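{- Let $k$ be a positive integer, let $m\ge 1$, let $1\le t_1<\cdots<t_m\le k$ be integers and let $a_1,\dots,a_m$ be positive integers. Then $$g^{(k)}_{R_{t_1}^{a_1}\cup\cdots\cup R_{t_m}^{a_m}}=g^{(k)}_{R_{t_1}^{a_1}}\,g^{(k)}_{R_{t_2}^{a_2}}\cdots g^{(k)}_{R_{t_m}^{a_m}}.$$
   Context: Partitions are identified with Young diagrams in French notation: the diagram of $\lambda=(\lambda_1\ge\lambda_2\ge\cdots)$ is the set of cells $(i,j)\in\mathbb{Z}_{>0}^2$ with $j\le\lambda_i$ (row $i$ counted from the bottom). $|\lambda|$ is the size, $l(\lambda)$ the number of nonzero parts, $\lambda'$ the conjugate, $\lambda\subset\mu$ means containment of diagrams. $\lambda\cup\mu$ is the partition whose multiset of parts is the union of the multisets of parts of $\lambda$ and $\mu$; $(s)$ is the one-part partition, and $\lambda\cup(0)=\lambda$. A partition is $k$-bounded if $\lambda_1\le k$; $\mathcal{P}^k$ denotes the set of $k$-bounded partitions. For $1\le t\le k$, $R_t=(t^{k+1-t})$ (the partition with $k+1-t$ parts equal to $t$) and $R_t^a$ is the union of $a$ copies of $R_t$. The hook length of a cell $c=(i,j)\in\lambda$ is $h_c(\lambda)=\lambda_i+\lambda'_j-i-j+1$. A $(k+1)$-core is a partition none of whose cells has hook length $k+1$; its length $|\kappa|_{k+1}$ is the number of its cells with hook length $<k+1$. The map $\mathfrak{p}$ with $\mathfrak{p}(\kappa)_i=\#\{j:(i,j)\in\kappa,\ h_{(i,j)}(\kappa)\le k\}$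 is a bijection from $(k+1)$-cores to $\mathcal{P}^k$; its inverse is denoted $\mathfrak{c}$. The residue of a cell $(i,j)$ is $j-i\bmod (k+1)$. For $(k+1)$-cores $\tau\subset\kappa$, $\kappa/\tau$ is a weak strip of size $r$ (weak $r$-strip) if $\kappa/\tau$ is a horizontal strip, $|\kappa|_{k+1}=|\tau|_{k+1}+r$, and the cells of $\kappa/\tau$ have exactly $r$ distinct residues. A removable corner of $\mu$ is a cell $(i,j)\in\mu$ with $(i+1,j),(i,j+1)\notin\mu$; a cell $(i,j)$ is $\lambda$-blocked if $(i+1,j)\in\lambda$; $r_{\lambda\mu}$ denotes the number of distinct residues of removable corners of $\mu$ that are not $\lambda$-blocked. Let $h_r$ be the complete homogeneous symmetric functions ($h_0=1$, $h_r=0$ for $r<0$) and $\Lambda^{(k)}=\mathbb{Z}[h_1,\dots,h_k]$. Binomial coefficients: $\binom{a}{b}=a(a-1)\cdots(a-b+1)/b!$ for $a\in\mathbb{Z}$, $b\in\mathbb{Z}_{\ge0}$, and $\binom ab=0$ for $b<0$. The $K$-$k$-Schur functions $\{g^{(k)}_\lambda\}_{\lambda\in\mathcal P^k}$ are the unique family of elements of $\Lambda^{(k)}$ with $g^{(k)}_\emptyset=1$ and, for all $\lambda\in\mathcal{P}^k$ and $0\le r\le k$, $$h_r\,g^{(k)}_\lambda=\sum_{s=0}^{r}(-1)^{r-s}\sum_{\mu\in\mathcal P^k:\ \mathfrak c(\mu)/\mathfrak c(\lambda)\text{ weak }s\text{ -strip}}\binom{r_{\mathfrak c(\mu)\mathfrak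 c(\lambda)}}{r-s}g^{(k)}_\mu .$$ They form a $\mathbb{Z}$-basis of $\Lambda^{(k)}$ and $g^{(k)}_{(r)}=h_r$ for $1\le r\le k$. -}

module Defs where

open import Data.Bool.Base using (Bool; true; false; _∧_; not; if_then_else_; T)
open import Data.Nat.Base as ℕ using (ℕ; zero; suc; _+_; _∸_; _≤ᵇ_; _<ᵇ_; _≡ᵇ_)
open import Data.Nat.Properties using () renaming (_≟_ to _≟ℕ_)
open import Data.Nat.Combinatorics.Base using (_C_)
open import Data.Integer.Base as ℤ using (ℤ; +_; -[1+_]; _%ℕ_)
open import Data.List.Base
  using (List; []; _∷_; [_]; _++_; map; concatMap; foldr; length; upTo; filterᵇ; deduplicate; allFin)
open import Data.Bool.ListAction using (and)
open import Data.Fin.Base using (Fin)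
open import Data.Vec.Base as Vec using (Vec; zipWith; replicate; updateAt)
open import Data.Vec.Properties using (≡-dec)
open import Data.Product.Base using (_×_; _,_)
open import Relation.Nullary.Decidable.Core using (does)
open import Relation.Binary.PropositionalEquality using (_≡_)

-- The ring Λ^(k) = ℤ[h₁,…,h_k], modelled as the polynomial ring over ℤ
-- in k commuting indeterminates x₁,…,x_k (with h_r = x_r, 1 ≤ r ≤ k).
-- A polynomial is a finite formal sum of terms (coefficient, exponent
-- vector); two polynomials are equal iff all their coefficients agree.

Mono : ℕ → Set
Mono k = Vec ℕ k

Poly : ℕ → Set
Poly k = List (ℤ × Mono k)

coeff : ∀ {k} → Poly k → Mono k → ℤ
coeff [] m = + 0
coeff ((c , e) ∷ p) m =
  (if does (≡-dec _≟ℕ_ e m) then c else + 0) ℤ.+ coeff p m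

infix 4 _≈_
_≈_ : ∀ {k} → Poly k → Poly k → Set
p ≈ q = ∀ m → coeff p m ≡ coeff q m

infixl 6 _+P_
_+P_ : ∀ {k} → Poly k → Poly k → Poly k
p +P q = p ++ q

infixl 7 _*P_
_*P_ : ∀ {k} → Poly k → Poly k → Poly k
p *P q = concatMap (λ { (c , e) → map (λ { (d , f) → (c ℤ.* d , zipWith _+_ e f) }) q }) p

scale : ∀ {k} → ℤ → Poly k → Poly k
scale c p = map (λ { (d , f) → (c ℤ.* d , f) }) p

1P : ∀ {k} → Poly k
1P = [ (+ 1 , replicate _ 0) ]

sumP : ∀ {k} → List (Poly k) → Poly k
sumP = foldr _+P_ []

prodP : ∀ {k} → List (Poly k) → Poly k
prodP = foldr _*P_ 1P

unitMono : (k r : ℕ) → Mono k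
unitMono zero r = Vec.[]
unitMono (suc k) zero = 1 Vec.∷ replicate k 0
unitMono (suc k) (suc r) = 0 Vec.∷ unitMono k r

-- h r : h_0 = 1, h_r = x_r for 1 ≤ r ≤ k
-- (the value for r > k is never used)
h : (k r : ℕ) → Poly k
h k zero = 1P
h k (suc r) = if suc r ≤ᵇ k then [ (+ 1 , unitMono k r) ] else []

-- Partitions as lists of parts (bottom row first in French notation).

isPartitionᵇ : List ℕ → Bool
isPartitionᵇ [] = true
isPartitionᵇ (x ∷ []) = 1 ≤ᵇ x
isPartitionᵇ (x ∷ y ∷ xs) = (y ≤ᵇ x) ∧ isPartitionᵇ (y ∷ xs)

-- λ_i for i ≥ 1 (0 beyond the length; index 0 is junk = 0)
part : List ℕ → ℕ → ℕ
part [] _ = 0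
part (x ∷ xs) zero = 0
part (x ∷ xs) (suc zero) = x
part (x ∷ xs) (suc (suc i)) = part xs (suc i)

range : ℕ → List ℕ
range n = map suc (upTo n)

conj : List ℕ → ℕ → ℕ
conj λ' j = length (filterᵇ (λ x → j ≤ᵇ x) λ')

Cell : Set
Cell = ℕ × ℕ

cells : List ℕ → List Cell
cells λ' = concatMap (λ i → map (λ j → (i , j)) (range (part λ' i))) (range (length λ'))

-- hook length λ_i + λ'_j - i - j + 1 (for cells of λ this is ≥ 1)
hook : List ℕ → Cell → ℕ
hook λ' (i , j) = (part λ' i + conj λ' j + 1) ∸ (i + j)

isCoreᵇ : ℕ → List ℕ → Bool
isCoreᵇ k κ = isPartitionᵇ κ ∧ and (map (λ c → not (hook κ c ≡ᵇ suc k)) (cells κ))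

IsCore : ℕ → List ℕ → Set
IsCore k κ = T (isCoreᵇ k κ)

-- the map 𝔭 : (k+1)-cores → k-bounded partitions (zero parts dropped)
pmap : ℕ → List ℕ → List ℕ
pmap k κ = filterᵇ (λ x → 1 ≤ᵇ x)
  (map (λ i → length (filterᵇ (λ j → hook κ (i , j) ≤ᵇ k) (range (part κ i))))
       (range (length κ)))

klen : ℕ → List ℕ → ℕ
klen k κ = length (filterᵇ (λ c → hook κ c ≤ᵇ k) (cells κ))

residue : ℕ → Cell → ℕ
residue k (i , j) = ((+ j) ℤ.- (+ i)) %ℕ suc k

nDistinct : List ℕ → ℕ
nDistinct xs = length (deduplicate _≟ℕ_ xs)

containedᵇ : List ℕ → List ℕ → Bool
containedᵇ τ κ = and (map (λ i → part τ i ≤ᵇ part κ i) (range (length τ)))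

hstripᵇ : List ℕ → List ℕ → Bool
hstripᵇ κ τ = containedᵇ τ κ ∧ and (map (λ i → part κ (suc i) ≤ᵇ part τ i) (range (length κ)))

skewCells : List ℕ → List ℕ → List Cell
skewCells κ τ = filterᵇ (λ { (i , j) → part τ i <ᵇ j }) (cells κ)

weakStripᵇ : ℕ → ℕ → List ℕ → List ℕ → Bool
weakStripᵇ k s κ τ =
  hstripᵇ κ τ ∧ (klen k κ ≡ᵇ klen k τ + s)
  ∧ (nDistinct (map (residue k) (skewCells κ τ)) ≡ᵇ s)

-- r_{κτ}: number of distinct residues of removable corners of τ not κ-blocked
rCount : ℕ → List ℕ → List ℕ → ℕ
rCount k κ τ = nDistinct (map (residue k)
  (filterᵇ (λ { (i , j) → (j ≡ᵇ part τ i) ∧ (part τ (suc i) <ᵇ j)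
                           ∧ not (j ≤ᵇ part κ (suc i)) })
           (cells τ)))

between : ℕ → ℕ → List ℕ
between lo hi = map (λ d → lo + d) (upTo (suc (hi ∸ lo)))

ext : ℕ → List ℕ → List (List ℕ)
ext ub [] = [ [] ]
ext ub (x ∷ xs) = concatMap (λ y → map (y ∷_) (ext x xs)) (between x ub)

-- Candidate shapes κ ⊇ τ for a weak s-strip with s ≤ k: all horizontal
-- strips over τ adding at most k cells in row 1 (a weak s-strip with
-- s ≤ k cannot add more than k cells in row 1, since k+1 consecutive
-- cells of a row have k+1 distinct residues). Non-strips are filtered out
-- below anyway, so this is just a finite superset of the index set.
cands : ℕ → List ℕ → List (List ℕ)
cands k τ = map (filterᵇ (λ x → 1 ≤ᵇ x)) (ext (part τ 1 + k) (τ ++ [ 0 ]))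

sign : ℕ → ℤ
sign n = -[1+ 0 ] ℤ.^ n

-- right-hand side of the K-k-Schur Pieri rule for h_r g_{𝔭(τ)},
-- indexed by cores κ = 𝔠(μ)
pieriRHS : (k : ℕ) → (List ℕ → Poly k) → List ℕ → ℕ → Poly k
pieriRHS k g τ r =
  sumP (map (λ s →
    sumP (map (λ κ → scale (sign (r ∸ s) ℤ.* (+ (rCount k κ τ C (r ∸ s)))) (g (pmap k κ)))
              (filterᵇ (λ κ → isCoreᵇ k κ ∧ weakStripᵇ k s κ τ) (cands k τ))))
    (upTo (suc r)))

-- g is the family of K-k-Schur functions g^{(k)}_λ (λ ∈ 𝒫^k), characterised
-- by g_∅ = 1 and the Pieri rule for all λ = 𝔭(τ) and 0 ≤ r ≤ k.
record IsKkSchur (k : ℕ) (g : List ℕ → Poly k) : Set where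
  field
    g-empty : g [] ≈ 1P
    pieri : (τ : List ℕ) → IsCore k τ → (r : ℕ) → r ℕ.≤ k →
            h k r *P g (pmap k τ) ≈ pieriRHS k g τ r

Rpow : (k t a : ℕ) → List ℕ
Rpow k t a = Data.List.Base.replicate (a ℕ.* (suc k ∸ t)) t
  where import Data.List.Base

insertD : ℕ → List ℕ → List ℕ
insertD x [] = [ x ]
insertD x (y ∷ ys) = if y ≤ᵇ x then x ∷ y ∷ ys else y ∷ insertD x ys

infixr 5 _∪P_
_∪P_ : List ℕ → List ℕ → List ℕ
λ' ∪P μ = foldr insertD μ λ'

bigUnion : (m : ℕ) → (Fin m → List ℕ) → List ℕ
bigUnion m f = foldr _∪P_ [] (map f (allFin m))

-- It suffices to split off the smallest rectangle: if P = R_T^a and all parts of λ exceed T, then g_{λ ∪ P} = g_P g_λ.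
-- The core of λ ∪ P is the core of λ, moved to the right by the width of the core of P, with the core of P on top.
-- Hence the weak strips over 𝔠(λ ∪ P) correspond to those over 𝔠(λ): writing the latter as 𝔠(μ ∪ (s)) / 𝔠(λ), with s
-- the length of the new top row, the partner is 𝔠(μ ∪ P ∪ (s)) / 𝔠(λ ∪ P); it has the same size, and one more unblocked
-- residue exactly when s < T. Moreover s ↦ s + 1 maps the strips with s < T bijectively to those with 1 ≤ s ≤ T and keeps
-- the unblocked residues. By Pascal's rule the Pieri rule for λ ∪ P is therefore the Pieri rule for λ with
-- g_{μ ∪ P ∪ (s)} − [1 ≤ s ≤ T] g_{μ ∪ P ∪ (s − 1)} in the place of g_{μ ∪ (s)}, and induction on the number of rows, the
-- size and s identifies this difference with g_P g_{μ ∪ (s)}.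
module Submission where

open import Defs

-- The length and residue conditions of a weak strip are global. An inequality valid for every
-- horizontal strip `f` / `g` of cores makes them local: the length grows by at most the number of
-- distinct residues (`size-≤`), row by row if each residue is counted in the highest row where it
-- occurs (`row-walk`). Weak strips are the case of equality, hence of equality in every row. So no
-- part shrinks; a cell that fits into the top row belongs to the strip as soon as its residue
-- occurs anywhere in the strip (`crossed⇒top`); and unstacking preserves weakness, because the
-- length of the result is squeezed between two bounds. Stacking needs parts above `T`: a bead of λ
-- moved down by k + 1 past the rows of λ then lands in the lowest block of the rectangle core,
-- whose rows after the first have the constant length `w`. It is also required that `T` < k:
-- shortening a top row of length `T` refers to column `T` + 1, which must be at most k. The smaller
-- of two rectangles satisfies this.

-- Linear arithmetic over ℕ by reflection

module LinearArithmetic where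
  open import Data.Bool.Base using (Bool; true; false; _∧_; T; if_then_else_)
  open import Data.Nat.Base using (ℕ; zero; suc; _+_; _*_; _≤_; _<_; _≤ᵇ_; z≤n)
  open import Data.Nat.Properties
  open import Data.Integer.Base as ℤ using (ℤ; +_; -[1+_])
  open import Data.List.Base as L using (List; []; _∷_; _++_)
  open import Data.Vec.Base as V using (Vec; []; _∷_; allFin)
  open import Data.Vec.N-ary using (N-ary; _$ⁿ_)
  open import Data.Fin.Base using (Fin; zero; suc)
  open import Data.Product.Base using (_×_; _,_; proj₁; proj₂)
  open import Data.Maybe.Base using (Maybe; just; nothing)
  open import Data.Empty using (⊥)
  open import Data.Unit.Base using (tt)
  open import Algebra.Properties.CommutativeSemigroup +-commutativeSemigroup using () renaming (interchange to +-interchange)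
  open import Relation.Binary.PropositionalEquality

  infixl 7 _⊕_
  data Exp (n : ℕ) : Set where
    var : Fin n → Exp n
    con : ℕ → Exp n
    _⊕_ : Exp n → Exp n → Exp n

  infix 6 _≼_ _≺_ _≐_
  data Rel (n : ℕ) : Set where
    _≼_ _≺_ _≐_ : Exp n → Exp n → Rel n

  infix 5 ⊢_
  infixr 4 _⇒_
  data Stmt (n : ℕ) : Set where
    _⇒_ : Rel n → Stmt n → Stmt n
    ⊢_ : Rel n → Stmt n
    ⊢⊥ : Stmt n

  ⟦_⟧ᵉ : ∀ {n} → Exp n → Vec ℕ n → ℕ
  ⟦ var i ⟧ᵉ ρ = V.lookup ρ i
  ⟦ con c ⟧ᵉ ρ = c
  ⟦ a ⊕ b ⟧ᵉ ρ = ⟦ a ⟧ᵉ ρ + ⟦ b ⟧ᵉ ρ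

  ⟦_⟧ʳ : ∀ {n} → Rel n → Vec ℕ n → Set
  ⟦ a ≼ b ⟧ʳ ρ = ⟦ a ⟧ᵉ ρ ≤ ⟦ b ⟧ᵉ ρ
  ⟦ a ≺ b ⟧ʳ ρ = ⟦ a ⟧ᵉ ρ < ⟦ b ⟧ᵉ ρ
  ⟦ a ≐ b ⟧ʳ ρ = ⟦ a ⟧ᵉ ρ ≡ ⟦ b ⟧ᵉ ρ

  ⟦_⟧ˢ : ∀ {n} → Stmt n → Vec ℕ n → Set
  ⟦ r ⇒ s ⟧ˢ ρ = ⟦ r ⟧ʳ ρ → ⟦ s ⟧ˢ ρ
  ⟦ ⊢ r ⟧ˢ ρ = ⟦ r ⟧ʳ ρ
  ⟦ ⊢⊥ ⟧ˢ ρ = ⊥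

  -- a linear form: the constant term, then the coefficients
  Form : ℕ → Set
  Form n = Vec ℕ (suc n)

  dot : ∀ {n} → Vec ℕ n → Vec ℕ n → ℕ
  dot [] [] = 0
  dot (a ∷ as) (x ∷ xs) = a * x + dot as xs

  val : ∀ {n} → Form n → Vec ℕ n → ℕ
  val F ρ = dot F (1 ∷ ρ)

  _+ᶠ_ : ∀ {n} → Vec ℕ n → Vec ℕ n → Vec ℕ n
  _+ᶠ_ = V.zipWith _+_

  _*ᶠ_ : ∀ {n} → ℕ → Vec ℕ n → Vec ℕ n
  c *ᶠ F = V.map (c *_) F

  0ᶠ : ∀ {n} → Vec ℕ n
  0ᶠ = V.replicate _ 0

  unit : ∀ {n} → Fin n → Vec ℕ n
  unit zero = 1 ∷ 0ᶠ
  unit (suc i) = 0 ∷ unit i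

  dot-+ : ∀ {n} (a b x : Vec ℕ n) → dot (a +ᶠ b) x ≡ dot a x + dot b x
  dot-+ [] [] [] = refl
  dot-+ (a ∷ as) (b ∷ bs) (x ∷ xs) rewrite dot-+ as bs xs = eq a b x (dot as xs) (dot bs xs)
    where eq : ∀ a b x p q → (a + b) * x + (p + q) ≡ (a * x + p) + (b * x + q)
          eq a b x p q rewrite *-distribʳ-+ x a b = +-interchange (a * x) (b * x) p q

  dot-* : ∀ {n} c (a x : Vec ℕ n) → dot (c *ᶠ a) x ≡ c * dot a x
  dot-* c [] [] = sym (*-zeroʳ c)
  dot-* c (a ∷ as) (x ∷ xs) rewrite dot-* c as xs = eq c a x (dot as xs)
    where eq : ∀ c a x p → c * a * x + c * p ≡ c * (a * x + p)
          eq c a x p rewrite *-assoc c a x = sym (*-distribˡ-+ c (a * x) p)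

  dot-0 : ∀ {n} (x : Vec ℕ n) → dot 0ᶠ x ≡ 0
  dot-0 [] = refl
  dot-0 (x ∷ xs) = dot-0 xs

  dot-unit : ∀ {n} (i : Fin n) x → dot (unit i) x ≡ V.lookup x i
  dot-unit zero (x ∷ xs) rewrite dot-0 xs = trans (+-identityʳ _) (+-identityʳ x)
  dot-unit (suc i) (x ∷ xs) = dot-unit i xs

  form : ∀ {n} → Exp n → Form n
  form (var i) = 0 ∷ unit i
  form (con c) = c ∷ 0ᶠ
  form (a ⊕ b) = form a +ᶠ form b

  val-form : ∀ {n} (e : Exp n) ρ → val (form e) ρ ≡ ⟦ e ⟧ᵉ ρ
  val-form (var i) ρ = dot-unit i ρ
  val-form (con c) ρ rewrite dot-0 ρ = trans (+-identityʳ _) (*-identityʳ c)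
  val-form (a ⊕ b) ρ = trans (dot-+ (form a) (form b) (1 ∷ ρ)) (cong₂ _+_ (val-form a ρ) (val-form b ρ))

  data Con (n : ℕ) : Set where
    leᶜ eqᶜ : Form n → Form n → Con n

  holds : ∀ {n} → Con n → Vec ℕ n → Set
  holds (leᶜ a b) ρ = val a ρ ≤ val b ρ
  holds (eqᶜ a b) ρ = val a ρ ≡ val b ρ

  con-of : ∀ {n} → Rel n → Con n
  con-of (a ≼ b) = leᶜ (form a) (form b)
  con-of (a ≺ b) = leᶜ (form (con 1 ⊕ a)) (form b)
  con-of (a ≐ b) = eqᶜ (form a) (form b)

  con-sound : ∀ {n} (r : Rel n) ρ → ⟦ r ⟧ʳ ρ → holds (con-of r) ρ
  con-sound (a ≼ b) ρ h rewrite val-form a ρ | val-form b ρ = h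
  con-sound (a ≺ b) ρ h rewrite val-form (con 1 ⊕ a) ρ | val-form b ρ = h
  con-sound (a ≐ b) ρ h rewrite val-form a ρ | val-form b ρ = h

  data All-hold {n} (ρ : Vec ℕ n) : List (Con n) → Set where
    [] : All-hold ρ []
    _∷_ : ∀ {c cs} → holds c ρ → All-hold ρ cs → All-hold ρ (c ∷ cs)

  -- A negative multiplier is only meaningful for an equation, where it exchanges the sides.
  combine : ∀ {n} → List (Con n) → List ℤ → Form n × Form n
  combine (leᶜ a b ∷ cs) (+ m ∷ ms) = let (x , y) = combine cs ms in (m *ᶠ a) +ᶠ x , (m *ᶠ b) +ᶠ y
  combine (eqᶜ a b ∷ cs) (+ m ∷ ms) = let (x , y) = combine cs ms in (m *ᶠ a) +ᶠ x , (m *ᶠ b) +ᶠ y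
  combine (eqᶜ a b ∷ cs) (-[1+ m ] ∷ ms) = let (x , y) = combine cs ms in (suc m *ᶠ b) +ᶠ x , (suc m *ᶠ a) +ᶠ y
  combine (leᶜ a b ∷ cs) (-[1+ m ] ∷ ms) = combine cs ms
  combine _ _ = 0ᶠ , 0ᶠ

  val-mono : ∀ {n} m (a b x y : Form n) ρ → val a ρ ≤ val b ρ → val x ρ ≤ val y ρ →
    val ((m *ᶠ a) +ᶠ x) ρ ≤ val ((m *ᶠ b) +ᶠ y) ρ
  val-mono m a b x y ρ p q
    rewrite dot-+ (m *ᶠ a) x (1 ∷ ρ) | dot-+ (m *ᶠ b) y (1 ∷ ρ) | dot-* m a (1 ∷ ρ) | dot-* m b (1 ∷ ρ)
    = +-mono-≤ (*-monoʳ-≤ m p) q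

  combine-sound : ∀ {n} ρ (cs : List (Con n)) ms → All-hold ρ cs →
    val (proj₁ (combine cs ms)) ρ ≤ val (proj₂ (combine cs ms)) ρ
  combine-sound ρ [] ms h = ≤-refl
  combine-sound ρ (leᶜ a b ∷ cs) [] h = ≤-refl
  combine-sound ρ (eqᶜ a b ∷ cs) [] h = ≤-refl
  combine-sound ρ (leᶜ a b ∷ cs) (+ m ∷ ms) (h ∷ hs) = val-mono m a b _ _ ρ h (combine-sound ρ cs ms hs)
  combine-sound ρ (leᶜ a b ∷ cs) (-[1+ m ] ∷ ms) (h ∷ hs) = combine-sound ρ cs ms hs
  combine-sound ρ (eqᶜ a b ∷ cs) (+ m ∷ ms) (h ∷ hs) = val-mono m a b _ _ ρ (≤-reflexive h) (combine-sound ρ cs ms hs)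
  combine-sound ρ (eqᶜ a b ∷ cs) (-[1+ m ] ∷ ms) (h ∷ hs) =
    val-mono (suc m) b a _ _ ρ (≤-reflexive (sym h)) (combine-sound ρ cs ms hs)

  _≤ᶠ_ : ∀ {n} → Vec ℕ n → Vec ℕ n → Bool
  [] ≤ᶠ [] = true
  (a ∷ as) ≤ᶠ (b ∷ bs) = (a ≤ᵇ b) ∧ (as ≤ᶠ bs)

  ∧-T : ∀ a b → T (a ∧ b) → T a × T b
  ∧-T true b h = tt , h

  ≤ᶠ-sound : ∀ {n} (a b x : Vec ℕ n) → T (a ≤ᶠ b) → dot a x ≤ dot b x
  ≤ᶠ-sound [] [] [] h = z≤n
  ≤ᶠ-sound (a ∷ as) (b ∷ bs) (x ∷ xs) h with ∧-T (a ≤ᵇ b) (as ≤ᶠ bs) h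
  ... | p , q = +-mono-≤ (*-monoˡ-≤ x (≤ᵇ⇒≤ a b p)) (≤ᶠ-sound as bs xs q)

  -- The combination asserts left ≤ right. This is absurd once the left form dominates 1 + right
  -- coefficient by coefficient, because the variables are natural numbers.
  refutes : ∀ {n} → List (Con n) → List ℤ → Bool
  refutes {n} cs ms = ((1 ∷ 0ᶠ) +ᶠ proj₂ (combine cs ms)) ≤ᶠ proj₁ (combine cs ms)

  refutes-sound : ∀ {n} ρ (cs : List (Con n)) ms → T (refutes cs ms) → All-hold ρ cs → ⊥
  refutes-sound ρ cs ms t h = <⇒≱ lt (combine-sound ρ cs ms h)
    where
    x = proj₁ (combine cs ms)
    y = proj₂ (combine cs ms)
    lt : val y ρ < val x ρ
    lt = ≤-trans (≤-reflexive (sym (trans (dot-+ (1 ∷ 0ᶠ) y (1 ∷ ρ)) (cong (λ z → suc z + val y ρ) (dot-0 ρ)))))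
                 (≤ᶠ-sound ((1 ∷ 0ᶠ) +ᶠ y) x (1 ∷ ρ) t)

  -- Fourier–Motzkin search for the multipliers. A row is a form that is ≥ 0 (or = 0),
  -- with the multipliers that produce it.
  record Row : Set where
    constructor row⟨_,_,_,_⟩
    field
      isEq : Bool
      const : ℤ
      coefs : List ℤ
      mult : List ℤ

  zipℤ : (ℤ → ℤ → ℤ) → List ℤ → List ℤ → List ℤ
  zipℤ f (x ∷ xs) (y ∷ ys) = f x y ∷ zipℤ f xs ys
  zipℤ f [] ys = L.map (f (+ 0)) ys
  zipℤ f xs [] = L.map (λ x → f x (+ 0)) xs

  lincomb : Bool → ℤ → Row → ℤ → Row → Row
  lincomb e a row⟨ _ , p , ps , ms ⟩ b row⟨ _ , q , qs , ns ⟩ = row⟨ e , f p q , zipℤ f ps qs , zipℤ f ms ns ⟩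
    where f : ℤ → ℤ → ℤ
          f x y = (a ℤ.* x) ℤ.+ (b ℤ.* y)

  headℤ : List ℤ → ℤ
  headℤ [] = + 0
  headℤ (x ∷ _) = x

  drop1 : Row → Row
  drop1 row⟨ e , p , ps , ms ⟩ = row⟨ e , p , L.drop 1 ps , ms ⟩

  isZero isPos isNeg : ℤ → Bool
  isZero (+ 0) = true
  isZero _ = false
  isPos (+ suc _) = true
  isPos _ = false
  isNeg -[1+ _ ] = true
  isNeg _ = false

  lead : Row → ℤ
  lead r = headℤ (Row.coefs r)

  findEq : List Row → Maybe Row
  findEq [] = nothing
  findEq (r ∷ rs) = if Row.isEq r then (if isZero (lead r) then findEq rs else just r) else findEq rs

  elimEq : Row → Row → Row
  elimEq e r = if isZero (lead r) then r
    -- The row `r` gets a positive factor, so that an inequality keeps its direction; the sign goes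
    -- to the equation `e`.
    else lincomb (Row.isEq r) (+ ℤ.∣ lead e ∣) r (sgn (lead e) ℤ.* (ℤ.- lead r)) e
    where sgn : ℤ → ℤ
          sgn (+ _) = + 1
          sgn -[1+ _ ] = -[1+ 0 ]

  useless : Row → Bool
  useless row⟨ e , p , ps , _ ⟩ = go (p ∷ ps)
    where go : List ℤ → Bool
          go [] = true
          go (-[1+ _ ] ∷ _) = false
          go (+ 0 ∷ xs) = go xs
          go (+ suc _ ∷ xs) = if e then false else go xs

  prune : List Row → List Row
  prune = L.filterᵇ (λ r → if useless r then false else true)

  pairUp : List Row → List Row → List Row
  pairUp ps ns = L.concatMap (λ p → L.map (λ q → lincomb false (ℤ.- lead q) p (lead p) q) ns) ps

  -- The variable to be eliminated is ≥ 0. No multiplier is recorded for this row, since the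
  -- coefficientwise comparison `≤ᶠ` in `refutes` already accounts for it.
  nonneg : ℕ → Row
  nonneg m = row⟨ false , + 0 , + 1 ∷ [] , [] ⟩

  elim1 : List Row → List Row
  elim1 rs with findEq rs
  ... | just e = prune (L.map (λ r → drop1 (elimEq e r)) (nonneg 0 ∷ rs))
  ... | nothing =
    let rs′ = nonneg 0 ∷ rs in
    prune (L.map drop1 (L.filterᵇ (λ r → isZero (lead r)) rs′
      ++ pairUp (L.filterᵇ (λ r → isPos (lead r)) rs′) (L.filterᵇ (λ r → isNeg (lead r)) rs′)))

  elimAll : ℕ → List Row → List Row
  elimAll zero rs = rs
  elimAll (suc n) rs = elimAll n (elim1 rs)

  pick : List Row → List ℤ
  pick [] = []
  pick (row⟨ _ , -[1+ _ ] , _ , ms ⟩ ∷ _) = ms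
  pick (row⟨ true , + suc _ , _ , ms ⟩ ∷ _) = L.map (ℤ.-_) ms
  pick (_ ∷ rs) = pick rs

  initialRows : ∀ {n} → List (Con n) → List Row
  initialRows cs = go cs (+ 1 ∷ [])
    where
    dif : ∀ {n} → Vec ℕ n → Vec ℕ n → List ℤ
    dif [] [] = []
    dif (a ∷ as) (b ∷ bs) = (b ℤ.⊖ a) ∷ dif as bs
    go : ∀ {n} → List (Con n) → List ℤ → List Row
    go [] u = []
    go (leᶜ (a ∷ as) (b ∷ bs) ∷ cs) u = row⟨ false , b ℤ.⊖ a , dif as bs , u ⟩ ∷ go cs (+ 0 ∷ u)
    go (eqᶜ (a ∷ as) (b ∷ bs) ∷ cs) u = row⟨ true , b ℤ.⊖ a , dif as bs , u ⟩ ∷ go cs (+ 0 ∷ u)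

  -- Nothing is proved about the search. Its multipliers are only a guess, which `refutes` checks
  -- again.
  certificate : ∀ {n} → List (Con n) → List ℤ
  certificate {n} cs = pick (elimAll n (initialRows cs))

  refutable : ∀ {n} → List (Con n) → Bool
  refutable cs = refutes cs (certificate cs)

  decides : ∀ {n} → Stmt n → List (Con n) → Bool
  decides (r ⇒ s) cs = decides s (cs L.++ con-of r ∷ [])
  decides (⊢ (a ≼ b)) cs = refutable (cs L.++ con-of (b ≺ a) ∷ [])
  decides (⊢ (a ≺ b)) cs = refutable (cs L.++ con-of (b ≼ a) ∷ [])
  decides (⊢ (a ≐ b)) cs = refutable (cs L.++ con-of (b ≺ a) ∷ []) ∧ refutable (cs L.++ con-of (a ≺ b) ∷ [])
  decides ⊢⊥ cs = refutable cs

  snoc : ∀ {n} {ρ : Vec ℕ n} {cs c} → All-hold ρ cs → holds c ρ → All-hold ρ (cs L.++ c ∷ [])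
  snoc [] h = h ∷ []
  snoc (x ∷ xs) h = x ∷ snoc xs h

  decides-sound : ∀ {n} (s : Stmt n) ρ cs → T (decides s cs) → All-hold ρ cs → ⟦ s ⟧ˢ ρ
  decides-sound (r ⇒ s) ρ cs t hs h = decides-sound s ρ _ t (snoc hs (con-sound r ρ h))
  decides-sound (⊢ (a ≼ b)) ρ cs t hs = ≮⇒≥ λ h → refutes-sound ρ _ (certificate (cs L.++ con-of (b ≺ a) ∷ [])) t (snoc hs (con-sound (b ≺ a) ρ h))
  decides-sound (⊢ (a ≺ b)) ρ cs t hs = ≰⇒> λ h → refutes-sound ρ _ (certificate (cs L.++ con-of (b ≼ a) ∷ [])) t (snoc hs (con-sound (b ≼ a) ρ h))
  decides-sound (⊢ (a ≐ b)) ρ cs t hs with ∧-T (refutable (cs L.++ con-of (b ≺ a) ∷ [])) _ t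
  ... | t₁ , t₂ = ≤-antisym (decides-sound (⊢ (a ≼ b)) ρ cs t₁ hs) (decides-sound (⊢ (b ≼ a)) ρ cs t₂ hs)
  decides-sound ⊢⊥ ρ cs t hs = refutes-sound ρ cs (certificate cs) t hs

  vars : ∀ {n} → Vec (Exp n) n
  vars = V.map var (allFin _)

  -- The implicit argument computes to the unit type when the search succeeds. The entries of `ρ`
  -- are atoms, so products such as `m * n` are passed as variables.
  lin : ∀ {n} (ρ : Vec ℕ n) (f : N-ary n (Exp n) (Stmt n)) → {T (decides (f $ⁿ vars) [])} → ⟦ f $ⁿ vars ⟧ˢ ρ
  lin ρ f {t} = decides-sound (f $ⁿ vars) ρ [] t []

-- Integer sums, polynomials and Pieri coefficients

module Polynomials where
  open import Data.Bool.Base using (Bool; true; false; if_then_else_; T)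
  open import Data.Nat.Base as ℕ using (ℕ; zero; suc; _≤_; _<_; _∸_; _≤ᵇ_; z≤n; s≤s)
  open import Data.Nat.Properties using (≤-<-connex; ≤ᵇ⇒≤; ≤⇒≤ᵇ; <⇒≱; m+n∸m≡n; m≤n⇒m<n∨m≡n; ≤-refl; n∸n≡0; +-suc; m+[n∸m]≡n; ≤-trans) renaming (_≟_ to _≟ℕ_)
  import Data.Nat.Properties as ℕₚ
  open import Data.Integer.Base using (ℤ; +_; -[1+_]; _+_; _*_; -_; _-_)
  open import Data.Integer.Properties using (+-identityˡ; +-identityʳ; +-assoc; +-comm; *-zeroʳ; *-distribˡ-+; neg-distrib-+; *-comm; *-assoc; *-identityˡ; +-commutativeSemigroup; pos-+; -1*i≡-i)
  open import Data.List.Base as L using (List; []; _∷_; _++_; map; concatMap; filterᵇ)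
  open import Data.List.Membership.Propositional using (_∈_)
  open import Data.List.Relation.Unary.Any using (here; there)
  open import Data.Vec.Base as V using (Vec; []; _∷_; zipWith)
  open import Data.Vec.Properties using (≡-dec; zipWith-comm; zipWith-assoc; zipWith-identityˡ)
  open import Data.Product.Base using (_×_; _,_; ∃)
  open import Data.Sum.Base using (_⊎_; inj₁; inj₂)
  open import Data.Empty using (⊥-elim)
  open import Function.Base using (_∘_)
  open import Relation.Nullary using (Dec; yes; no)
  open import Relation.Nullary.Decidable using (does; dec-true; dec-false)
  open import Relation.Binary.PropositionalEquality
  open import Algebra.Properties.CommutativeSemigroup +-commutativeSemigroup using () renaming (interchange to +ℤ-interchange)
  open import Data.Nat.Combinatorics using (_C_; nCk+nC[k+1]≡[n+1]C[k+1])
  open import Data.List.Relation.Unary.All as All using ([]; _∷_)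
  open import Data.List.Relation.Unary.AllPairs using ([]; _∷_)
  open import Data.List.Relation.Unary.Unique.Propositional using (Unique)
  open import Data.Unit.Base using (tt)

  sumZ : ∀ {A : Set} → (A → ℤ) → List A → ℤ
  sumZ f [] = + 0
  sumZ f (x ∷ xs) = f x + sumZ f xs

  sumZ-cong : ∀ {A : Set} {f g : A → ℤ} xs → (∀ {x} → x ∈ xs → f x ≡ g x) → sumZ f xs ≡ sumZ g xs
  sumZ-cong [] h = refl
  sumZ-cong (x ∷ xs) h = cong₂ _+_ (h (here refl)) (sumZ-cong xs (h ∘ there))

  sumZ-++ : ∀ {A : Set} (f : A → ℤ) xs ys → sumZ f (xs ++ ys) ≡ sumZ f xs + sumZ f ys
  sumZ-++ f [] ys = sym (+-identityˡ _)
  sumZ-++ f (x ∷ xs) ys = trans (cong (λ z → f x + z) (sumZ-++ f xs ys)) (sym (+-assoc (f x) _ _))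

  sumZ-map : ∀ {A B : Set} (f : B → ℤ) (g : A → B) xs → sumZ f (map g xs) ≡ sumZ (f ∘ g) xs
  sumZ-map f g [] = refl
  sumZ-map f g (x ∷ xs) = cong (λ z → f (g x) + z) (sumZ-map f g xs)

  sumZ-concatMap : ∀ {A B : Set} (f : B → ℤ) (g : A → List B) xs → sumZ f (concatMap g xs) ≡ sumZ (λ x → sumZ f (g x)) xs
  sumZ-concatMap f g [] = refl
  sumZ-concatMap f g (x ∷ xs) = trans (sumZ-++ f (g x) _) (cong (λ z → sumZ f (g x) + z) (sumZ-concatMap f g xs))

  sumZ-zero : ∀ {A : Set} (xs : List A) → sumZ (λ _ → + 0) xs ≡ + 0
  sumZ-zero [] = refl
  sumZ-zero (x ∷ xs) = trans (+-identityˡ _) (sumZ-zero xs)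

  sumZ-+ : ∀ {A : Set} (f g : A → ℤ) xs → sumZ (λ x → f x + g x) xs ≡ sumZ f xs + sumZ g xs
  sumZ-+ f g [] = refl
  sumZ-+ f g (x ∷ xs) = trans (cong (λ z → f x + g x + z) (sumZ-+ f g xs)) (+ℤ-interchange (f x) (g x) _ _)

  sumZ-* : ∀ {A : Set} c (f : A → ℤ) xs → sumZ (λ x → c * f x) xs ≡ c * sumZ f xs
  sumZ-* c f [] = sym (*-zeroʳ c)
  sumZ-* c f (x ∷ xs) = trans (cong (λ z → c * f x + z) (sumZ-* c f xs)) (sym (*-distribˡ-+ c (f x) _))

  sumZ-neg : ∀ {A : Set} (f : A → ℤ) xs → sumZ (λ x → - f x) xs ≡ - sumZ f xs
  sumZ-neg f [] = refl
  sumZ-neg f (x ∷ xs) = trans (cong (λ z → - f x + z) (sumZ-neg f xs)) (sym (neg-distrib-+ (f x) _))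

  sumZ-swap : ∀ {A B : Set} (f : A → B → ℤ) xs ys → sumZ (λ x → sumZ (f x) ys) xs ≡ sumZ (λ y → sumZ (λ x → f x y) xs) ys
  sumZ-swap f [] ys = sym (sumZ-zero ys)
  sumZ-swap f (x ∷ xs) ys = trans (cong (λ z → sumZ (f x) ys + z) (sumZ-swap f xs ys)) (sym (sumZ-+ (f x) _ ys))

  module _ {k : ℕ} where

    at : Mono k → ℤ → Mono k → ℤ
    at m c e = if does (≡-dec _≟ℕ_ e m) then c else + 0

    at-* : ∀ m c d e → at m (c * d) e ≡ c * at m d e
    at-* m c d e with does (≡-dec _≟ℕ_ e m)
    ... | true = refl
    ... | false = sym (*-zeroʳ c)

    coeff-sumZ : ∀ (p : Poly k) m → coeff p m ≡ sumZ (λ (c , e) → at m c e) p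
    coeff-sumZ [] m = refl
    coeff-sumZ ((c , e) ∷ p) m = cong (λ z → at m c e + z) (coeff-sumZ p m)

    coeff-++ : ∀ (p q : Poly k) m → coeff (p ++ q) m ≡ coeff p m + coeff q m
    coeff-++ p q m = trans (coeff-sumZ (p ++ q) m) (trans (sumZ-++ _ p q) (cong₂ _+_ (sym (coeff-sumZ p m)) (sym (coeff-sumZ q m))))

    coeff-scale : ∀ c (p : Poly k) m → coeff (scale c p) m ≡ c * coeff p m
    coeff-scale c p m = trans (coeff-sumZ (scale c p) m) (trans (sumZ-map _ _ p)
      (trans (sumZ-cong p (λ { {d , f} _ → at-* m c d f })) (trans (sumZ-* c _ p) (cong (λ z → c * z) (sym (coeff-sumZ p m))))))

    pair : Mono k → ℤ × Mono k → ℤ × Mono k → ℤ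
    pair m (c , e) (d , f) = at m (c * d) (zipWith ℕ._+_ e f)

    coeff-* : ∀ (p q : Poly k) m → coeff (p *P q) m ≡ sumZ (λ x → sumZ (pair m x) q) p
    coeff-* p q m = trans (coeff-sumZ (p *P q) m) (trans (sumZ-concatMap _ _ p)
      (sumZ-cong p (λ _ → trans (sumZ-map _ _ q) (sumZ-cong q (λ _ → refl)))))

    *P-comm : ∀ (p q : Poly k) → p *P q ≈ q *P p
    *P-comm p q m = trans (coeff-* p q m) (trans (sumZ-swap (pair m) p q) (trans
      (sumZ-cong q λ { {y} _ → sumZ-cong p λ { {x} _ → pair-comm x y } }) (sym (coeff-* q p m))))
      where
      pair-comm : ∀ x y → pair m x y ≡ pair m y x
      pair-comm (c , e) (d , f) = cong₂ (at m) (*-comm c d) (zipWith-comm ℕₚ.+-comm e f)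

    *P-assoc : ∀ (p q r : Poly k) → (p *P q) *P r ≈ p *P (q *P r)
    *P-assoc p q r m = begin
      coeff ((p *P q) *P r) m ≡⟨ coeff-* (p *P q) r m ⟩
      sumZ (λ x → sumZ (pair m x) r) (p *P q) ≡⟨ sumZ-concatMap _ _ p ⟩
      sumZ (λ x → sumZ (λ xy → sumZ (pair m xy) r) (map (mul x) q)) p ≡⟨ sumZ-cong p (λ { {x} _ → sumZ-map _ (mul x) q }) ⟩
      sumZ (λ x → sumZ (λ y → sumZ (pair m (mul x y)) r) q) p
        ≡⟨ sumZ-cong p (λ { {x} _ → sumZ-cong q (λ { {y} _ → sumZ-cong r (λ { {z} _ → pair-assoc x y z }) }) }) ⟩
      sumZ (λ x → sumZ (λ y → sumZ (λ z → pair m x (mul y z)) r) q) p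
        ≡⟨ sumZ-cong p (λ { {x} _ → sumZ-cong q (λ { {y} _ → sym (sumZ-map (pair m x) (mul y) r) }) }) ⟩
      sumZ (λ x → sumZ (λ y → sumZ (pair m x) (map (mul y) r)) q) p
        ≡⟨ sumZ-cong p (λ { {x} _ → sym (sumZ-concatMap (pair m x) (λ y → map (mul y) r) q) }) ⟩
      sumZ (λ x → sumZ (pair m x) (q *P r)) p ≡⟨ sym (coeff-* p (q *P r) m) ⟩
      coeff (p *P (q *P r)) m ∎
      where
      open ≡-Reasoning
      mul : ℤ × Mono k → ℤ × Mono k → ℤ × Mono k
      mul (c , e) (d , f) = c * d , zipWith ℕ._+_ e f
      pair-assoc : ∀ x y z → pair m (mul x y) z ≡ pair m x (mul y z)
      pair-assoc (c , e) (d , f) (b , h) = cong₂ (at m) (*-assoc c d b) (zipWith-assoc ℕₚ.+-assoc e f h)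

    *P-++ : ∀ (p q r : Poly k) m → coeff (p *P (q ++ r)) m ≡ coeff (p *P q) m + coeff (p *P r) m
    *P-++ p q r m = trans (coeff-* p (q ++ r) m) (trans (sumZ-cong p (λ { {x} _ → sumZ-++ (pair m x) q r }))
      (trans (sumZ-+ _ _ p) (sym (cong₂ _+_ (coeff-* p q m) (coeff-* p r m)))))

    *P-[] : ∀ (p : Poly k) m → coeff (p *P []) m ≡ + 0
    *P-[] p m = trans (coeff-* p [] m) (sumZ-zero p)

    *P-scale : ∀ c (p q : Poly k) m → coeff (p *P scale c q) m ≡ c * coeff (p *P q) m
    *P-scale c p q m = trans (coeff-* p (scale c q) m) (trans (sumZ-cong p (λ { {x} _ → inner x }))
      (trans (sumZ-* c _ p) (cong (λ z → c * z) (sym (coeff-* p q m)))))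
      where
      inner : ∀ x → sumZ (pair m x) (scale c q) ≡ c * sumZ (pair m x) q
      inner (a , e) = trans (sumZ-map _ _ q) (trans (sumZ-cong q λ { {d , f} _ →
        trans (cong (λ z → at m z (zipWith ℕ._+_ e f)) (trans (sym (*-assoc a c d)) (trans (cong (λ z → z * d) (*-comm a c)) (*-assoc c a d))))
              (at-* m c (a * d) (zipWith ℕ._+_ e f)) }) (sumZ-* c _ q))

    private
      -- Polynomials are compared by coefficients and not as lists, so congruence of the product
      -- needs an argument: multiplication by the monomial `e` contributes to `m` from the quotient
      -- of `m` by `e` alone, or not at all if `e` does not divide `m`.
      quotient : ∀ {k} (e m : Vec ℕ k) → (∃ λ m′ → ∀ f → does (≡-dec _≟ℕ_ (zipWith ℕ._+_ e f) m) ≡ does (≡-dec _≟ℕ_ f m′))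
        ⊎ (∀ f → does (≡-dec _≟ℕ_ (zipWith ℕ._+_ e f) m) ≡ false)
      quotient {k} e m with solve e m
        where
        solve : ∀ {k} (e m : Vec ℕ k) → Dec (∃ λ m′ → zipWith ℕ._+_ e m′ ≡ m)
        solve [] [] = yes ([] , refl)
        solve (x ∷ e) (y ∷ m) with x ℕₚ.≤? y | solve e m
        ... | yes x≤y | yes (m′ , refl) = yes (y ℕ.∸ x ∷ m′ , cong (λ z → z ∷ _) (ℕₚ.m+[n∸m]≡n x≤y))
        ... | no x≰y | _ = no λ { (z ∷ m′ , refl) → x≰y (ℕₚ.m≤m+n x z) }
        ... | _ | no h = no λ { (z ∷ m′ , refl) → h (m′ , refl) }
      ... | no h = inj₂ λ f → dec-false (≡-dec _≟ℕ_ (zipWith ℕ._+_ e f) m) (λ eq → h (f , eq))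
      ... | yes (m′ , refl) = inj₁ (m′ , same)
        where
        cancel : ∀ {k} (e f m : Vec ℕ k) → zipWith ℕ._+_ e f ≡ zipWith ℕ._+_ e m → f ≡ m
        cancel [] [] [] _ = refl
        cancel (x ∷ e) (y ∷ f) (z ∷ m) eq = cong₂ _∷_ (ℕₚ.+-cancelˡ-≡ x y z (cong V.head eq)) (cancel e f m (cong V.tail eq))
        same : ∀ f → does (≡-dec _≟ℕ_ (zipWith ℕ._+_ e f) (zipWith ℕ._+_ e m′)) ≡ does (≡-dec _≟ℕ_ f m′)
        same f with ≡-dec _≟ℕ_ f m′
        ... | yes refl = dec-true (≡-dec _≟ℕ_ (zipWith ℕ._+_ e f) (zipWith ℕ._+_ e f)) refl
        ... | no h = dec-false (≡-dec _≟ℕ_ (zipWith ℕ._+_ e f) (zipWith ℕ._+_ e m′)) (λ eq → h (cancel e f m′ eq))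

    *P-congʳ : ∀ (p : Poly k) {q r : Poly k} → q ≈ r → p *P q ≈ p *P r
    *P-congʳ p {q} {r} h m = trans (coeff-* p q m) (trans (sumZ-cong p (λ { {x} _ → inner x })) (sym (coeff-* p r m)))
      where
      inner : ∀ x → sumZ (pair m x) q ≡ sumZ (pair m x) r
      inner (c , e) with quotient e m
      ... | inj₂ none = trans (zeros q) (sym (zeros r))
        where zeros : ∀ q → sumZ (pair m (c , e)) q ≡ + 0
              zeros q = trans (sumZ-cong q (λ { {d , f} _ → cong (λ b → if b then c * d else + 0) (none f) })) (sumZ-zero q)
      ... | inj₁ (m′ , same) = trans (to q) (trans (cong (λ z → c * z) (h m′)) (sym (to r)))
        where to : ∀ q → sumZ (pair m (c , e)) q ≡ c * coeff q m′
              to q = trans (sumZ-cong q (λ { {d , f} _ → trans (cong (λ b → if b then c * d else + 0) (same f)) (at-* m′ c d f) }))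
                       (trans (sumZ-* c _ q) (cong (λ z → c * z) (sym (coeff-sumZ q m′))))

    *P-congˡ : ∀ {p q : Poly k} (r : Poly k) → p ≈ q → p *P r ≈ q *P r
    *P-congˡ {p} {q} r h m = trans (*P-comm p r m) (trans (*P-congʳ r {p} {q} h m) (*P-comm r q m))

    *P-identityʳ : ∀ (p : Poly k) → p *P 1P ≈ p
    *P-identityʳ p m = trans (*P-comm p 1P m) (trans (coeff-* 1P p m) (trans (+-identityʳ _)
      (trans (sumZ-cong p (λ { {d , f} _ → cong₂ (at m) (*-identityˡ d) (zipWith-identityˡ (λ _ → refl) f) })) (sym (coeff-sumZ p m)))))

    *P-leftComm : ∀ (p q r : Poly k) → p *P (q *P r) ≈ q *P (p *P r)
    *P-leftComm p q r m = trans (sym (*P-assoc p q r m)) (trans (*P-congˡ {p *P q} {q *P p} r (*P-comm p q) m) (*P-assoc q p r m))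

  sumZ-vanish : ∀ {A : Set} {f : A → ℤ} xs → (∀ {x} → x ∈ xs → f x ≡ + 0) → sumZ f xs ≡ + 0
  sumZ-vanish xs h = trans (sumZ-cong xs h) (sumZ-zero xs)

  sumZ-single : ∀ {A : Set} {f : A → ℤ} {x xs} → Unique xs → x ∈ xs → (∀ {y} → y ∈ xs → y ≢ x → f y ≡ + 0) → sumZ f xs ≡ f x
  sumZ-single {f = f} {xs = x ∷ xs} (x∉ ∷ u) (here refl) h =
    trans (cong (λ z → f x + z) (sumZ-vanish xs λ p → h (there p) (λ e → All.lookup x∉ p (sym e)))) (+-identityʳ _)
  sumZ-single {f = f} {xs = y ∷ xs} (y∉ ∷ u) (there p) h =
    trans (cong₂ _+_ (h (here refl) (All.lookup y∉ p)) (sumZ-single u p (h ∘ there))) (+-identityˡ _)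

  sumZ-filter : ∀ {A : Set} (f : A → ℤ) (b : A → Bool) xs → sumZ f (filterᵇ b xs) ≡ sumZ (λ x → if b x then f x else + 0) xs
  sumZ-filter f b [] = refl
  sumZ-filter f b (x ∷ xs) with b x
  ... | true = cong (λ z → f x + z) (sumZ-filter f b xs)
  ... | false = trans (sumZ-filter f b xs) (sym (+-identityˡ _))

  -- the coefficient of g_μ in h_r g_λ, for a weak m-strip with ρ unblocked residues
  pieriTerm pieriCoeff : ℕ → ℕ → ℕ → ℤ
  pieriTerm r m ρ = sign (r ∸ m) * (+ (ρ C (r ∸ m)))
  pieriCoeff r m ρ = if m ≤ᵇ r then pieriTerm r m ρ else + 0

  pieriCoeff-≤ : ∀ {r m} ρ → m ≤ r → pieriCoeff r m ρ ≡ pieriTerm r m ρ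
  pieriCoeff-≤ {r} {m} ρ h with m ≤ᵇ r in eq
  ... | true = refl
  ... | false = ⊥-elim (subst T eq (≤⇒≤ᵇ h))

  pieriCoeff-> : ∀ {r m} ρ → r < m → pieriCoeff r m ρ ≡ + 0
  pieriCoeff-> {r} {m} ρ h with m ≤ᵇ r in eq
  ... | true = ⊥-elim (<⇒≱ h (≤ᵇ⇒≤ m r (subst T (sym eq) tt)))
  ... | false = refl

  pieriCoeff-diag : ∀ r ρ → pieriCoeff r r ρ ≡ + 1
  pieriCoeff-diag r ρ = trans (pieriCoeff-≤ {r} ρ ≤-refl) (trans (cong (λ z → sign z * (+ (ρ C z))) (n∸n≡0 r)) (lemma ρ))
    where
    open import Data.Nat.Combinatorics using (nCn≡1; nCk≡nC[n∸k])
    lemma : ∀ ρ → sign 0 * (+ (ρ C 0)) ≡ + 1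
    lemma ρ = cong (λ z → sign 0 * (+ z)) (trans (nCk≡nC[n∸k] {0} {ρ} z≤n) (nCn≡1 ρ))

  -- Pascal's rule with lower index `suc j`, where j = r ∸ suc m; the term with lower index `j`
  -- carries the opposite sign in the strip of size m + 1. The cut-off in `pieriCoeff` matters: for
  -- r < m the monus would turn the coefficient into 1 instead of 0.
  pieriCoeff-suc : ∀ r m ρ → pieriCoeff r m (suc ρ) ≡ pieriCoeff r m ρ + - pieriCoeff r (suc m) ρ
  pieriCoeff-suc r m ρ with ≤-<-connex m r
  ... | inj₂ h = trans (pieriCoeff-> {r} (suc ρ) h) (sym (cong₂ (λ x y → x + - y) (pieriCoeff-> {r} ρ h) (pieriCoeff-> {r} ρ (≤-trans h (≤-trans (m≤1+n m) ≤-refl)))))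
    where m≤1+n : ∀ m → m ≤ suc m
          m≤1+n zero = z≤n
          m≤1+n (suc m) = s≤s (m≤1+n m)
  ... | inj₁ h with m≤n⇒m<n∨m≡n h
  ...   | inj₂ refl = trans (pieriCoeff-diag r (suc ρ)) (sym (cong₂ (λ x y → x + - y) (pieriCoeff-diag r ρ) (pieriCoeff-> {r} ρ ≤-refl)))
  ...   | inj₁ lt = begin
    pieriCoeff r m (suc ρ) ≡⟨ pieriCoeff-≤ {r} (suc ρ) h ⟩
    sign (r ∸ m) * (+ (suc ρ C (r ∸ m))) ≡⟨ cong (λ z → sign z * (+ (suc ρ C z))) r∸m ⟩
    sign (suc j) * (+ (suc ρ C suc j)) ≡⟨ cong (λ z → sign (suc j) * (+ z)) (sym (nCk+nC[k+1]≡[n+1]C[k+1] ρ j)) ⟩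
    sign (suc j) * (+ (ρ C j ℕ.+ ρ C suc j)) ≡⟨ cong (sign (suc j) *_) (pos-+ (ρ C j) (ρ C suc j)) ⟩
    sign (suc j) * (+ (ρ C j) + + (ρ C suc j)) ≡⟨ *-distribˡ-+ (sign (suc j)) (+ (ρ C j)) (+ (ρ C suc j)) ⟩
    sign (suc j) * (+ (ρ C j)) + sign (suc j) * (+ (ρ C suc j)) ≡⟨ +-comm (sign (suc j) * (+ (ρ C j))) _ ⟩
    sign (suc j) * (+ (ρ C suc j)) + sign (suc j) * (+ (ρ C j)) ≡⟨ cong₂ _+_
        (trans (cong (λ z → sign z * (+ (ρ C z))) (sym r∸m)) (sym (pieriCoeff-≤ {r} ρ h)))
        (trans (trans (*-assoc -[1+ 0 ] (sign j) _) (-1*i≡-i _)) (cong -_ (sym (pieriCoeff-≤ {r} ρ lt)))) ⟩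
    pieriCoeff r m ρ + - pieriCoeff r (suc m) ρ ∎
    where
    open ≡-Reasoning
    j = r ∸ suc m
    r∸m : r ∸ m ≡ suc j
    r∸m = trans (cong (_∸ m) (sym (m+[n∸m]≡n lt))) (trans (cong (_∸ m) (sym (+-suc m j))) (m+n∸m≡n m (suc j)))

  -- The Pieri rule is evaluated by two functionals, a coefficient and a coefficient after
  -- multiplication by a fixed polynomial. Both are treated at once.
  record Additive {k} (φ : Poly k → ℤ) : Set where
    field
      φ-++ : ∀ p q → φ (p ++ q) ≡ φ p + φ q
      φ-[] : φ [] ≡ + 0
      φ-scale : ∀ c p → φ (scale c p) ≡ c * φ p

    φ-sumP : ∀ ps → φ (sumP ps) ≡ sumZ φ ps
    φ-sumP [] = φ-[]
    φ-sumP (p ∷ ps) = trans (φ-++ p (sumP ps)) (cong (λ z → φ p + z) (φ-sumP ps))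

  coeff-additive : ∀ {k} (m : Mono k) → Additive (λ p → coeff p m)
  coeff-additive m = record { φ-++ = λ p q → coeff-++ p q m ; φ-[] = refl ; φ-scale = λ c p → coeff-scale c p m }

  coeff-*-additive : ∀ {k} (P : Poly k) (m : Mono k) → Additive (λ p → coeff (P *P p) m)
  coeff-*-additive P m = record { φ-++ = λ p q → *P-++ P p q m ; φ-[] = *P-[] P m ; φ-scale = λ c p → *P-scale c P p m }

open LinearArithmetic using (lin; con; _⊕_; _≼_; _≺_; _≐_; _⇒_; ⊢_; ⊢⊥)
open Polynomials
open import Data.Nat.Base using (ℕ; zero; suc; _+_; _*_; _∸_; _≤_; _<_; z≤n; s≤s; _%_; _⊓_; _≤ᵇ_; _≡ᵇ_; _<ᵇ_)
open import Data.Nat.Properties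
open import Data.Nat.DivMod using (m≡m%n+[m/n]*n; [m+kn]%n≡m%n; %-distribˡ-+; m<n⇒m%n≡m; m%n<n; m*n%n≡0; _/_; /-monoˡ-≤; _%_; m%n%n≡m%n)
open import Data.Integer.Base as ℤ using (ℤ; +_; _%ℕ_)
open import Data.Vec.Base using ([]; _∷_)
open import Data.Product.Base using (_×_; _,_; proj₁; proj₂; ∃; ∃-syntax)
open import Data.Sum.Base using (_⊎_; inj₁; inj₂)
open import Relation.Binary.PropositionalEquality hiding ([_])
open import Data.List.Base as L using (List; []; _∷_; _++_; length; map; upTo; deduplicate; filterᵇ; applyUpTo; concatMap; [_]; replicate; allFin; tabulate)
open import Data.List.Properties using (length-map; length-++; map-applyUpTo; filter-++; ∷-injectiveʳ; length-applyUpTo; map-tabulate; ++-identityʳ)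
open import Data.List.Membership.Propositional using (_∈_; _∉_)
open import Data.List.Membership.Propositional.Properties using (∈-++⁺ˡ; ∈-++⁺ʳ; ∈-++⁻; ∈-∃++; ∈-deduplicate⁺; ∈-deduplicate⁻; ∈-map⁺; ∈-map⁻; ∈-filter⁺; ∈-filter⁻; ∈-applyUpTo⁺; ∈-applyUpTo⁻; ∈-concat⁺′; ∈-concat⁻′; ∈-upTo⁺; ∈-upTo⁻)
open import Data.List.Membership.DecPropositional _≟_ using (_∈?_)
open import Data.List.Relation.Unary.Any using (here; there)
open import Data.List.Relation.Unary.All as All using (All; []; _∷_)
open import Data.List.Relation.Unary.AllPairs using ([]; _∷_)
open import Data.List.Relation.Unary.Unique.Propositional using (Unique)
open import Data.List.Relation.Unary.Unique.DecPropositional.Properties _≟_ using (deduplicate-!)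
open import Data.Empty using (⊥; ⊥-elim)
open import Relation.Nullary using (¬_; yes; no)
open import Relation.Binary.Definitions using (tri<; tri≈; tri>)
open import Data.Bool.Base using (Bool; true; false; T; _∧_; not; if_then_else_)
open import Data.Bool.Properties using (T-∧; T?)
open import Data.Bool.ListAction using (and)
open import Function.Base using (_∘_)
open import Function.Bundles using (Equivalence; mk⇔)
open import Data.Unit.Base using (tt)
import Data.List.Relation.Unary.Unique.Propositional.Properties as Uniq
import Data.Integer.Properties as ℤₚ
open import Data.List.Relation.Binary.Permutation.Propositional using (_↭_; prep; swap) renaming (refl to ↭-refl′; trans to ↭-trans′)
open import Data.List.Relation.Binary.BagAndSetEquality using (∼bag⇒↭)
open import Data.List.Membership.Propositional.Properties.WithK using (unique∧set⇒bag)
open import Data.Fin.Base as Fin using (Fin)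
import Data.List.Relation.Unary.All.Properties as Allₚ

-- Residues

private
  %-+-cong : ∀ {n} c a b → a % suc n ≡ b % suc n → (a + c) % suc n ≡ (b + c) % suc n
  %-+-cong {n} c a b h = trans (%-distribˡ-+ a c (suc n))
    (trans (cong (λ z → (z + c % suc n) % suc n) h) (sym (%-distribˡ-+ b c (suc n))))

%-≡⇒∃ : ∀ n {a b} → a % suc n ≡ b % suc n → a ≤ b → ∃ λ m → b ≡ a + m * suc n
%-≡⇒∃ n {a} {b} h a≤b = q b ∸ q a , (begin
  b                                       ≡⟨ m≡m%n+[m/n]*n b (suc n) ⟩
  b % suc n + q b * suc n                 ≡⟨ cong₂ (λ x y → x + y * suc n) (sym h) (sym (m+[n∸m]≡n qa≤qb)) ⟩
  a % suc n + (q a + (q b ∸ q a)) * suc n ≡⟨ cong (λ z → a % suc n + z) (*-distribʳ-+ (suc n) (q a) _) ⟩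
  a % suc n + (q a * suc n + (q b ∸ q a) * suc n) ≡⟨ sym (+-assoc (a % suc n) _ _) ⟩
  (a % suc n + q a * suc n) + (q b ∸ q a) * suc n ≡⟨ cong (λ z → z + (q b ∸ q a) * suc n) (sym (m≡m%n+[m/n]*n a (suc n))) ⟩
  a + (q b ∸ q a) * suc n ∎)
  where
  open ≡-Reasoning
  q : ℕ → ℕ
  q x = x / suc n
  qa≤qb : q a ≤ q b
  qa≤qb = /-monoˡ-≤ (suc n) a≤b

-- Since −1 ≡ k mod k + 1.
residue-% : ∀ k i j → residue k (i , j) ≡ (j + i * k) % suc k
residue-% k i j with ≤-total i j
... | inj₁ i≤j rewrite sym (m+[n∸m]≡n i≤j) = go (j ∸ i)
  where
  open import Data.Integer.Properties using (m-n≡m⊖n; ⊖-≥)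
  go : ∀ d → ((+ (i + d)) ℤ.- (+ i)) %ℕ suc k ≡ (i + d + i * k) % suc k
  go d rewrite m-n≡m⊖n (i + d) i | ⊖-≥ (m≤m+n i d) | m+n∸m≡n i d =
    trans (sym ([m+kn]%n≡m%n d i (suc k))) (cong (_% suc k) eq)
    where
    eq : d + i * suc k ≡ i + d + i * k
    eq rewrite *-suc i k = lin (d ∷ i ∷ i * k ∷ []) (λ d i x → ⊢ d ⊕ (i ⊕ x) ≐ i ⊕ d ⊕ x)
... | inj₂ j≤i rewrite sym (m+[n∸m]≡n j≤i) = go (i ∸ j)
  where
  open import Data.Integer.Properties using (m-n≡m⊖n; ⊖-≤)
  neg : ∀ d → (ℤ.- (+ d)) %ℕ suc k ≡ (d * k) % suc k
  neg zero = refl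
  neg (suc d) with suc d % suc k in h
  ... | zero = sym (trans (cong (_% suc k) eq) (m*n%n≡0 (suc d / suc k * k) (suc k)))
    where
    eq : suc d * k ≡ suc d / suc k * k * suc k
    eq = begin
      suc d * k ≡⟨ cong (_* k) (trans (m≡m%n+[m/n]*n (suc d) (suc k)) (cong (λ z → z + suc d / suc k * suc k) h)) ⟩
      suc d / suc k * suc k * k ≡⟨ *-assoc (suc d / suc k) (suc k) k ⟩
      suc d / suc k * (suc k * k) ≡⟨ cong (suc d / suc k *_) (*-comm (suc k) k) ⟩
      suc d / suc k * (k * suc k) ≡⟨ sym (*-assoc (suc d / suc k) k (suc k)) ⟩
      suc d / suc k * k * suc k ∎
      where open ≡-Reasoning
  ... | suc r = sym (begin
      (suc d * k) % suc k ≡⟨ cong (λ z → (z * k) % suc k) (trans (m≡m%n+[m/n]*n (suc d) (suc k)) (cong (λ z → z + suc d / suc k * suc k) h)) ⟩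
      ((suc r + x * suc k) * k) % suc k ≡⟨ cong (_% suc k) eq ⟩
      ((k ∸ r) + (r + x * k) * suc k) % suc k ≡⟨ [m+kn]%n≡m%n (k ∸ r) (r + x * k) (suc k) ⟩
      (k ∸ r) % suc k ≡⟨ m<n⇒m%n≡m (s≤s (m∸n≤m k r)) ⟩
      k ∸ r ∎)
    where
    open ≡-Reasoning
    x = suc d / suc k
    r≤k : r ≤ k
    r≤k = ≤-pred (≤-trans (≤-reflexive (sym h)) (≤-trans (n≤1+n _) (m%n<n (suc d) (suc k))))
    eq : (suc r + x * suc k) * k ≡ (k ∸ r) + (r + x * k) * suc k
    eq rewrite *-distribʳ-+ k (suc r) (x * suc k) | *-distribʳ-+ (suc k) r (x * k)
       | *-assoc x (suc k) k | *-assoc x k (suc k) | *-comm k (suc k) | *-suc r k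
       = lin (k ∷ r ∷ k ∸ r ∷ r * k ∷ x * (suc k * k) ∷ [])
             (λ k r d y z → d ⊕ r ≐ k ⇒ ⊢ k ⊕ y ⊕ z ≐ d ⊕ (r ⊕ y ⊕ z)) (m∸n+n≡m r≤k)
  go : ∀ d → ((+ j) ℤ.- (+ (j + d))) %ℕ suc k ≡ (j + (j + d) * k) % suc k
  go d rewrite m-n≡m⊖n j (j + d) | ⊖-≤ (m≤m+n j d) | m+n∸m≡n j d =
    trans (neg d) (trans (sym ([m+kn]%n≡m%n (d * k) j (suc k))) (cong (_% suc k) eq))
    where
    eq : d * k + j * suc k ≡ j + (j + d) * k
    eq rewrite *-suc j k | *-distribʳ-+ k j d =
      lin (d * k ∷ j ∷ j * k ∷ []) (λ x j y → ⊢ x ⊕ (j ⊕ y) ≐ j ⊕ (y ⊕ x))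

private
  shuffle : ∀ i j i′ k → j + i * k + (i + i′) ≡ (j + i′) + i * suc k
  shuffle i j i′ k rewrite *-suc i k =
    lin (j ∷ i * k ∷ i ∷ i′ ∷ []) (λ j x i i′ → ⊢ j ⊕ x ⊕ (i ⊕ i′) ≐ j ⊕ i′ ⊕ (i ⊕ x))

-- Contents `j - i` and `j′ - i′` are compared with the rows moved to the other side, to stay in ℕ;
-- the last hypothesis says which content is the larger one. All later congruences of contents have
-- this form.
residue-≡⇒ : ∀ k i j i′ j′ → residue k (i , j) ≡ residue k (i′ , j′) → j + i′ ≤ j′ + i →
  ∃ λ m → j′ + i ≡ j + i′ + m * suc k
residue-≡⇒ k i j i′ j′ h le = %-≡⇒∃ k
  (trans (sym ([m+kn]%n≡m%n (j + i′) i (suc k)))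
    (trans (cong (_% suc k) (sym (shuffle i j i′ k)))
      (trans (%-+-cong (i + i′) (j + i * k) (j′ + i′ * k)
               (trans (sym (residue-% k i j)) (trans h (residue-% k i′ j′))))
        (trans (cong (λ z → (j′ + i′ * k + z) % suc k) (+-comm i i′))
          (trans (cong (_% suc k) (shuffle i′ j′ i k)) ([m+kn]%n≡m%n (j′ + i) i′ (suc k))))))) le

⇒residue-≡ : ∀ k i j i′ j′ m → j′ + i ≡ j + i′ + m * suc k → residue k (i , j) ≡ residue k (i′ , j′)
⇒residue-≡ k i j i′ j′ m h = trans (residue-% k i j) (trans (trans
  (trans (sym ([m+kn]%n≡m%n (j + i * k) (m + i′) (suc k))) (trans (cong (_% suc k) eq) ([m+kn]%n≡m%n (j′ + i′ * k) i (suc k))))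
  refl) (sym (residue-% k i′ j′)))
  where
  eq : j + i * k + (m + i′) * suc k ≡ j′ + i′ * k + i * suc k
  eq rewrite *-distribʳ-+ (suc k) m i′ | *-suc i k | *-suc i′ k =
    lin (j ∷ i * k ∷ m * suc k ∷ i′ ∷ i′ * k ∷ j′ ∷ i ∷ [])
        (λ j x y i′ z j′ i → j′ ⊕ i ≐ j ⊕ i′ ⊕ y ⇒ ⊢ j ⊕ x ⊕ (y ⊕ (i′ ⊕ z)) ≐ j′ ⊕ z ⊕ (i ⊕ x)) h

residue< : ∀ k c → residue k c < suc k
residue< k (i , j) rewrite residue-% k i j = m%n<n (j + i * k) (suc k)

pigeonhole : ∀ {us vs : List ℕ} (f : ℕ → ℕ) → Unique us →
  (∀ {x y} → x ∈ us → y ∈ us → f x ≡ f y → x ≡ y) → (∀ {x} → x ∈ us → f x ∈ vs) → length us ≤ length vs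
pigeonhole {[]} f u inj sub = z≤n
pigeonhole {x ∷ us} {vs} f (x∉ ∷ u) inj sub with ∈-∃++ (sub (here refl))
... | as , bs , refl = ≤-trans (s≤s (pigeonhole f u (λ p q → inj (there p) (there q)) sub′))
    (≤-reflexive (trans (cong suc (length-++ as)) (trans (sym (+-suc (length as) (length bs))) (sym (length-++ as)))))
  where
  sub′ : ∀ {y} → y ∈ us → f y ∈ as ++ bs
  sub′ {y} p with ∈-++⁻ as (sub (there p))
  ... | inj₁ q = ∈-++⁺ˡ q
  ... | inj₂ (there q) = ∈-++⁺ʳ as q
  ... | inj₂ (here e) = ⊥-elim (All.lookup x∉ p (inj (here refl) (there p) (sym e)))

∈-dedup⁻ : ∀ {x} xs → x ∈ deduplicate _≟_ xs → x ∈ xs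
∈-dedup⁻ xs = ∈-deduplicate⁻ _≟_ xs

nDistinct-inj : ∀ {xs ys} (f : ℕ → ℕ) → (∀ {x y} → x ∈ xs → y ∈ xs → f x ≡ f y → x ≡ y) →
  (∀ {x} → x ∈ xs → f x ∈ ys) → nDistinct xs ≤ nDistinct ys
nDistinct-inj {xs} {ys} f inj sub = pigeonhole f (deduplicate-! xs)
  (λ p q → inj (∈-dedup⁻ xs p) (∈-dedup⁻ xs q)) (λ p → ∈-deduplicate⁺ _≟_ (sub (∈-dedup⁻ xs p)))

nDistinct-⊆ : ∀ {xs ys} → (∀ {x} → x ∈ xs → x ∈ ys) → nDistinct xs ≤ nDistinct ys
nDistinct-⊆ = nDistinct-inj (λ x → x) (λ _ _ e → e)

nDistinct-≈ : ∀ {xs ys} → (∀ {x} → x ∈ xs → x ∈ ys) → (∀ {x} → x ∈ ys → x ∈ xs) → nDistinct xs ≡ nDistinct ys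
nDistinct-≈ p q = ≤-antisym (nDistinct-⊆ p) (nDistinct-⊆ q)

nDistinct-map : ∀ {xs ys} (f : ℕ → ℕ) → (∀ {x y} → x ∈ xs → y ∈ xs → f x ≡ f y → x ≡ y) →
  (∀ {x} → x ∈ xs → f x ∈ ys) → (∀ {y} → y ∈ ys → ∃ λ x → x ∈ xs × f x ≡ y) → nDistinct xs ≡ nDistinct ys
nDistinct-map {xs} {ys} f inj sub sur = ≤-antisym (nDistinct-inj f inj sub)
  (≤-trans (nDistinct-⊆ (λ {y} p → let (x , q , e) = sur p in subst (_∈ map f (deduplicate _≟_ xs)) e
             (∈-map⁺ f (∈-deduplicate⁺ _≟_ q))))
    (≤-trans (length-dedup-≤ (map f (deduplicate _≟_ xs))) (≤-reflexive (length-map f (deduplicate _≟_ xs)))))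
  where
  open import Data.List.Properties using (length-deduplicate)
  length-dedup-≤ : ∀ xs → length (deduplicate _≟_ xs) ≤ length xs
  length-dedup-≤ = length-deduplicate _≟_

nDistinct-∈ : ∀ {x xs} → x ∈ xs → nDistinct (x ∷ xs) ≡ nDistinct xs
nDistinct-∈ p = nDistinct-≈ (λ { (here refl) → p ; (there q) → q }) there

nDistinct-∉ : ∀ {x xs} → x ∉ xs → nDistinct (x ∷ xs) ≡ suc (nDistinct xs)
nDistinct-∉ {x} {xs} p = cong (λ z → suc (length z)) (filter-all _ (All.tabulate λ {y} q e → p (∈-dedup⁻ xs (subst (_∈ _) (sym e) q))))
  where open import Data.List.Properties using (filter-all)

fresh : List ℕ → List ℕ → ℕ
fresh [] R = 0
fresh (x ∷ xs) R with x ∈? R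
... | yes _ = fresh xs R
... | no _ = suc (fresh xs R)

nDistinct-++ : ∀ {xs} R → Unique xs → nDistinct (xs ++ R) ≡ fresh xs R + nDistinct R
nDistinct-++ {[]} R u = refl
nDistinct-++ {x ∷ xs} R (x∉ ∷ u) with x ∈? R
... | yes p = trans (nDistinct-∈ (∈-++⁺ʳ xs p)) (nDistinct-++ R u)
... | no p = trans (nDistinct-∉ q) (cong suc (nDistinct-++ R u))
  where
  q : x ∉ xs ++ R
  q r with ∈-++⁻ xs r
  ... | inj₁ s = All.lookup x∉ s refl
  ... | inj₂ s = p s

-- Cores and their abacus

-- Rows are numbered from 0 here, so row i of a function is row suc i of a diagram.
Anti : (ℕ → ℕ) → Set
Anti f = ∀ i → f (suc i) ≤ f i

anti-≤ : ∀ {f} → Anti f → ∀ {i j} → i ≤ j → f j ≤ f i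
anti-≤ {f} a {i} {j} h = subst (λ z → f z ≤ f i) (m+[n∸m]≡n h) (go (j ∸ i))
  where
  go : ∀ d → f (i + d) ≤ f i
  go zero = ≤-reflexive (cong f (+-identityʳ i))
  go (suc d) = ≤-trans (subst (λ z → f z ≤ f (i + d)) (sym (+-suc i d)) (a (i + d))) (go d)

psum : (ℕ → ℕ) → ℕ → ℕ → ℕ
psum p i zero = 0
psum p i (suc c) = p i + psum p (suc i) c

-- The contents (column minus row) at the ends of the rows of f are the beads of an abacus. Horizontal steps of the
-- boundary are its gaps; the one along the top of column j at height r is described by Gap.
Gap : (ℕ → ℕ) → ℕ → ℕ → Set
Gap g r j = g r < j × (∀ b → b < r → j ≤ g b)

record Strip (f g : ℕ → ℕ) : Set where
  field
    below : ∀ i → g i ≤ f i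
    above : ∀ i → f (suc i) ≤ g i

  above′ : Anti g → ∀ {i j} → i < j → f j ≤ g i
  above′ a {i} {suc j} (s≤s h) = ≤-trans (above j) (anti-≤ a h)

module Cores (k : ℕ) where

  n : ℕ
  n = suc k

  abstract
    -- Kept opaque, so that residues enter the abacus arguments only as congruences of contents,
    -- through `res-⇒` and `⇒res`.
    res : ℕ → ℕ → ℕ
    res i j = residue k (suc i , j)

    res-⇒ : ∀ i j i′ j′ → res i j ≡ res i′ j′ → j + i′ ≤ j′ + i → ∃ λ m → j′ + i ≡ j + i′ + m * n
    res-⇒ i j i′ j′ h le with residue-≡⇒ k (suc i) j (suc i′) j′ h
                                 (lin (j ∷ i′ ∷ j′ ∷ i ∷ []) (λ j i′ j′ i → j ⊕ i′ ≼ j′ ⊕ i ⇒ ⊢ j ⊕ (con 1 ⊕ i′) ≼ j′ ⊕ (con 1 ⊕ i)) le)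
    ... | m , e = m , lin (j ∷ i′ ∷ j′ ∷ i ∷ m * n ∷ [])
      (λ j i′ j′ i m → j′ ⊕ (con 1 ⊕ i) ≐ j ⊕ (con 1 ⊕ i′) ⊕ m ⇒ ⊢ j′ ⊕ i ≐ j ⊕ i′ ⊕ m) e

    ⇒res : ∀ i j i′ j′ m → j′ + i ≡ j + i′ + m * n → res i j ≡ res i′ j′
    ⇒res i j i′ j′ m h = ⇒residue-≡ k (suc i) j (suc i′) j′ m (lin (j ∷ i′ ∷ j′ ∷ i ∷ m * n ∷ [])
      (λ j i′ j′ i m → j′ ⊕ i ≐ j ⊕ i′ ⊕ m ⇒ ⊢ j′ ⊕ (con 1 ⊕ i) ≐ j ⊕ (con 1 ⊕ i′) ⊕ m) h)

    res-def : ∀ i j → res i j ≡ residue k (suc i , j)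
    res-def i j = refl

  res-close : ∀ i j j′ → res i j ≡ res i j′ → j ≤ j′ → j′ ≤ j + k → j ≡ j′
  res-close i j j′ h le le′ with res-⇒ i j i j′ h (+-monoˡ-≤ i le)
  ... | zero , e = lin (j ∷ j′ ∷ i ∷ []) (λ j j′ i → j′ ⊕ i ≐ j ⊕ i ⊕ con 0 ⇒ ⊢ j ≐ j′) e
  ... | suc m , e = ⊥-elim (lin (j ∷ j′ ∷ i ∷ k ∷ m * n ∷ [])
        (λ j j′ i k x → j′ ⊕ i ≐ j ⊕ i ⊕ (con 1 ⊕ k ⊕ x) ⇒ j′ ≼ j ⊕ k ⇒ ⊢⊥) e le′)

  -- Row i of a core has p i cells of hook length at most k, and its other cells are those below row i + n − p i.
  record IsC (f p : ℕ → ℕ) : Set where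
    field
      anti : Anti f
      p≤k : ∀ i → p i ≤ k
      law : ∀ i → f (suc (k ∸ p i) + i) + p i ≡ f i

    mono : ∀ {i j} → i ≤ j → f j ≤ f i
    mono = anti-≤ anti

    q+p : ∀ i → (k ∸ p i) + p i ≡ k
    q+p i = m∸n+n≡m (p≤k i)

    p≤f : ∀ i → p i ≤ f i
    p≤f i = ≤-trans (m≤n+m (p i) _) (≤-reflexive (law i))

    -- The left side of the equation grows strictly with `x`: a larger `x` lowers the row
    -- `suc (k ∸ x) + i`, which makes it no shorter.
    p-unique : ∀ i x → x ≤ k → f (suc (k ∸ x) + i) + x ≡ f i → x ≡ p i
    p-unique i x x≤k e with <-cmp x (p i)
    ... | tri≈ _ h _ = h
    ... | tri< h _ _ = ⊥-elim (lin (f (suc (k ∸ x) + i) ∷ x ∷ f i ∷ f (suc (k ∸ p i) + i) ∷ p i ∷ [])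
          (λ a x b c p → a ⊕ x ≐ b ⇒ c ⊕ p ≐ b ⇒ x ≺ p ⇒ a ≼ c ⇒ ⊢⊥) e (law i) h
          (mono (+-monoˡ-≤ i (s≤s (∸-monoʳ-≤ k (<⇒≤ h))))))
    ... | tri> _ _ h = ⊥-elim (lin (f (suc (k ∸ x) + i) ∷ x ∷ f i ∷ f (suc (k ∸ p i) + i) ∷ p i ∷ [])
          (λ a x b c p → a ⊕ x ≐ b ⇒ c ⊕ p ≐ b ⇒ p ≺ x ⇒ c ≼ a ⇒ ⊢⊥) e (law i) h
          (mono (+-monoˡ-≤ i (s≤s (∸-monoʳ-≤ k (<⇒≤ h))))))

    -- Moving a bead down by n gives a bead, so no bead is congruent to a gap below it.
    noBead : ∀ {r j} → Gap f r j → ∀ m r′ → ¬ (f r′ + r ≡ j + r′ + m * n)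
    noBead {r} {j} (lo , hi) zero r′ e with <-≤-connex r′ r
    ... | inj₁ h = lin (f r′ ∷ r ∷ j ∷ r′ ∷ []) (λ a r j r′ → a ⊕ r ≐ j ⊕ r′ ⊕ con 0 ⇒ r′ ≺ r ⇒ j ≼ a ⇒ ⊢⊥) e h (hi r′ h)
    ... | inj₂ h = lin (f r′ ∷ r ∷ j ∷ r′ ∷ f r ∷ []) (λ a r j r′ b → a ⊕ r ≐ j ⊕ r′ ⊕ con 0 ⇒ r ≼ r′ ⇒ a ≼ b ⇒ b ≺ j ⇒ ⊢⊥) e h (mono h) lo
    -- The bead moved down by `n` is the end of the row named by `law`.
    noBead {r} {j} G (suc m) r′ e = noBead G m (suc (k ∸ p r′) + r′)
      (lin (f (suc (k ∸ p r′) + r′) ∷ p r′ ∷ f r′ ∷ k ∸ p r′ ∷ k ∷ r ∷ j ∷ r′ ∷ m * n ∷ [])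
        (λ f′ p f q k r j r′ m → f ⊕ r ≐ j ⊕ r′ ⊕ (con 1 ⊕ k ⊕ m) ⇒ f′ ⊕ p ≐ f ⇒ q ⊕ p ≐ k ⇒
          ⊢ f′ ⊕ r ≐ j ⊕ (con 1 ⊕ q ⊕ r′) ⊕ m)
        e (law r′) (q+p r′))

  open IsC public

  cellsRes : ℕ → ℕ → ℕ → List ℕ
  cellsRes i y zero = []
  cellsRes i y (suc e) = res i (suc y) ∷ cellsRes i (suc y) e

  cellsRes⁺ : ∀ i y e j → y < j → j ≤ y + e → res i j ∈ cellsRes i y e
  cellsRes⁺ i y zero j a b = ⊥-elim (<⇒≱ a (≤-trans b (≤-reflexive (+-identityʳ y))))
  cellsRes⁺ i y (suc e) j a b with m≤n⇒m<n∨m≡n a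
  ... | inj₁ h = there (cellsRes⁺ i (suc y) e j h (≤-trans b (≤-reflexive (+-suc y e))))
  ... | inj₂ refl = here refl

  cellsRes⁻ : ∀ i y e {x} → x ∈ cellsRes i y e → ∃ λ j → y < j × j ≤ y + e × x ≡ res i j
  cellsRes⁻ i y (suc e) (here refl) = suc y , ≤-refl , ≤-trans (s≤s (m≤m+n y e)) (≤-reflexive (sym (+-suc y e))) , refl
  cellsRes⁻ i y (suc e) (there p) with cellsRes⁻ i (suc y) e p
  ... | j , a , b , c = j , <-trans ≤-refl a , ≤-trans b (≤-reflexive (sym (+-suc y e))) , c

  cellsRes-unique : ∀ i y e → e ≤ k → Unique (cellsRes i y e)
  cellsRes-unique i y zero h = []
  cellsRes-unique i y (suc e) h = All.tabulate new ∷ cellsRes-unique i (suc y) e (<⇒≤ h)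
    where
    new : ∀ {x} → x ∈ cellsRes i (suc y) e → res i (suc y) ≢ x
    new p q with cellsRes⁻ i (suc y) e p
    ... | j , a , b , c = <⇒≢ a (res-close i (suc y) j (trans q c) (<⇒≤ a) (≤-trans b (+-monoʳ-≤ (suc y) (<⇒≤ h))))

  rowRes : (f g : ℕ → ℕ) → ℕ → List ℕ
  rowRes f g i = cellsRes i (g i) (f i ∸ g i)

  stripRes : (f g : ℕ → ℕ) → ℕ → ℕ → List ℕ
  stripRes f g i zero = []
  stripRes f g i (suc c) = rowRes f g i ++ stripRes f g (suc i) c

  Crosses : (f g : ℕ → ℕ) → ℕ → ℕ → ℕ → Set
  Crosses f g i c x = ∃[ r ] ∃[ j ] (i ≤ r × r < i + c × g r < j × j ≤ f r × x ≡ res r j)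

  stripRes⁺ : ∀ f g i c r j → i ≤ r → r < i + c → g r < j → j ≤ f r → res r j ∈ stripRes f g i c
  stripRes⁺ f g i zero r j a b _ _ = ⊥-elim (<⇒≱ b (≤-trans (≤-reflexive (+-identityʳ i)) a))
  stripRes⁺ f g i (suc c) r j a b u v with m≤n⇒m<n∨m≡n a
  ... | inj₁ h = ∈-++⁺ʳ (rowRes f g i) (stripRes⁺ f g (suc i) c r j h (≤-trans b (≤-reflexive (+-suc i c))) u v)
  ... | inj₂ refl = ∈-++⁺ˡ (cellsRes⁺ i (g i) _ j u (≤-trans v (m≤n+m∸n (f i) (g i))))

  stripRes⁻ : ∀ f g i c {x} → (∀ i → g i ≤ f i) → x ∈ stripRes f g i c → Crosses f g i c x
  stripRes⁻ f g i (suc c) le p with ∈-++⁻ (rowRes f g i) p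
  ... | inj₁ q = let (j , a , b , e) = cellsRes⁻ i (g i) _ q in
    i , j , ≤-refl , m<m+n i (s≤s z≤n) , a , ≤-trans b (≤-reflexive (m+[n∸m]≡n (le i))) , e
  ... | inj₂ q = let (r , j , a , b , rest) = stripRes⁻ f g (suc i) c le q in
    r , j , <⇒≤ a , ≤-trans b (≤-reflexive (sym (+-suc i c))) , rest

  -- The lattice point in column `c` at height `a` lies on the boundary of the diagram of `g`.
  OnBoundary : (ℕ → ℕ) → ℕ → ℕ → Set
  OnBoundary g a c = g a ≤ c × (∀ b → b < a → c ≤ g b)

  -- The content lying `n` below that of cell `y` in row `i` is a bead of `g`.
  Bead : (ℕ → ℕ) → ℕ → ℕ → Set
  Bead g i y = ∃ λ r → g r + i + n ≡ y + r

  -- Follow the boundary of g along the contents that lie n below those of the cells y + 1, …, y + e of row i.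
  -- Steps below the residues of R are horizontal.
  walk : ∀ {g} → Anti g → (R : List ℕ) → ∀ i e y a c a₁ c₁ → OnBoundary g a c → OnBoundary g a₁ c₁ →
    y + a ≡ c + i + n → c₁ + a ≡ c + a₁ + e →
    (∀ j → y < j → j ≤ y + e → res i j ∈ R → ¬ Bead g i j) →
    (c + e ≤ c₁ + fresh (cellsRes i y e) R) ×
    (c₁ + fresh (cellsRes i y e) R ≤ c + e → ∀ j → y < j → j ≤ y + e → res i j ∉ R → Bead g i j)
  walk {g} ag R i zero y a c a₁ c₁ (ga , ba) (ga₁ , ba₁) ey ec H = le , λ _ j u v _ → ⊥-elim (<⇒≱ u (≤-trans v (≤-reflexive (+-identityʳ y))))
    where
    le : c + 0 ≤ c₁ + 0
    le with <-≤-connex c₁ c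
    ... | inj₂ h = +-monoˡ-≤ 0 h
    ... | inj₁ h = ⊥-elim (<⇒≱ h (≤-trans (ba a₁ (lin (c₁ ∷ a ∷ c ∷ a₁ ∷ []) (λ c₁ a c a₁ → c₁ ≺ c ⇒ c₁ ⊕ a ≐ c ⊕ a₁ ⊕ con 0 ⇒ ⊢ a₁ ≺ a) h ec)) ga₁))
  walk {g} ag R i (suc e) y a c a₁ c₁ B B₁ ey ec H = step a B ey ec
    where
    Goal : Set
    Goal = (c + suc e ≤ c₁ + fresh (cellsRes i y (suc e)) R) ×
      (c₁ + fresh (cellsRes i y (suc e)) R ≤ c + suc e → ∀ j → y < j → j ≤ y + suc e → res i j ∉ R → Bead g i j)
    H′ : ∀ j → suc y < j → j ≤ suc y + e → res i j ∈ R → ¬ Bead g i j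
    H′ j u v = H j (<⇒≤ u) (≤-trans v (≤-reflexive (sym (+-suc y e))))
    y+ : suc y ≤ y + suc e
    y+ = ≤-trans (s≤s (m≤m+n y e)) (≤-reflexive (sym (+-suc y e)))
    fr : ℕ
    fr = fresh (cellsRes i (suc y) e) R
    -- A horizontal step over a fresh residue leaves a slack of one in the bound, so equality
    -- excludes it.
    horizontal : ∀ a → OnBoundary g a (suc c) → y + a ≡ c + i + n → c₁ + a ≡ c + a₁ + suc e → Goal
    horizontal a B′ ey ec with walk ag R i e (suc y) a (suc c) a₁ c₁ B′ B₁ (cong suc ey) (trans ec (+-suc (c + a₁) e)) H′
                             | res i (suc y) ∈? R
    ... | le , tight | yes p =
      lin (c ∷ e ∷ c₁ ∷ fr ∷ []) (λ c e c₁ f → con 1 ⊕ c ⊕ e ≼ c₁ ⊕ f ⇒ ⊢ c ⊕ (con 1 ⊕ e) ≼ c₁ ⊕ f) le ,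
      λ h j u v j∉ → later (lin (c ∷ e ∷ c₁ ∷ fr ∷ []) (λ c e c₁ f → c₁ ⊕ f ≼ c ⊕ (con 1 ⊕ e) ⇒ ⊢ c₁ ⊕ f ≼ con 1 ⊕ c ⊕ e) h) j u v j∉
      where
      later : c₁ + fr ≤ suc c + e → ∀ j → y < j → j ≤ y + suc e → res i j ∉ R → Bead g i j
      later h j u v j∉ with m≤n⇒m<n∨m≡n u
      ... | inj₁ w = tight h j w (≤-trans v (≤-reflexive (+-suc y e))) j∉
      ... | inj₂ refl = ⊥-elim (j∉ p)
    ... | le , tight | no p =
      lin (c ∷ e ∷ c₁ ∷ fr ∷ []) (λ c e c₁ f → con 1 ⊕ c ⊕ e ≼ c₁ ⊕ f ⇒ ⊢ c ⊕ (con 1 ⊕ e) ≼ c₁ ⊕ (con 1 ⊕ f)) le ,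
      λ h → ⊥-elim (lin (c ∷ e ∷ c₁ ∷ fr ∷ []) (λ c e c₁ f → c₁ ⊕ (con 1 ⊕ f) ≼ c ⊕ (con 1 ⊕ e) ⇒ con 1 ⊕ c ⊕ e ≼ c₁ ⊕ f ⇒ ⊢⊥) h le)
    -- A vertical step descends along the end of row `b`, which is a bead. By `H` its residue is not
    -- in `R`, so it is paid for by `fresh`.
    vertical : ∀ b → g b ≡ c → OnBoundary g b c → y + suc b ≡ c + i + n → c₁ + suc b ≡ c + a₁ + suc e → Goal
    vertical b gb B′ ey ec with walk ag R i e (suc y) b c a₁ c₁ B′ B₁ (trans (sym (+-suc y b)) ey)
                               (suc-injective (trans (sym (+-suc c₁ b)) (trans ec (+-suc (c + a₁) e)))) H′
                             | res i (suc y) ∈? R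
    ... | le , tight | yes p = ⊥-elim (H (suc y) ≤-refl y+ p (b , bead))
      where bead : g b + i + n ≡ suc y + b
            bead = trans (cong (λ z → z + i + n) gb) (trans (sym ey) (+-suc y b))
    ... | le , tight | no p =
      lin (c ∷ e ∷ c₁ ∷ fr ∷ []) (λ c e c₁ f → c ⊕ e ≼ c₁ ⊕ f ⇒ ⊢ c ⊕ (con 1 ⊕ e) ≼ c₁ ⊕ (con 1 ⊕ f)) le ,
      λ h j u v j∉ → later (lin (c ∷ e ∷ c₁ ∷ fr ∷ []) (λ c e c₁ f → c₁ ⊕ (con 1 ⊕ f) ≼ c ⊕ (con 1 ⊕ e) ⇒ ⊢ c₁ ⊕ f ≼ c ⊕ e) h) j u v j∉
      where
      later : c₁ + fr ≤ c + e → ∀ j → y < j → j ≤ y + suc e → res i j ∉ R → Bead g i j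
      later h j u v j∉ with m≤n⇒m<n∨m≡n u
      ... | inj₁ w = tight h j w (≤-trans v (≤-reflexive (+-suc y e))) j∉
      ... | inj₂ refl = b , trans (cong (λ z → z + i + n) gb) (trans (sym ey) (+-suc y b))
    step : ∀ a → OnBoundary g a c → y + a ≡ c + i + n → c₁ + a ≡ c + a₁ + suc e → Goal
    step zero (lo , _) ey ec = horizontal 0 (m≤n⇒m≤1+n lo , λ _ ()) ey ec
    step (suc b) (lo , hi) ey ec with m≤n⇒m<n∨m≡n (hi b ≤-refl)
    ... | inj₁ h = horizontal (suc b) (m≤n⇒m≤1+n lo , λ { b′ (s≤s b′≤) → ≤-trans h (anti-≤ ag b′≤) }) ey ec
    ... | inj₂ h = vertical b (sym h) (≤-reflexive (sym h) , λ b′ b′< → hi b′ (m≤n⇒m≤1+n b′<)) ey ec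

-- Weak strips

module Weaks (k : ℕ) where
  open Cores k

  psum-snoc : ∀ p i c → psum p i (suc c) ≡ psum p i c + p (i + c)
  psum-snoc p i zero = trans (+-identityʳ (p i)) (cong p (sym (+-identityʳ i)))
  psum-snoc p i (suc c) = trans (cong (λ z → p i + z) (psum-snoc p (suc i) c))
    (trans (sym (+-assoc (p i) _ _)) (cong (λ z → p i + psum p (suc i) c + p z) (sym (+-suc i c))))

  psum-+ : ∀ p i c d → psum p i (c + d) ≡ psum p i c + psum p (i + c) d
  psum-+ p i zero d = cong (λ z → psum p z d) (sym (+-identityʳ i))
  psum-+ p i (suc c) d = trans (cong (λ z → p i + z) (psum-+ p (suc i) c d))
    (trans (sym (+-assoc (p i) _ _)) (cong (λ z → p i + psum p (suc i) c + psum p z d) (sym (+-suc i c))))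

  psum-cong : ∀ {p q} i j c → (∀ x → x < c → p (i + x) ≡ q (j + x)) → psum p i c ≡ psum q j c
  psum-cong i j zero h = refl
  psum-cong {p} {q} i j (suc c) h = cong₂ _+_
    (subst₂ (λ a b → p a ≡ q b) (+-identityʳ i) (+-identityʳ j) (h 0 (s≤s z≤n)))
    (psum-cong (suc i) (suc j) c λ x l → subst₂ (λ a b → p a ≡ q b) (+-suc i x) (+-suc j x) (h (suc x) (s≤s l)))

  psum-≤ : ∀ {p q} i c → (∀ x → i ≤ x → x < i + c → p x ≤ q x) → psum p i c ≤ psum q i c
  psum-≤ i zero h = z≤n
  psum-≤ i (suc c) h = +-mono-≤ (h i ≤-refl (m<m+n i (s≤s z≤n)))
    (psum-≤ (suc i) c λ x a b → h x (<⇒≤ a) (≤-trans b (≤-reflexive (sym (+-suc i c)))))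

  psum-≡⇒ : ∀ {p q} i c → (∀ x → i ≤ x → x < i + c → p x ≤ q x) → psum p i c ≡ psum q i c →
    ∀ x → i ≤ x → x < i + c → p x ≡ q x
  psum-≡⇒ i zero h e x a b = ⊥-elim (<⇒≱ b (≤-trans (≤-reflexive (+-identityʳ i)) a))
  psum-≡⇒ {p} {q} i (suc c) h e x a b with m≤n⇒m<n∨m≡n a
  ... | inj₁ i<x = psum-≡⇒ (suc i) c h′
          (lin (p i ∷ q i ∷ psum p (suc i) c ∷ psum q (suc i) c ∷ []) (λ a b c d → a ⊕ c ≐ b ⊕ d ⇒ a ≼ b ⇒ c ≼ d ⇒ ⊢ c ≐ d)
            e (h i ≤-refl (m<m+n i (s≤s z≤n))) (psum-≤ (suc i) c h′))
          x i<x (≤-trans b (≤-reflexive (+-suc i c)))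
    where h′ : ∀ x → suc i ≤ x → x < suc i + c → p x ≤ q x
          h′ x a b = h x (<⇒≤ a) (≤-trans b (≤-reflexive (sym (+-suc i c))))
  ... | inj₂ refl = lin (p i ∷ q i ∷ psum p (suc i) c ∷ psum q (suc i) c ∷ []) (λ a b c d → a ⊕ c ≐ b ⊕ d ⇒ a ≼ b ⇒ c ≼ d ⇒ ⊢ a ≐ b)
            e (h i ≤-refl (m<m+n i (s≤s z≤n))) (psum-≤ (suc i) c λ x a b → h x (<⇒≤ a) (≤-trans b (≤-reflexive (sym (+-suc i c)))))

  module Over {f p′ g p} (Cf : IsC f p′) (Cg : IsC g p) (S : Strip f g) where
    open Strip S

    -- By `law` the first `f i` - `p′ i` columns are filled in a row of `f` above row `i`, so in a
    -- horizontal strip they are filled in row `i` of `g`.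
    row-≤ : ∀ i → f i ≤ g i + p′ i
    row-≤ i = ≤-trans (≤-reflexive (sym (law Cf i))) (+-monoˡ-≤ (p′ i) (above′ (anti Cg) (s≤s (m≤n+m i _))))

    row-≤k : ∀ i → f i ∸ g i ≤ k
    row-≤k i = ≤-trans (m≤n+o⇒m∸n≤o (f i) (g i) (row-≤ i)) (p≤k Cf i)

    -- A crossed cell in a higher row lies in a column that is a gap of `g` at that height. Its
    -- content is congruent to that of cell `y` and smaller, hence at most the content `n` below
    -- `y`, and `noBead` applies.
    crossing-no-bead : ∀ i c y → g i < y → res i y ∈ stripRes f g (suc i) c → ¬ Bead g i y
    crossing-no-bead i c y gi<y q (r′ , bead) with stripRes⁻ f g (suc i) c below q
    ... | r , j , i<r , _ , gr<j , j≤fr , e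
      with res-⇒ r j i y (sym e) (<⇒≤ (+-mono-< (≤-trans (s≤s (≤-trans j≤fr (above′ (anti Cg) i<r))) gi<y) i<r))
    ... | zero , e′ = lin (y ∷ r ∷ j ∷ i ∷ g i ∷ f r ∷ [])
          (λ y r j i gi fr → y ⊕ r ≐ j ⊕ i ⊕ con 0 ⇒ gi ≺ y ⇒ j ≼ fr ⇒ fr ≼ gi ⇒ i ≺ r ⇒ ⊢⊥) e′ gi<y j≤fr (above′ (anti Cg) i<r) i<r
    ... | suc m , e′ = noBead Cg (gr<j , λ b b<r → ≤-trans j≤fr (above′ (anti Cg) b<r)) m r′
          (lin (y ∷ r ∷ j ∷ i ∷ k ∷ m * n ∷ g r′ ∷ r′ ∷ [])
            (λ y r j i k m g r′ → y ⊕ r ≐ j ⊕ i ⊕ (con 1 ⊕ k ⊕ m) ⇒ g ⊕ i ⊕ (con 1 ⊕ k) ≐ y ⊕ r′ ⇒ ⊢ g ⊕ r ≐ j ⊕ r′ ⊕ m) e′ bead)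

    -- The walk starts `n` below the end of row `i` of `g` and stops `n` below the end of row `i` of
    -- `f`. By `law` these points are ends of rows `a` of `g` and `a₁` of `f`, in columns `g i` -
    -- `p i` and `f i` - `p′ i`. The second point is also on the boundary of `g`, because f / g is a
    -- horizontal strip.
    row-walk : ∀ i c → let R = stripRes f g (suc i) c in
      (p′ i ≤ p i + fresh (rowRes f g i) R) ×
      (p i + fresh (rowRes f g i) R ≤ p′ i → ∀ j → g i < j → j ≤ f i → res i j ∉ R → Bead g i j)
    row-walk i c = let (le , tight) = w in
        lin (g a ∷ f i ∸ g i ∷ f a₁ ∷ fr ∷ p i ∷ p′ i ∷ f i ∷ g i ∷ [])
          (λ c e c₁ fr p p′ f g → c ⊕ e ≼ c₁ ⊕ fr ⇒ c ⊕ p ≐ g ⇒ c₁ ⊕ p′ ≐ f ⇒ g ⊕ e ≐ f ⇒ ⊢ p′ ≼ p ⊕ fr)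
          le (law Cg i) (law Cf i) (m+[n∸m]≡n (below i)) ,
        λ h j u v → tight (lin (g a ∷ f i ∸ g i ∷ f a₁ ∷ fr ∷ p i ∷ p′ i ∷ f i ∷ g i ∷ [])
          (λ c e c₁ fr p p′ f g → p ⊕ fr ≼ p′ ⇒ c ⊕ p ≐ g ⇒ c₁ ⊕ p′ ≐ f ⇒ g ⊕ e ≐ f ⇒ ⊢ c₁ ⊕ fr ≼ c ⊕ e)
          h (law Cg i) (law Cf i) (m+[n∸m]≡n (below i))) j u (≤-trans v (≤-reflexive (sym (m+[n∸m]≡n (below i)))))
      where
      R = stripRes f g (suc i) c
      fr = fresh (rowRes f g i) R
      a = suc (k ∸ p i) + i
      a₁ = suc (k ∸ p′ i) + i
      w = walk (anti Cg) R i (f i ∸ g i) (g i) a (g a) a₁ (f a₁)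
            (≤-refl , λ b h → anti-≤ (anti Cg) (<⇒≤ h))
            (below a₁ , λ b h → above′ (anti Cg) h)
            (lin (g i ∷ g a ∷ p i ∷ k ∸ p i ∷ k ∷ i ∷ []) (λ gi ga p q k i → ga ⊕ p ≐ gi ⇒ q ⊕ p ≐ k ⇒
               ⊢ gi ⊕ (con 1 ⊕ q ⊕ i) ≐ ga ⊕ i ⊕ (con 1 ⊕ k)) (law Cg i) (q+p Cg i))
            (lin (g i ∷ g a ∷ p i ∷ k ∸ p i ∷ k ∷ i ∷ f i ∷ f a₁ ∷ p′ i ∷ k ∸ p′ i ∷ f i ∸ g i ∷ [])
              (λ gi ga p q k i fi fa p′ q′ e → ga ⊕ p ≐ gi ⇒ q ⊕ p ≐ k ⇒ fa ⊕ p′ ≐ fi ⇒ q′ ⊕ p′ ≐ k ⇒ gi ⊕ e ≐ fi ⇒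
               ⊢ fa ⊕ (con 1 ⊕ q ⊕ i) ≐ ga ⊕ (con 1 ⊕ q′ ⊕ i) ⊕ e)
              (law Cg i) (q+p Cg i) (law Cf i) (q+p Cf i) (m+[n∸m]≡n (below i)))
            (λ j u v → crossing-no-bead i c j u)

    count-suc : ∀ i c → nDistinct (stripRes f g i (suc c)) ≡
      fresh (rowRes f g i) (stripRes f g (suc i) c) + nDistinct (stripRes f g (suc i) c)
    count-suc i c = nDistinct-++ (stripRes f g (suc i) c) (cellsRes-unique i (g i) _ (row-≤k i))

    -- The row bounds are added from the top, so that each residue is counted in the highest row
    -- where it occurs. Weak strips are the case of equality.
    size-≤ : ∀ i c → psum p′ i c ≤ psum p i c + nDistinct (stripRes f g i c)
    size-≤ i zero = z≤n
    size-≤ i (suc c) rewrite count-suc i c =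
      lin (p′ i ∷ p i ∷ fresh (rowRes f g i) (stripRes f g (suc i) c) ∷ psum p′ (suc i) c ∷ psum p (suc i) c ∷ nDistinct (stripRes f g (suc i) c) ∷ [])
        (λ a b fr P Q N → a ≼ b ⊕ fr ⇒ P ≼ Q ⊕ N ⇒ ⊢ a ⊕ P ≼ b ⊕ Q ⊕ (fr ⊕ N)) (proj₁ (row-walk i c)) (size-≤ (suc i) c)

    -- In a weak strip every crossed content whose lower neighbour is a gap of g is crossed again higher up.
    Tight : ℕ → ℕ → Set
    Tight i hi = p i ≤ p′ i × (∀ j → g i < j → j ≤ f i → ¬ Bead g i j →
      ∃[ r ] ∃[ j′ ] (i < r × r < hi × g r < j′ × j′ ≤ f r × res i j ≡ res r j′))

    -- Equality of the sums leaves no slack in the bound of any single row, so the second half of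
    -- `row-walk` applies to each of them.
    tight : ∀ i c → psum p i c + nDistinct (stripRes f g i c) ≤ psum p′ i c → ∀ r → i ≤ r → r < i + c → Tight r (i + c)
    tight i zero h r a b = ⊥-elim (<⇒≱ b (≤-trans (≤-reflexive (+-identityʳ i)) a))
    tight i (suc c) h r a b with m≤n⇒m<n∨m≡n a
    ... | inj₁ i<r = subst (Tight r) (sym (+-suc i c)) (tight (suc i) c
          (lin (p′ i ∷ p i ∷ fresh (rowRes f g i) (stripRes f g (suc i) c) ∷ psum p′ (suc i) c ∷ psum p (suc i) c ∷ nDistinct (stripRes f g (suc i) c) ∷ [])
            (λ a b fr P Q N → b ⊕ Q ⊕ (fr ⊕ N) ≼ a ⊕ P ⇒ a ≼ b ⊕ fr ⇒ ⊢ Q ⊕ N ≼ P)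
            (subst (λ z → p i + psum p (suc i) c + z ≤ p′ i + psum p′ (suc i) c) (count-suc i c) h) (proj₁ (row-walk i c)))
          r i<r (≤-trans b (≤-reflexive (+-suc i c))))
    ... | inj₂ refl = ≤-trans (m≤m+n (p i) _) row , crit
      where
      row : p i + fresh (rowRes f g i) (stripRes f g (suc i) c) ≤ p′ i
      row = lin (p′ i ∷ p i ∷ fresh (rowRes f g i) (stripRes f g (suc i) c) ∷ psum p′ (suc i) c ∷ psum p (suc i) c ∷ nDistinct (stripRes f g (suc i) c) ∷ [])
            (λ a b fr P Q N → b ⊕ Q ⊕ (fr ⊕ N) ≼ a ⊕ P ⇒ P ≼ Q ⊕ N ⇒ ⊢ b ⊕ fr ≼ a)
            (subst (λ z → p i + psum p (suc i) c + z ≤ p′ i + psum p′ (suc i) c) (count-suc i c) h) (size-≤ (suc i) c)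
      crit : ∀ j → g i < j → j ≤ f i → ¬ Bead g i j →
        ∃[ r ] ∃[ j′ ] (i < r × r < i + suc c × g r < j′ × j′ ≤ f r × res i j ≡ res r j′)
      crit j u v nb with res i j ∈? stripRes f g (suc i) c
      ... | yes q = let (r , j′ , a , b , rest) = stripRes⁻ f g (suc i) c below q in
            r , j′ , a , ≤-trans b (≤-reflexive (sym (+-suc i c))) , rest
      ... | no q = ⊥-elim (nb (proj₂ (row-walk i c) row j u v q))

  -- `l` is the row that the strip may open on top of `g`; the later lemmas add `g l ≡ 0`.
  record Weak (l : ℕ) (f p′ g p : ℕ → ℕ) : Set where
    field
      coreF : IsC f p′
      coreG : IsC g p
      strip : Strip f g
      size : psum p′ 0 (suc l) ≡ psum p 0 (suc l) + nDistinct (stripRes f g 0 (suc l))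
    open Strip strip public
    open Over coreF coreG strip public

    row-tight : ∀ i → i ≤ l → Tight i (suc l)
    row-tight i h = tight 0 (suc l) (≤-reflexive (sym size)) i z≤n (s≤s h)

    f≥g : ∀ {x} → (∀ b → b < l → x ≤ g b) → ∀ b → b < l → x ≤ f b
    f≥g h b lt = ≤-trans (h b lt) (below b)

    module _ (gl : g l ≡ 0) where

      top≤k : f l ≤ k
      top≤k = subst (λ z → f l ∸ z ≤ k) gl (row-≤k l)

      gap-g : ∀ {x} → 1 ≤ x → (∀ b → b < l → x ≤ g b) → Gap g l x
      gap-g 1≤x h = subst (λ z → z < _) (sym gl) 1≤x , h

      private
        go : ∀ d i y x → l ≤ i + d → i ≤ l → 1 ≤ x → x ≤ k → (∀ b → b < l → x ≤ g b) → g i < y → y ≤ f i →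
          res l x ≡ res i y → x ≤ f l
        go d i y x e h 1≤x x≤k gap u v er with m≤n⇒m<n∨m≡n h
        go d i y x e h 1≤x x≤k gap u v er | inj₂ refl with ≤-total x y
        ... | inj₁ x≤y = ≤-trans x≤y v
        ... | inj₂ y≤x = ≤-trans (≤-reflexive (sym (res-close l y x (sym er) y≤x (≤-trans x≤k (m≤n+m k y))))) v
        go zero i y x e h 1≤x x≤k gap u v er | inj₁ i<l = ⊥-elim (<⇒≱ i<l (≤-trans e (≤-reflexive (+-identityʳ i))))
        go (suc d) i y x e h 1≤x x≤k gap u v er | inj₁ i<l with proj₂ (row-tight i h) y u v nb
          where
          x<y : x < y
          x<y = ≤-trans (s≤s (gap i i<l)) u
          nb : ¬ Bead g i y
          nb (r , bead) with res-⇒ l x i y er (+-mono-≤ (<⇒≤ x<y) (<⇒≤ i<l))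
          ... | zero , e′ = lin (y ∷ l ∷ x ∷ i ∷ []) (λ y l x i → y ⊕ l ≐ x ⊕ i ⊕ con 0 ⇒ x ≺ y ⇒ i ≺ l ⇒ ⊢⊥) e′ x<y i<l
          ... | suc m , e′ = noBead coreG (gap-g 1≤x gap) m r
                (lin (y ∷ l ∷ x ∷ i ∷ k ∷ m * n ∷ g r ∷ r ∷ [])
                  (λ y l x i k m g r → y ⊕ l ≐ x ⊕ i ⊕ (con 1 ⊕ k ⊕ m) ⇒ g ⊕ i ⊕ (con 1 ⊕ k) ≐ y ⊕ r ⇒ ⊢ g ⊕ l ≐ x ⊕ r ⊕ m) e′ bead)
        ... | r , j′ , a , b , c , c′ , er′ = go d r j′ x
              (≤-trans e (≤-trans (≤-reflexive (+-suc i d)) (+-monoˡ-≤ d a))) (≤-pred b) 1≤x x≤k gap c c′ (trans er er′)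

      -- Column `x` is a gap of `g` at height `l`, so by `noBead` there is no bead `n` below a cell
      -- of the same residue in a lower row. `Tight` then yields a crossing of this residue further
      -- up, and the climb ends in row `l`, where `x` ≤ `k` forces the cell `x` itself to be in `f`.
      crossed⇒top : ∀ i y x → i ≤ l → 1 ≤ x → x ≤ k → (∀ b → b < l → x ≤ g b) → g i < y → y ≤ f i →
        res l x ≡ res i y → x ≤ f l
      crossed⇒top i y x h = go (l ∸ i) i y x (m≤n+m∸n l i) h

  UnblockedCorner : (f g : ℕ → ℕ) → ℕ → Set
  UnblockedCorner f g x = ∃ λ i → g (suc i) < g i × f (suc i) < g i × x ≡ res i (g i)

-- Lengthening the top row of a weak strip

module Shifts (k : ℕ) where
  open Cores k
  open Weaks k

  data Linked (f : ℕ → ℕ) (l i : ℕ) : ℕ → Set where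
    is-linked : i ≤ l → res i (f i) ≡ res l (f l) → Linked f l i 1
    unlinked : (i ≤ l → res i (f i) ≢ res l (f l)) → Linked f l i 0

  abstract
    linked : (ℕ → ℕ) → ℕ → ℕ → ℕ
    linked f l i with i ≤? l | res i (f i) ≟ res l (f l)
    ... | yes _ | yes _ = 1
    ... | yes _ | no _ = 0
    ... | no _ | _ = 0

    linked? : ∀ f l i → Linked f l i (linked f l i)
    linked? f l i with i ≤? l | res i (f i) ≟ res l (f l)
    ... | yes a | yes b = is-linked a b
    ... | yes a | no b = unlinked (λ _ → b)
    ... | no a | _ = unlinked (λ b → ⊥-elim (a b))

  linked-yes : ∀ f l i → i ≤ l → res i (f i) ≡ res l (f l) → linked f l i ≡ 1
  linked-yes f l i a b with linked f l i | linked? f l i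
  ... | .1 | is-linked _ _ = refl
  ... | .0 | unlinked h = ⊥-elim (h a b)

  linked-no : ∀ f l i → (i ≤ l → res i (f i) ≢ res l (f l)) → linked f l i ≡ 0
  linked-no f l i h with linked f l i | linked? f l i
  ... | .1 | is-linked a b = ⊥-elim (h a b)
  ... | .0 | unlinked _ = refl

  linked-top : ∀ f l → linked f l l ≡ 1
  linked-top f l = linked-yes f l l ≤-refl refl

  -- Lengthening or shortening the top row of a core by one is a simple affine reflection: all rows whose last cell
  -- has the residue of the last cell of row l change along with it.
  plus minus : (ℕ → ℕ) → ℕ → ℕ → ℕ
  plus f l i = f i + linked f l i
  minus f l i = f i ∸ linked f l i

  atTop : (ℕ → ℕ) → (ℕ → ℕ) → ℕ → ℕ → ℕ
  atTop φ p l i with i ≟ l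
  ... | yes _ = φ (p i)
  ... | no _ = p i

  atTop-top : ∀ φ p l → atTop φ p l l ≡ φ (p l)
  atTop-top φ p l with l ≟ l
  ... | yes _ = refl
  ... | no h = ⊥-elim (h refl)

  atTop-other : ∀ φ p l i → i ≢ l → atTop φ p l i ≡ p i
  atTop-other φ p l i h with i ≟ l
  ... | yes e = ⊥-elim (h e)
  ... | no _ = refl

  -- Under 𝔭 only the top part changes, although every linked row of the core does.
  plusP minusP : (ℕ → ℕ) → ℕ → ℕ → ℕ
  plusP = atTop suc
  minusP = atTop (λ x → x ∸ 1)

  psum-atTop : ∀ φ p l → psum (atTop φ p l) 0 (suc l) ≡ psum p 0 l + φ (p l)
  psum-atTop φ p l = trans (psum-snoc (atTop φ p l) 0 l)
    (cong₂ _+_ (psum-cong 0 0 l (λ x x<l → atTop-other φ p l x (<⇒≢ x<l))) (atTop-top φ p l))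

  module _ {l f p′ g p} (W : Weak l f p′ g p) (gl : g l ≡ 0) where
    open Weak W

    beyond : ∀ i → l < i → f i ≡ 0
    beyond i h = n≤0⇒n≡0 (≤-trans (above′ (anti coreG) h) (≤-reflexive gl))

    top-p : p′ l ≡ f l
    top-p = trans (cong (λ z → z + p′ l) (sym (beyond _ (s≤s (m≤n+m l (k ∸ p′ l)))))) (law coreF l)

    module _ (hi : ∀ b → b < l → suc (f l) ≤ g b) where

      f-hi : ∀ b → b < l → suc (f l) ≤ f b
      f-hi = f≥g hi

      f-lo : ∀ i → i ≤ l → f l ≤ f i
      f-lo i h = mono coreF h

      is-linked⇒ : ∀ i → i ≤ l → res i (f i) ≡ res l (f l) → ∃ λ m → f i + l ≡ f l + i + m * n
      is-linked⇒ i h e = res-⇒ l (f l) i (f i) (sym e) (+-mono-≤ (f-lo i h) h)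

      law-res : ∀ i → res (suc (k ∸ p′ i) + i) (f (suc (k ∸ p′ i) + i)) ≡ res i (f i)
      law-res i = ⇒res _ _ i (f i) 1 (lin (f i ∷ p′ i ∷ k ∸ p′ i ∷ k ∷ i ∷ f (suc (k ∸ p′ i) + i) ∷ [])
        (λ fi p q k i fr → fr ⊕ p ≐ fi ⇒ q ⊕ p ≐ k ⇒ ⊢ fi ⊕ (con 1 ⊕ q ⊕ i) ≐ fr ⊕ i ⊕ (con 1 ⊕ k ⊕ con 0)) (law coreF i) (q+p coreF i))

      -- Moving a bead by `n` keeps its residue. If the row met lies above `l`, it is empty, so
      -- `f i` = `p′ i`, and the content at the end of row `i` exceeds that of row `l` by less than
      -- `n` but by more than 0: row `i` is not linked.
      linked-law : ∀ i → i < l → linked f l (suc (k ∸ p′ i) + i) ≡ linked f l i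
      linked-law i i<l with <-≤-connex l (suc (k ∸ p′ i) + i)
      ... | inj₁ l<r = trans (linked-no f l _ (λ h → ⊥-elim (<⇒≱ l<r h))) (sym (linked-no f l i λ h e → no-link (is-linked⇒ i h e)))
        where
        no-link : ¬ (∃ λ m → f i + l ≡ f l + i + m * n)
        no-link (zero , e) = lin (f i ∷ l ∷ f l ∷ i ∷ []) (λ fi l fl i → fi ⊕ l ≐ fl ⊕ i ⊕ con 0 ⇒ con 1 ⊕ fl ≼ fi ⇒ i ≺ l ⇒ ⊢⊥) e (f-hi i i<l) i<l
        no-link (suc m , e) = lin (f i ∷ l ∷ f l ∷ i ∷ k ∷ m * n ∷ p′ i ∷ k ∸ p′ i ∷ [])
          (λ fi l fl i k m p q → fi ⊕ l ≐ fl ⊕ i ⊕ (con 1 ⊕ k ⊕ m) ⇒ fi ≐ p ⇒ q ⊕ p ≐ k ⇒ l ≺ con 1 ⊕ q ⊕ i ⇒ ⊢⊥) e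
          (trans (sym (law coreF i)) (cong (λ z → z + p′ i) (beyond _ l<r))) (q+p coreF i) l<r
      ... | inj₂ r≤l with linked f l i | linked? f l i
      ...   | .1 | is-linked a e = linked-yes f l _ r≤l (trans (law-res i) e)
      ...   | .0 | unlinked h = linked-no f l _ (λ _ e → h (<⇒≤ i<l) (trans (sym (law-res i)) e))

      linked-beyond : ∀ i → l < i → linked f l i ≡ 0
      linked-beyond i h = linked-no f l i (λ h′ → ⊥-elim (<⇒≱ h h′))

      -- The gap in column `f l` + 1 has the content next to the end of row `l`. A bead next to the
      -- end of another linked row would be congruent to this gap and not below it.
      no-next : ∀ {φ π} → IsC φ π → Gap φ l (suc (f l)) → ∀ i → i ≤ l → res i (f i) ≡ res l (f l) → ∀ j → φ j + i ≢ suc (f i) + j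
      no-next C G i h e j e′ with is-linked⇒ i h e
      ... | m , eq = noBead C G m j (lin (f i ∷ l ∷ f l ∷ i ∷ m * n ∷ j ∷ _ ∷ [])
        (λ fi l fl i m j φj → fi ⊕ l ≐ fl ⊕ i ⊕ m ⇒ φj ⊕ i ≐ con 1 ⊕ fi ⊕ j ⇒ ⊢ φj ⊕ l ≐ con 1 ⊕ fl ⊕ j ⊕ m) eq e′)

      plus-IsC : suc (f l) ≤ k → IsC (plus f l) (plusP p′ l)
      plus-IsC s<k = record { anti = anti⁺ ; p≤k = p≤k⁺ ; law = law⁺ }
        where
        anti⁺ : Anti (plus f l)
        anti⁺ i with linked f l (suc i) | linked? f l (suc i)
        ... | .0 | unlinked _ = ≤-trans (≤-reflexive (+-identityʳ _)) (≤-trans (anti coreF i) (m≤m+n _ _))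
        ... | .1 | is-linked a e with m≤n⇒m<n∨m≡n (anti coreF i)
        ...   | inj₁ lt = ≤-trans (≤-reflexive (+-comm (f (suc i)) 1)) (≤-trans lt (m≤m+n _ _))
        ...   | inj₂ eq = ⊥-elim (no-next coreF (≤-refl , f-hi) (suc i) a e i
                  (trans (+-suc (f i) i) (cong (λ z → suc (z + i)) (sym eq))))
        p≤k⁺ : ∀ i → plusP p′ l i ≤ k
        p≤k⁺ i with i ≟ l
        ... | yes refl = ≤-trans (≤-reflexive (cong suc top-p)) s<k
        ... | no _ = p≤k coreF i
        law⁺ : ∀ i → plus f l (suc (k ∸ plusP p′ l i) + i) + plusP p′ l i ≡ plus f l i
        law⁺ i with i ≟ l
        ... | yes refl = trans (cong₂ (λ a b → a + b + suc (p′ l)) (beyond _ top<) (linked-beyond _ top<))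
                (trans (cong suc top-p) (trans (+-comm 1 (f l)) (cong (λ z → f l + z) (sym (linked-top f l)))))
          where top< : l < suc (k ∸ suc (p′ l)) + l
                top< = s≤s (m≤n+m l _)
        ... | no i≢l with <-≤-connex i l
        ...   | inj₁ i<l rewrite linked-law i i<l =
                lin (f (suc (k ∸ p′ i) + i) ∷ linked f l i ∷ p′ i ∷ f i ∷ []) (λ a d p b → a ⊕ p ≐ b ⇒ ⊢ a ⊕ d ⊕ p ≐ b ⊕ d) (law coreF i)
        ...   | inj₂ l≤i rewrite linked-beyond i (≤∧≢⇒< l≤i (λ e → i≢l (sym e)))
                             | linked-beyond (suc (k ∸ p′ i) + i) (≤-trans (s≤s l≤i) (s≤s (m≤n+m i _))) =
                lin (f (suc (k ∸ p′ i) + i) ∷ p′ i ∷ f i ∷ []) (λ a p b → a ⊕ p ≐ b ⇒ ⊢ a ⊕ con 0 ⊕ p ≐ b ⊕ con 0) (law coreF i)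

      plus-Weak : suc (f l) ≤ k → Weak l (plus f l) (plusP p′ l) g p
      plus-Weak s<k = record
        { coreF = plus-IsC s<k ; coreG = coreG ; strip = strip⁺ ; size = size⁺ }
        where
        D D⁺ : List ℕ
        D = stripRes f g 0 (suc l)
        D⁺ = stripRes (plus f l) g 0 (suc l)
        strip⁺ : Strip (plus f l) g
        strip⁺ = record { below = λ i → ≤-trans (below i) (m≤m+n _ _) ; above = above⁺ }
          where
          above⁺ : ∀ i → plus f l (suc i) ≤ g i
          above⁺ i with linked f l (suc i) | linked? f l (suc i)
          ... | .0 | unlinked _ = ≤-trans (≤-reflexive (+-identityʳ _)) (above i)
          ... | .1 | is-linked a e with m≤n⇒m<n∨m≡n (above i)
          ...   | inj₁ lt = ≤-trans (≤-reflexive (+-comm (f (suc i)) 1)) lt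
          ...   | inj₂ eq = ⊥-elim (no-next coreG (gap-g gl (s≤s z≤n) hi) (suc i) a e i
                    (trans (+-suc (g i) i) (cong (λ z → suc (z + i)) (sym eq))))
        new : ℕ
        new = res l (suc (f l))
        -- If the new residue occurred in the strip, `crossed⇒top` would put column `suc (f l)` into
        -- row `l` of `f`.
        new∉ : new ∉ D
        new∉ q with stripRes⁻ f g 0 (suc l) below q
        ... | r , j , _ , r≤l , u , v , e = <-irrefl refl (crossed⇒top gl r j (suc (f l)) (≤-pred r≤l) (s≤s z≤n) s<k hi u v e)
        ⊆ : ∀ {x} → x ∈ new ∷ D → x ∈ D⁺
        ⊆ (here refl) = stripRes⁺ (plus f l) g 0 (suc l) l (suc (f l)) z≤n ≤-refl (≤-trans (s≤s (≤-reflexive gl)) (s≤s z≤n))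
                          (≤-reflexive (trans (+-comm 1 (f l)) (cong (λ z → f l + z) (sym (linked-top f l)))))
        ⊆ (there q) with stripRes⁻ f g 0 (suc l) below q
        ... | r , j , a , b , u , v , refl = stripRes⁺ (plus f l) g 0 (suc l) r j a b u (≤-trans v (m≤m+n _ _))
        ⊇ : ∀ {x} → x ∈ D⁺ → x ∈ new ∷ D
        ⊇ q with stripRes⁻ (plus f l) g 0 (suc l) (Strip.below strip⁺) q
        ... | r , j , a , b , u , v , refl with linked f l r | linked? f l r
        ...   | .0 | unlinked _ = there (stripRes⁺ f g 0 (suc l) r j a b u (≤-trans v (≤-reflexive (+-identityʳ _))))
        ...   | .1 | is-linked x e with m≤n⇒m<n∨m≡n (≤-trans v (≤-reflexive (+-comm (f r) 1)))
        ...     | inj₁ lt = there (stripRes⁺ f g 0 (suc l) r j a b u (≤-pred lt))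
        ...     | inj₂ refl with is-linked⇒ r x e
        ...       | m , eq = here (sym (⇒res l (suc (f l)) r (suc (f r)) m (cong suc eq)))
        size⁺ : psum (plusP p′ l) 0 (suc l) ≡ psum p 0 (suc l) + nDistinct D⁺
        size⁺ = trans (trans (psum-atTop suc p′ l) (trans (+-suc _ (p′ l)) (cong suc (trans (sym (psum-snoc p′ 0 l)) size))))
          (trans (sym (+-suc _ _)) (cong (λ z → psum p 0 (suc l) + z) (trans (sym (nDistinct-∉ new∉)) (nDistinct-≈ ⊆ ⊇))))

      plus-top : plus f l l ≡ suc (f l)
      plus-top = trans (cong (λ z → f l + z) (linked-top f l)) (+-comm (f l) 1)

      minus-plus : ∀ i → minus (plus f l) l i ≡ f i
      minus-plus i with linked f l i | linked? f l i
      ... | .1 | is-linked a e = trans (cong (λ z → (f i + 1) ∸ z) (linked-yes (plus f l) l i a same)) (m+n∸n≡m (f i) 1)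
        where
        same : res i (plus f l i) ≡ res l (plus f l l)
        same rewrite linked-yes f l i a e | linked-top f l with is-linked⇒ i a e
        ... | m , eq = sym (⇒res l (f l + 1) i (f i + 1) m (lin (f i ∷ l ∷ f l ∷ i ∷ m * n ∷ [])
              (λ fi l fl i m → fi ⊕ l ≐ fl ⊕ i ⊕ m ⇒ ⊢ fi ⊕ con 1 ⊕ l ≐ fl ⊕ con 1 ⊕ i ⊕ m) eq))
      ... | .0 | unlinked h = trans (cong (λ z → (f i + 0) ∸ z) (linked-no (plus f l) l i no-link)) (+-identityʳ (f i))
        where
        no-link : i ≤ l → res i (plus f l i) ≢ res l (plus f l l)
        no-link a e rewrite linked-no f l i h | linked-top f l
          with m≤n⇒m<n∨m≡n a
        ... | inj₂ refl = h a refl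
        ... | inj₁ lt with res-⇒ l (f l + 1) i (f i + 0) (sym e) (+-mono-≤ (≤-trans (≤-reflexive (+-comm (f l) 1)) (≤-trans (f-hi i lt) (m≤m+n _ _))) a)
        ...   | m , eq = noBead coreF (≤-refl , f-hi) m i (lin (f i ∷ l ∷ f l ∷ i ∷ m * n ∷ [])
                  (λ fi l fl i m → fi ⊕ con 0 ⊕ l ≐ fl ⊕ con 1 ⊕ i ⊕ m ⇒ ⊢ fi ⊕ l ≐ con 1 ⊕ fl ⊕ i ⊕ m) eq)

      -- A corner in row `i` could become blocked only by a linked row `suc i` of length `g i` - 1.
      -- Then the bead of row `i` of `g` is two contents above the end of a linked row, hence
      -- congruent to the gap of `g` in column `f l` + 2 at height `l`.
      plus-unblocked : (∀ b → b < l → suc (suc (f l)) ≤ g b) → ∀ i → f (suc i) < g i → plus f l (suc i) < g i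
      plus-unblocked hi₂ i lt with linked f l (suc i) | linked? f l (suc i)
      ... | .0 | unlinked _ = ≤-trans (s≤s (≤-reflexive (+-identityʳ _))) lt
      ... | .1 | is-linked a e with m≤n⇒m<n∨m≡n lt
      ...   | inj₁ lt′ = ≤-trans (s≤s (≤-reflexive (+-comm (f (suc i)) 1))) lt′
      ...   | inj₂ eq with is-linked⇒ (suc i) a e
      ...     | m , eq′ = ⊥-elim (noBead coreG (gap-g gl (s≤s z≤n) hi₂) m i
                (lin (f (suc i) ∷ l ∷ f l ∷ i ∷ m * n ∷ g i ∷ [])
                  (λ fi l fl i m gi → fi ⊕ l ≐ fl ⊕ (con 1 ⊕ i) ⊕ m ⇒ con 1 ⊕ fi ≐ gi ⇒ ⊢ gi ⊕ l ≐ con 2 ⊕ fl ⊕ i ⊕ m) eq′ eq))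

      module _ (1≤s : 1 ≤ f l) where

        gap-top : Gap f (suc l) (f l)
        gap-top = ≤-trans (s≤s (≤-reflexive (beyond (suc l) ≤-refl))) 1≤s , λ b h → f-lo b (≤-pred h)

        linked-≤ : ∀ i → linked f l i ≤ f i
        linked-≤ i with linked f l i | linked? f l i
        ... | .0 | unlinked _ = z≤n
        ... | .1 | is-linked a _ = ≤-trans 1≤s (f-lo i a)

        no-prev : ∀ i → i ≤ l → res i (f i) ≡ res l (f l) → ∀ j → f j + suc i ≢ f i + j
        no-prev i a e j e′ with is-linked⇒ i a e
        ... | m , eq = noBead coreF gap-top m j (lin (f i ∷ l ∷ f l ∷ i ∷ m * n ∷ j ∷ f j ∷ [])
          (λ fi l fl i m j fj → fi ⊕ l ≐ fl ⊕ i ⊕ m ⇒ fj ⊕ (con 1 ⊕ i) ≐ fi ⊕ j ⇒ ⊢ fj ⊕ (con 1 ⊕ l) ≐ fl ⊕ j ⊕ m) eq e′)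

        minus-anti : Anti (minus f l)
        minus-anti i with linked f l i | linked? f l i
        ... | .0 | unlinked _ = ≤-trans (m∸n≤m _ (linked f l (suc i))) (anti coreF i)
        ... | .1 | is-linked a e with m≤n⇒m<n∨m≡n (anti coreF i)
        ...   | inj₁ lt = ≤-trans (m∸n≤m _ (linked f l (suc i))) (∸-monoˡ-≤ 1 lt)
        ...   | inj₂ eq = ⊥-elim (no-prev i a e (suc i) (cong (λ z → z + suc i) eq))

        minus-IsC : IsC (minus f l) (minusP p′ l)
        minus-IsC = record { anti = minus-anti ; p≤k = p≤k⁻ ; law = law⁻ }
          where
          p≤k⁻ : ∀ i → minusP p′ l i ≤ k
          p≤k⁻ i with i ≟ l
          ... | yes refl = ≤-trans (m∸n≤m _ 1) (p≤k coreF i)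
          ... | no _ = p≤k coreF i
          law⁻ : ∀ i → minus f l (suc (k ∸ minusP p′ l i) + i) + minusP p′ l i ≡ minus f l i
          law⁻ i with i ≟ l
          ... | yes refl = trans (cong₂ (λ a b → (a ∸ b) + (p′ l ∸ 1)) (beyond _ top<) (linked-beyond _ top<))
                  (trans (cong (λ z → z ∸ 1) top-p) (cong (λ z → f l ∸ z) (sym (linked-top f l))))
            where top< : l < suc (k ∸ (p′ l ∸ 1)) + l
                  top< = s≤s (m≤n+m l _)
          ... | no i≢l with <-≤-connex i l
          ...   | inj₁ i<l = trans (cong (λ z → (f r ∸ z) + p′ i) (linked-law i i<l))
                    (lin (f r ∸ linked f l i ∷ f r ∷ f i ∸ linked f l i ∷ f i ∷ linked f l i ∷ p′ i ∷ [])
                      (λ a fr b fi d p → a ⊕ d ≐ fr ⇒ b ⊕ d ≐ fi ⇒ fr ⊕ p ≐ fi ⇒ ⊢ a ⊕ p ≐ b)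
                      (m∸n+n≡m (≤-trans (≤-reflexive (sym (linked-law i i<l))) (linked-≤ r))) (m∸n+n≡m (linked-≤ i)) (law coreF i))
            where r = suc (k ∸ p′ i) + i
          ...   | inj₂ l≤i rewrite linked-beyond i (≤∧≢⇒< l≤i (λ e → i≢l (sym e)))
                               | linked-beyond (suc (k ∸ p′ i) + i) (≤-trans (s≤s l≤i) (s≤s (m≤n+m i _))) = law coreF i

        minus-Weak : suc (f l) ≤ k → Weak l (minus f l) (minusP p′ l) g p
        minus-Weak s<k = record { coreF = minus-IsC ; coreG = coreG ; strip = strip⁻ ; size = size⁻ }
          where
          D D⁻ : List ℕ
          D = stripRes f g 0 (suc l)
          D⁻ = stripRes (minus f l) g 0 (suc l)
          strip⁻ : Strip (minus f l) g
          strip⁻ = record { below = below⁻ ; above = λ i → ≤-trans (m∸n≤m _ (linked f l (suc i))) (above i) }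
            where
            below⁻ : ∀ i → g i ≤ minus f l i
            below⁻ i with linked f l i | linked? f l i
            ... | .0 | unlinked _ = below i
            ... | .1 | is-linked a e with m≤n⇒m<n∨m≡n (below i)
            ...   | inj₁ lt = ∸-monoˡ-≤ 1 lt
            ...   | inj₂ eq with is-linked⇒ i a e
            ...     | m , eq′ = ⊥-elim (noBead coreG (gap-g gl 1≤s (λ b h → <⇒≤ (hi b h))) m i (trans (cong (λ z → z + l) eq) eq′))
          new : ℕ
          new = res l (f l)
          -- A remaining cell of this residue is not the last one of its row in `f`, since linked
          -- last cells have been removed. So the next cell is crossed as well; it has the residue
          -- of column `f l` + 1 in row `l`, and `crossed⇒top` would lengthen row `l`.
          new∉ : new ∉ D⁻
          new∉ q with stripRes⁻ (minus f l) g 0 (suc l) (Strip.below strip⁻) q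
          ... | r , j , _ , r≤l , u , v , e with m≤n⇒m<n∨m≡n (≤-trans v (m∸n≤m (f r) (linked f l r)))
          ...   | inj₂ refl = <⇒≱ (∸-monoʳ-< {f r} {1} {0} (s≤s z≤n) (≤-trans 1≤s (f-lo r (≤-pred r≤l))))
                   (subst (λ z → f r ≤ f r ∸ z) (linked-yes f l r (≤-pred r≤l) (sym e)) v)
          ...   | inj₁ j<fr with res-⇒ l (f l) r j e (+-mono-≤ (≤-trans lo (<⇒≤ u)) (≤-pred r≤l))
            where lo : f l ≤ g r
                  lo with m≤n⇒m<n∨m≡n (≤-pred r≤l)
                  ... | inj₁ r<l = <⇒≤ (hi r r<l)
                  ... | inj₂ refl = ⊥-elim (<⇒≢ j<fr (res-close l j (f l) (sym e) (<⇒≤ j<fr) (≤-trans (<⇒≤ s<k) (m≤n+m k j))))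
          ...     | m , eq = <-irrefl refl (crossed⇒top gl r (suc j) (suc (f l)) (≤-pred r≤l) (s≤s z≤n) s<k hi (m≤n⇒m≤1+n u) j<fr
                      (⇒res l (suc (f l)) r (suc j) m (cong suc eq)))
          ⊆ : ∀ {x} → x ∈ D → x ∈ new ∷ D⁻
          ⊆ q with stripRes⁻ f g 0 (suc l) below q
          ... | r , j , a , b , u , v , refl with j ≤? minus f l r
          ...   | yes h = there (stripRes⁺ (minus f l) g 0 (suc l) r j a b u h)
          ...   | no h with linked f l r | linked? f l r
          ...     | .0 | unlinked _ = ⊥-elim (h v)
          ...     | .1 | is-linked x e with m≤n⇒m<n∨m≡n v
          ...       | inj₁ lt = ⊥-elim (h (∸-monoˡ-≤ 1 lt))
          ...       | inj₂ refl = here e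
          ⊇ : ∀ {x} → x ∈ new ∷ D⁻ → x ∈ D
          ⊇ (here refl) = stripRes⁺ f g 0 (suc l) l (f l) z≤n ≤-refl (≤-trans (s≤s (≤-reflexive gl)) 1≤s) ≤-refl
          ⊇ (there q) with stripRes⁻ (minus f l) g 0 (suc l) (Strip.below strip⁻) q
          ... | r , j , a , b , u , v , refl = stripRes⁺ f g 0 (suc l) r j a b u (≤-trans v (m∸n≤m _ (linked f l r)))
          size⁻ : psum (minusP p′ l) 0 (suc l) ≡ psum p 0 (suc l) + nDistinct D⁻
          size⁻ = trans (psum-atTop _ p′ l)
            (lin (psum p′ 0 l ∷ p′ l ∷ p′ l ∸ 1 ∷ psum p 0 (suc l) ∷ nDistinct D ∷ nDistinct D⁻ ∷ psum p′ 0 (suc l) ∷ [])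
              (λ P a b Q N M P′ → b ⊕ con 1 ≐ a ⇒ P′ ≐ P ⊕ a ⇒ P′ ≐ Q ⊕ N ⇒ N ≐ con 1 ⊕ M ⇒ ⊢ P ⊕ b ≐ Q ⊕ M)
              (m∸n+n≡m (≤-trans 1≤s (≤-reflexive (sym top-p)))) (psum-snoc p′ 0 l) size (trans (nDistinct-≈ ⊆ ⊇) (nDistinct-∉ new∉)))

        minus-top : suc (minus f l l) ≡ f l
        minus-top = trans (cong (λ z → suc (f l ∸ z)) (linked-top f l)) (m+[n∸m]≡n 1≤s)

        plus-minus : ∀ i → plus (minus f l) l i ≡ f i
        plus-minus i with linked f l i | linked? f l i
        ... | .1 | is-linked a e = trans (cong (λ z → (f i ∸ 1) + z) (linked-yes (minus f l) l i a same)) (m∸n+n≡m (≤-trans 1≤s (f-lo i a)))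
          where
          same : res i (minus f l i) ≡ res l (minus f l l)
          same rewrite linked-yes f l i a e | linked-top f l with is-linked⇒ i a e
          ... | m , eq = sym (⇒res l (f l ∸ 1) i (f i ∸ 1) m (lin (f i ∷ l ∷ f l ∷ i ∷ m * n ∷ f i ∸ 1 ∷ f l ∸ 1 ∷ [])
                (λ fi l fl i m x y → fi ⊕ l ≐ fl ⊕ i ⊕ m ⇒ x ⊕ con 1 ≐ fi ⇒ y ⊕ con 1 ≐ fl ⇒ ⊢ x ⊕ l ≐ y ⊕ i ⊕ m) eq
                (m∸n+n≡m (≤-trans 1≤s (f-lo i a))) (m∸n+n≡m 1≤s)))
        ... | .0 | unlinked h = trans (cong (λ z → f i + z) (linked-no (minus f l) l i no-link)) (+-identityʳ (f i))
          where
          no-link : i ≤ l → res i (minus f l i) ≢ res l (minus f l l)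
          no-link a e rewrite linked-no f l i h | linked-top f l
            with res-⇒ l (f l ∸ 1) i (f i) (sym e) (+-mono-≤ (≤-trans (m∸n≤m _ 1) (f-lo i a)) a)
          ... | m , eq = noBead coreF gap-top m i (lin (f i ∷ l ∷ f l ∷ i ∷ m * n ∷ f l ∸ 1 ∷ [])
                  (λ fi l fl i m y → fi ⊕ l ≐ y ⊕ i ⊕ m ⇒ y ⊕ con 1 ≐ fl ⇒ ⊢ fi ⊕ (con 1 ⊕ l) ≐ fl ⊕ i ⊕ m) eq (m∸n+n≡m 1≤s))

-- The core of a multiple rectangle

cons : ℕ → (ℕ → ℕ) → ℕ → ℕ
cons x r zero = x
cons x r (suc i) = r i

rep : ℕ → ℕ → (ℕ → ℕ) → ℕ → ℕ
rep zero y r = r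
rep (suc m) y r = cons y (rep m y r)

rep-lo : ∀ m y r i → i < m → rep m y r i ≡ y
rep-lo (suc m) y r zero h = refl
rep-lo (suc m) y r (suc i) (s≤s h) = rep-lo m y r i h

rep-hi : ∀ m y r i → rep m y r (m + i) ≡ r i
rep-hi zero y r i = refl
rep-hi (suc m) y r i = rep-hi m y r i

data Split (m i : ℕ) : Set where
  lo : i < m → Split m i
  hi : ∀ x → i ≡ m + x → Split m i

split : ∀ m i → Split m i
split m i with <-≤-connex i m
... | inj₁ h = lo h
... | inj₂ h = hi (i ∸ m) (sym (m+[n∸m]≡n h))

module Stairs (k T q : ℕ) (q+T : q + T ≡ k) (1≤T : 1 ≤ T) where
  open Cores k
  open Weaks k

  N : ℕ
  N = suc q

  -- The core of R_T^a ∪ (e) for e ≤ T.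
  st : ℕ → ℕ → ℕ → ℕ
  st zero e = cons e (λ _ → 0)
  st (suc a) e = cons (suc a * T + e) (rep q (suc a * T) (st a e))

  pst : ℕ → ℕ → ℕ → ℕ
  pst zero e = cons e (λ _ → 0)
  pst (suc a) e = rep N T (pst a e)

  -- One row more than `a` blocks of `N` rows, as room for the top row `e`.
  height : ℕ → ℕ
  height zero = 1
  height (suc a) = N + height a

  st-head : ∀ a e → st a e 0 ≡ a * T + e
  st-head zero e = refl
  st-head (suc a) e = refl

  st-mid : ∀ a e i → i < q → st (suc a) e (suc i) ≡ suc a * T
  st-mid a e i h = rep-lo q _ _ i h

  st-hi : ∀ a e x → st (suc a) e (N + x) ≡ st a e x
  st-hi a e x = rep-hi q _ _ x

  st-block : ∀ a e i → i < N → st a e i + T ≡ st (suc a) e i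
  st-block a e zero h = trans (cong (λ z → z + T) (st-head a e))
    (lin (a * T ∷ e ∷ T ∷ []) (λ x e t → ⊢ x ⊕ e ⊕ t ≐ t ⊕ x ⊕ e) )
  st-block zero e (suc i) (s≤s h) = trans (sym (+-identityʳ T)) (sym (st-mid 0 e i h))
  st-block (suc a) e (suc i) (s≤s h) = trans (cong (λ z → z + T) (st-mid a e i h)) (trans (+-comm _ T) (sym (st-mid (suc a) e i h)))

  T≤k : T ≤ k
  T≤k = ≤-trans (m≤n+m T q) (≤-reflexive q+T)

  k∸T : k ∸ T ≡ q
  k∸T = trans (cong (λ z → z ∸ T) (sym q+T)) (m+n∸n≡m q T)

  module _ {e : ℕ} (e≤T : e ≤ T) where

    st-anti : ∀ a → Anti (st a e)
    st-anti zero zero = z≤n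
    st-anti zero (suc i) = z≤n
    st-anti (suc a) i with split N (suc i)
    st-anti (suc a) .(q + 0) | hi zero refl = ≤-trans (≤-reflexive (trans (st-hi a e 0) (st-head a e)))
      (≤-trans (≤-trans (+-monoʳ-≤ (a * T) e≤T) (≤-reflexive (+-comm (a * T) T))) (low (q + 0) (≤-reflexive (+-identityʳ q))))
      where
      low : ∀ i → i ≤ q → suc a * T ≤ st (suc a) e i
      low zero h = m≤m+n _ e
      low (suc i) h = ≤-reflexive (sym (st-mid a e i h))
    st-anti (suc a) .(q + suc x) | hi (suc x) refl = ≤-trans (≤-reflexive (st-hi a e (suc x)))
      (≤-trans (st-anti a x) (≤-reflexive (trans (sym (st-hi a e x)) (cong (st (suc a) e) (sym (+-suc q x))))))
    st-anti (suc a) zero | lo (s≤s h) = ≤-trans (≤-reflexive (st-mid a e 0 h)) (m≤m+n _ e)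
    st-anti (suc a) (suc i) | lo (s≤s h) = ≤-reflexive (trans (st-mid a e (suc i) h) (sym (st-mid a e i (<⇒≤ h))))

    pst-≤ : ∀ a i → pst a e i ≤ T
    pst-≤ zero zero = e≤T
    pst-≤ zero (suc i) = z≤n
    pst-≤ (suc a) i with split N i
    ... | lo h = ≤-reflexive (rep-lo N T _ i h)
    ... | hi x refl = ≤-trans (≤-reflexive (rep-hi N T _ x)) (pst-≤ a x)

    st-law : ∀ a i → st a e (suc (k ∸ pst a e i) + i) + pst a e i ≡ st a e i
    st-law zero zero = refl
    st-law zero (suc i) = refl
    st-law (suc a) i with split N i
    ... | lo h rewrite rep-lo N T (pst a e) i h | k∸T = trans (cong (λ z → z + T) (st-hi a e i)) (st-block a e i h)
    ... | hi x refl rewrite rep-hi N T (pst a e) x =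
      trans (cong (λ z → z + pst a e x) (trans (cong (st (suc a) e) (lin (k ∸ pst a e x ∷ q ∷ x ∷ []) (λ a q x → ⊢ con 1 ⊕ a ⊕ (con 1 ⊕ q ⊕ x) ≐ con 1 ⊕ q ⊕ (con 1 ⊕ a ⊕ x))))
              (st-hi a e (suc (k ∸ pst a e x) + x))))
        (trans (st-law a x) (sym (st-hi a e x)))

    st-IsC : ∀ a → IsC (st a e) (pst a e)
    st-IsC a = record { anti = st-anti a ; p≤k = λ i → ≤-trans (pst-≤ a i) T≤k ; law = st-law a }

  st-mono : ∀ {e e′} → e ≤ e′ → ∀ a i → st a e i ≤ st a e′ i
  st-mono h zero zero = h
  st-mono h zero (suc i) = z≤n
  st-mono {e} {e′} h (suc a) i with split N i
  st-mono h (suc a) zero | lo _ = +-monoʳ-≤ (suc a * T) h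
  st-mono {e} {e′} h (suc a) (suc i) | lo (s≤s l) = ≤-reflexive (trans (st-mid a e i l) (sym (st-mid a e′ i l)))
  st-mono {e} {e′} h (suc a) .(N + x) | hi x refl = ≤-trans (≤-reflexive (st-hi a e x)) (≤-trans (st-mono h a x) (≤-reflexive (sym (st-hi a e′ x))))

  st-above : ∀ {e} → e ≤ T → ∀ a i → st a e (suc i) ≤ st a 0 i
  st-above h zero i = z≤n
  st-above {e} h (suc a) i with split N (suc i)
  st-above {e} h (suc a) .(q + 0) | hi zero refl = ≤-trans (≤-reflexive (trans (st-hi a e 0) (st-head a e)))
      (≤-trans (≤-trans (+-monoʳ-≤ (a * T) h) (≤-reflexive (+-comm (a * T) T))) (low (q + 0) (≤-reflexive (+-identityʳ q))))
      where
      low : ∀ i → i ≤ q → suc a * T ≤ st (suc a) 0 i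
      low zero h = m≤m+n _ 0
      low (suc i) h = ≤-reflexive (sym (st-mid a 0 i h))
  st-above {e} h (suc a) .(q + suc x) | hi (suc x) refl = ≤-trans (≤-reflexive (st-hi a e (suc x)))
      (≤-trans (st-above h a x) (≤-reflexive (trans (sym (st-hi a 0 x)) (cong (st (suc a) 0) (sym (+-suc q x))))))
  st-above {e} h (suc a) zero | lo (s≤s l) = ≤-trans (≤-reflexive (st-mid a e 0 l)) (m≤m+n _ 0)
  st-above {e} h (suc a) (suc i) | lo (s≤s l) = ≤-reflexive (trans (st-mid a e (suc i) l) (sym (st-mid a 0 i (<⇒≤ l))))

  st-beyond : ∀ a e i → height a ≤ i → st a e i ≡ 0
  st-beyond zero e (suc i) h = refl
  st-beyond (suc a) e i h with split N i
  ... | lo l = ⊥-elim (<⇒≱ l (≤-trans (m≤m+n N (height a)) h))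
  ... | hi x refl = trans (st-hi a e x) (st-beyond a e x (+-cancelˡ-≤ N _ _ h))

  -- Going up by a block changes the content at the end of its first row by -(`N` + `T`) = -`n`.
  -- Hence the `e` cells added to the different blocks have the same residues as those added to row
  -- 0.
  st-corner : ∀ a e i → st a 0 i < st a e i →
    st a e i ≡ st a 0 i + e × ∃ λ b → a * T + i ≡ st a 0 i + b * n
  st-corner zero e zero h = refl , 0 , refl
  st-corner (suc a) e i h with split N i
  st-corner (suc a) e zero h | lo _ = cong (λ z → z + e) (sym (+-identityʳ (suc a * T))) , 0 , sym (+-identityʳ _)
  st-corner (suc a) e (suc i) h | lo (s≤s l) = ⊥-elim (<⇒≢ h (trans (st-mid a 0 i l) (sym (st-mid a e i l))))
  st-corner (suc a) e .(N + x) h | hi x refl with st-corner a e x (subst₂ _<_ (st-hi a 0 x) (st-hi a e x) h)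
  ... | c , b , d = trans (st-hi a e x) (trans c (cong (λ z → z + e) (sym (st-hi a 0 x)))) , suc b ,
      trans (lin (T ∷ a * T ∷ q ∷ x ∷ st a 0 x ∷ b * n ∷ k ∷ []) (λ t at q x s b k → at ⊕ x ≐ s ⊕ b ⇒ q ⊕ t ≐ k ⇒
         ⊢ t ⊕ at ⊕ (con 1 ⊕ q ⊕ x) ≐ s ⊕ (con 1 ⊕ k ⊕ b)) d q+T) (cong (λ z → z + suc b * n) (sym (st-hi a 0 x)))

  st-drop : ∀ a e i → st a 0 (suc i) < st a 0 i →
    st a 0 i ≡ st a 0 (suc i) + T × st a e (suc i) ≡ st a 0 (suc i) + e × ∃ λ b → a * T + suc i ≡ st a 0 (suc i) + b * n
  st-drop zero e zero ()
  st-drop zero e (suc i) ()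
  st-drop (suc a) e i h with split N (suc i)
  st-drop (suc a) e .(q + 0) h | hi zero refl =
      trans (trans (top (q + 0) (≤-reflexive (+-identityʳ q))) (+-comm T (a * T))) (cong (λ z → z + T) (sym h0)) ,
      trans (trans (st-hi a e 0) (st-head a e)) (cong (λ z → z + e) (sym h0)) ,
      1 , trans (lin (T ∷ a * T ∷ q ∷ k ∷ []) (λ t at q k → q ⊕ t ≐ k ⇒ ⊢ t ⊕ at ⊕ (con 1 ⊕ (q ⊕ con 0)) ≐ at ⊕ (con 1 ⊕ k ⊕ con 0)) q+T) (cong (λ z → z + 1 * n) (sym h0))
    where
    h0 : st (suc a) 0 (suc (q + 0)) ≡ a * T
    h0 = trans (st-hi a 0 0) (trans (st-head a 0) (+-identityʳ _))
    top : ∀ i → i ≤ q → st (suc a) 0 i ≡ suc a * T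
    top zero h = +-identityʳ _
    top (suc i) h = st-mid a 0 i h
  st-drop (suc a) e .(q + suc x) h | hi (suc x) refl with st-drop a e x (subst₂ _<_ (st-hi a 0 (suc x)) prev h)
    where prev : st (suc a) 0 (q + suc x) ≡ st a 0 x
          prev = trans (cong (st (suc a) 0) (+-suc q x)) (st-hi a 0 x)
  ... | c , d , b , f = trans (trans (cong (st (suc a) 0) (+-suc q x)) (st-hi a 0 x)) (trans c (cong (λ z → z + T) (sym (st-hi a 0 (suc x))))) ,
      trans (st-hi a e (suc x)) (trans d (cong (λ z → z + e) (sym (st-hi a 0 (suc x))))) , suc b ,
      trans (lin (T ∷ a * T ∷ q ∷ x ∷ st a 0 (suc x) ∷ b * n ∷ k ∷ []) (λ t at q x s b k → at ⊕ (con 1 ⊕ x) ≐ s ⊕ b ⇒ q ⊕ t ≐ k ⇒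
         ⊢ t ⊕ at ⊕ (con 1 ⊕ (q ⊕ (con 1 ⊕ x))) ≐ s ⊕ (con 1 ⊕ k ⊕ b)) f q+T) (cong (λ z → z + suc b * n) (sym (st-hi a 0 (suc x))))
  st-drop (suc a) e zero h | lo (s≤s l) = ⊥-elim (<⇒≢ h (trans (st-mid a 0 0 l) (sym (+-identityʳ _))))
  st-drop (suc a) e (suc i) h | lo (s≤s l) = ⊥-elim (<⇒≢ h (trans (st-mid a 0 (suc i) l) (sym (st-mid a 0 i (<⇒≤ l)))))

  pst-sum : ∀ a e → psum (pst a e) 0 (height a) ≡ psum (pst a 0) 0 (height a) + e
  pst-sum zero e = +-comm e 0
  pst-sum (suc a) e = begin
    psum (pst (suc a) e) 0 (N + height a) ≡⟨ psum-+ (pst (suc a) e) 0 N (height a) ⟩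
    psum (pst (suc a) e) 0 N + psum (pst (suc a) e) N (height a) ≡⟨ cong₂ _+_
      (psum-cong 0 0 N λ x h → trans (rep-lo N T _ x h) (sym (rep-lo N T _ x h))) (trans (tail e) (pst-sum a e)) ⟩
    psum (pst (suc a) 0) 0 N + (psum (pst a 0) 0 (height a) + e) ≡⟨ sym (+-assoc (psum (pst (suc a) 0) 0 N) _ e) ⟩
    psum (pst (suc a) 0) 0 N + psum (pst a 0) 0 (height a) + e ≡⟨ cong (λ z → psum (pst (suc a) 0) 0 N + z + e) (sym (tail 0)) ⟩
    psum (pst (suc a) 0) 0 N + psum (pst (suc a) 0) N (height a) + e ≡⟨ cong (λ z → z + e) (sym (psum-+ (pst (suc a) 0) 0 N (height a))) ⟩
    psum (pst (suc a) 0) 0 (N + height a) + e ∎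
    where
    open ≡-Reasoning
    tail : ∀ e → psum (pst (suc a) e) N (height a) ≡ psum (pst a e) 0 (height a)
    tail e = psum-cong N 0 (height a) λ x _ → rep-hi N T (pst a e) x

glue : ℕ → (f h : ℕ → ℕ) → ℕ → ℕ
glue zero f h = h
glue (suc l) f h = cons (f 0) (glue l (λ i → f (suc i)) h)

glue-lo : ∀ l f h i → i < l → glue l f h i ≡ f i
glue-lo (suc l) f h zero _ = refl
glue-lo (suc l) f h (suc i) (s≤s lt) = glue-lo l _ h i lt

glue-hi : ∀ l f h x → glue l f h (l + x) ≡ h x
glue-hi zero f h x = refl
glue-hi (suc l) f h x = glue-hi l _ h x

glue-at : ∀ l f h → glue l f h l ≡ h 0
glue-at l f h = trans (cong (glue l f h) (sym (+-identityʳ l))) (glue-hi l f h 0)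

-- Cores that form a horizontal strip over a multiple rectangle

module Stacks (k T q : ℕ) (q+T : q + T ≡ k) (1≤T : 1 ≤ T) (a : ℕ) where
  open Cores k
  open Weaks k
  open Stairs k T q q+T 1≤T public

  IsC-cong : ∀ {f f′ p} → (∀ i → f i ≡ f′ i) → IsC f p → IsC f′ p
  IsC-cong e C = record
    { anti = λ i → subst₂ _≤_ (e (suc i)) (e i) (anti C i)
    ; p≤k = p≤k C ; law = λ i → trans (cong (λ z → z + _) (sym (e _))) (trans (law C i) (e i)) }

  IsC-drop : ∀ {f p} m → IsC f p → IsC (λ i → f (m + i)) (λ i → p (m + i))
  IsC-drop {f} {p} m C = record
    { anti = λ i → subst (λ z → f z ≤ f (m + i)) (sym (+-suc m i)) (anti C (m + i)) ; p≤k = λ i → p≤k C (m + i)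
    ; law = λ i → trans (cong (λ z → f z + p (m + i)) (lin (m ∷ i ∷ k ∸ p (m + i) ∷ []) (λ m i x → ⊢ m ⊕ (con 1 ⊕ x ⊕ i) ≐ con 1 ⊕ x ⊕ (m ⊕ i)))) (law C (m + i)) }

  -- the width of the core of R_T^(a+1)
  w : ℕ
  w = suc a * T

  S₀ : ℕ → ℕ
  S₀ = st (suc a) 0

  S₀-≤ : ∀ x → S₀ x ≤ w
  S₀-≤ x = ≤-trans (anti-≤ {S₀} (st-anti z≤n (suc a)) {0} {x} z≤n) (≤-reflexive (+-identityʳ w))

  -- The lowest row exceeds the width `w` by `s`; the first rows of the other blocks exceed theirs
  -- by `e`, and the top row is `e`.
  sh : ℕ → ℕ → ℕ → ℕ
  sh s e = cons (w + s) (rep q w (st a e))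

  shP : ℕ → ℕ → ℕ → ℕ
  shP x e = cons x (rep q T (pst a e))

  sh-mid : ∀ s e x → suc x ≤ q → sh s e (suc x) ≡ w
  sh-mid s e x h = st-mid a e x h

  -- Up to `T` the core condition repeats the excess `s` in all blocks. Beyond `T` it leaves `e`
  -- free; only e = T gives the core of the rectangles with the part `s`, and that choice is forced
  -- later by the length.
  data Fit (s e : ℕ) : Set where
    small : s ≤ T → e ≡ s → Fit s e
    big : T < s → s ≤ k → e ≤ T → Fit s e

  fit-e : ∀ {s e} → Fit s e → e ≤ T
  fit-e (small h refl) = h
  fit-e (big _ _ h) = h

  fit-≤ : ∀ {s e} → Fit s e → e ≤ s
  fit-≤ (small _ refl) = ≤-refl
  fit-≤ (big h _ h′) = ≤-trans h′ (<⇒≤ h)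

  fitP : ∀ {s e} → Fit s e → ℕ
  fitP (small _ _) = T
  fitP {s} (big _ _ _) = s

  fit : ∀ s → s ≤ k → Fit s (s ⊓ T)
  fit s s≤k with ≤-<-connex s T
  ... | inj₁ h = small h (m≤n⇒m⊓n≡m h)
  ... | inj₂ h = big h s≤k (m⊓n≤n s T)

  sh-IsC : ∀ {s e} (F : Fit s e) → IsC (sh s e) (shP (fitP F) e)
  sh-IsC {s} (small h refl) = st-IsC h (suc a)
  sh-IsC {s} {e} (big T<s s≤k e≤T) = record { anti = anti′ ; p≤k = p≤k′ ; law = law′ }
    where
    C = st-IsC e≤T (suc a)
    anti′ : Anti (sh s e)
    anti′ zero = ≤-trans (anti C 0) (+-monoʳ-≤ w (≤-trans e≤T (<⇒≤ T<s)))
    anti′ (suc i) = anti C (suc i)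
    p≤k′ : ∀ i → shP s e i ≤ k
    p≤k′ zero = s≤k
    p≤k′ (suc i) = p≤k C (suc i)
    law′ : ∀ i → sh s e (suc (k ∸ shP s e i) + i) + shP s e i ≡ sh s e i
    law′ zero = cong (λ z → z + s) (sh-mid s e (k ∸ s + 0)
      (lin (k ∸ s ∷ s ∷ k ∷ q ∷ T ∷ []) (λ x s k q t → x ⊕ s ≐ k ⇒ q ⊕ t ≐ k ⇒ t ≺ s ⇒ ⊢ con 1 ⊕ (x ⊕ con 0) ≼ q) (m∸n+n≡m s≤k) q+T T<s))
    law′ (suc i) = law C (suc i)

  sh-below : ∀ {s e} x → S₀ x ≤ sh s e x
  sh-below {s} {e} zero = +-monoʳ-≤ w z≤n
  sh-below {s} {e} (suc x) = st-mono {0} {e} z≤n (suc a) (suc x)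

  sh-above : ∀ {s e} → e ≤ T → ∀ x → sh s e (suc x) ≤ S₀ x
  sh-above h x = st-above h (suc a) x

  sh-corner : ∀ {s e} → e ≤ s → ∀ x → S₀ x < sh s e x → sh s e x ≤ S₀ x + s × ∃ λ b → w + x ≡ S₀ x + b * n
  sh-corner {s} h zero lt = ≤-reflexive (cong (λ z → z + s) (sym (+-identityʳ w))) , 0 , sym (+-identityʳ _)
  sh-corner {s} {e} h (suc x) lt with st-corner (suc a) e (suc x) lt
  ... | c , d = ≤-trans (≤-reflexive c) (+-monoʳ-≤ (S₀ (suc x)) h) , d

  shP-sum : ∀ x e → psum (shP x e) 0 (height (suc a)) + T ≡ psum (pst (suc a) 0) 0 (height (suc a)) + x + e
  shP-sum x e = lin (T ∷ x ∷ e ∷ psum (shP x e) 1 (q + height a) ∷ psum (pst (suc a) e) 1 (q + height a) ∷ psum (pst (suc a) 0) 1 (q + height a) ∷ [])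
      (λ t x e A B C → A ≐ B ⇒ t ⊕ B ≐ t ⊕ C ⊕ e ⇒ ⊢ x ⊕ A ⊕ t ≐ t ⊕ C ⊕ x ⊕ e)
      (psum-cong 1 1 (q + height a) (λ _ _ → refl)) (pst-sum (suc a) e)

  -- For s > T the length gained is s + e - T, so equality holds only for e = T.
  fit-sum : ∀ {s e} (F : Fit s e) → psum (shP (fitP F) e) 0 (height (suc a)) ≤ psum (pst (suc a) 0) 0 (height (suc a)) + s
  fit-sum {s} {e} (small _ refl) = ≤-reflexive (pst-sum (suc a) s)
  fit-sum {s} {e} (big _ _ e≤T) = lin (T ∷ s ∷ e ∷ psum (shP s e) 0 (height (suc a)) ∷ psum (pst (suc a) 0) 0 (height (suc a)) ∷ [])
      (λ t s e A B → A ⊕ t ≐ B ⊕ s ⊕ e ⇒ e ≼ t ⇒ ⊢ A ≼ B ⊕ s) (shP-sum s e) e≤T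

  mutual
    -- Rows 1 to `q` are squeezed between equal rows of the rectangle core. The rows from `N` on
    -- form a strip over the core with one rectangle less, and the excess of their first row is `e`.
    strip-tail : ∀ a {γ p} → IsC γ p → Strip γ (st (suc a) 0) →
      ∃ λ e → e ≤ T × (∀ i → γ (suc i) ≡ st (suc a) e (suc i))
    strip-tail a {γ} {p} C S = e , e≤T , rows
      where
      open Strip S
      e = γ N ∸ a * T
      top : ∀ i → i ≤ q → st (suc a) 0 i ≡ suc a * T
      top zero h = +-identityʳ _
      top (suc i) h = st-mid a 0 i h
      γN-≤ : γ N ≤ suc a * T
      γN-≤ = ≤-trans (above q) (≤-reflexive (top q ≤-refl))
      γN-≥ : a * T ≤ γ N
      γN-≥ = ≤-trans (≤-reflexive (sym (trans (cong (st (suc a) 0) (sym (+-identityʳ N))) (trans (st-hi a 0 0) (trans (st-head a 0) (+-identityʳ _)))))) (below N)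
      e≤T : e ≤ T
      e≤T = lin (e ∷ a * T ∷ γ N ∷ T ∷ []) (λ e at g t → e ⊕ at ≐ g ⇒ g ≼ t ⊕ at ⇒ ⊢ e ≼ t) (m∸n+n≡m γN-≥) γN-≤
      tailC : IsC (λ i → γ (N + i)) (λ i → p (N + i))
      tailC = IsC-drop N C
      tailS : Strip (λ i → γ (N + i)) (st a 0)
      tailS = record { below = λ i → ≤-trans (≤-reflexive (sym (st-hi a 0 i))) (below (N + i))
                     ; above = λ i → ≤-trans (≤-reflexive (cong γ (+-suc N i))) (≤-trans (above (N + i)) (≤-reflexive (st-hi a 0 i))) }
      tail : ∀ x → γ (N + x) ≡ st a e x
      tail = strip-rows a tailC tailS (trans (cong γ (+-identityʳ N)) (trans (sym (m∸n+n≡m γN-≥)) (+-comm e (a * T)))) e≤T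
      rows : ∀ i → γ (suc i) ≡ st (suc a) e (suc i)
      rows i with split N (suc i)
      ... | hi x eq = trans (cong γ eq) (trans (tail x) (trans (sym (st-hi a e x)) (cong (st (suc a) e) (sym eq))))
      ... | lo (s≤s h) = trans (≤-antisym (≤-trans (above i) (≤-reflexive (top i (<⇒≤ h)))) (≤-trans (≤-reflexive (sym (top (suc i) h))) (below (suc i))))
                           (sym (st-mid a e i h))

    strip-rows : ∀ a {γ p e} → IsC γ p → Strip γ (st a 0) → γ 0 ≡ a * T + e → e ≤ T → ∀ i → γ i ≡ st a e i
    strip-rows zero C S h e≤T zero = h
    strip-rows zero C S h e≤T (suc zero) = n≤0⇒n≡0 (Strip.above S 0)
    strip-rows zero C S h e≤T (suc (suc i)) = n≤0⇒n≡0 (Strip.above S (suc i))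
    strip-rows (suc a) {γ} {p} {e} C S h e≤T with strip-tail a C S
    ... | e′ , e′≤T , rows = λ { zero → h ; (suc i) → trans (rows i) (cong (λ z → st (suc a) z (suc i)) e′≡e) }
      where
      r = k ∸ p 0 + 0
      e′≡e : e′ ≡ e
      -- `law` for row 0 meets row `suc r`. If it is inside the lowest block, then `p 0` > `T`,
      -- although the row exceeds the block by only `e` ≤ `T`. If it is beyond row `N`, then `p 0` <
      -- `T`, although that row is shorter by at least `T`. So it is row `N`, `p 0` = `T`, and the
      -- two excesses agree.
      e′≡e with split N (suc r)
      ... | lo (s≤s r<q) = ⊥-elim (lin (k ∸ p 0 ∷ p 0 ∷ k ∷ q ∷ T ∷ e ∷ γ (suc r) ∷ γ 0 ∷ a * T ∷ [])
              (λ x p k q t e γr γ0 at → x ⊕ p ≐ k ⇒ q ⊕ t ≐ k ⇒ x ⊕ con 0 ≺ q ⇒ γr ⊕ p ≐ γ0 ⇒ γr ≐ t ⊕ at ⇒ γ0 ≐ t ⊕ at ⊕ e ⇒ e ≼ t ⇒ ⊢⊥)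
              (q+p C 0) q+T r<q (law C 0) (trans (rows r) (st-mid a e′ r r<q)) h e≤T)
      ... | hi zero eq = lin (k ∸ p 0 ∷ p 0 ∷ k ∷ q ∷ T ∷ e ∷ γ (suc r) ∷ γ 0 ∷ a * T ∷ e′ ∷ [])
              (λ x p k q t e γr γ0 at e′ → x ⊕ p ≐ k ⇒ q ⊕ t ≐ k ⇒ con 1 ⊕ (x ⊕ con 0) ≐ con 1 ⊕ (q ⊕ con 0) ⇒ γr ⊕ p ≐ γ0 ⇒ γr ≐ at ⊕ e′ ⇒ γ0 ≐ t ⊕ at ⊕ e ⇒ ⊢ e′ ≐ e)
              (q+p C 0) q+T eq (law C 0) (trans (rows r) (trans (cong (st (suc a) e′) eq) (trans (st-hi a e′ 0) (st-head a e′)))) h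
      ... | hi (suc x) eq = ⊥-elim (lin (k ∸ p 0 ∷ p 0 ∷ k ∷ q ∷ T ∷ e ∷ γ (suc r) ∷ γ 0 ∷ a * T ∷ x ∷ [])
              (λ y p k q t e γr γ0 at x → y ⊕ p ≐ k ⇒ q ⊕ t ≐ k ⇒ con 1 ⊕ (y ⊕ con 0) ≐ con 1 ⊕ (q ⊕ (con 1 ⊕ x)) ⇒ γr ⊕ p ≐ γ0 ⇒ γr ≼ at ⇒ γ0 ≐ t ⊕ at ⊕ e ⇒ ⊢⊥)
              (q+p C 0) q+T eq (law C 0) low h)
        where
        low : γ (suc r) ≤ a * T
        low = ≤-trans (≤-reflexive (trans (rows r) (trans (cong (st (suc a) e′) eq) (st-hi a e′ (suc x)))))
          (≤-trans (st-above e′≤T a x) (≤-trans (anti-≤ (st-anti z≤n a) z≤n) (≤-reflexive (trans (st-head a 0) (+-identityʳ _)))))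

  strip-sh : ∀ {γ p} → IsC γ p → Strip γ S₀ → γ 0 ≤ w + k → ∃ λ e → Fit (γ 0 ∸ w) e × (∀ i → γ i ≡ sh (γ 0 ∸ w) e i)
  strip-sh {γ} C S le with strip-tail a C S | ≤-<-connex (γ 0 ∸ w) T
  ... | e , e≤T , rows | inj₁ h = γ 0 ∸ w , small h refl , strip-rows (suc a) C S w+s h
    where w+s : γ 0 ≡ w + (γ 0 ∸ w)
          w+s = sym (m+[n∸m]≡n (≤-trans (≤-reflexive (sym (+-identityʳ w))) (Strip.below S 0)))
  ... | e , e≤T , rows | inj₂ h = e , big h (m≤n+o⇒m∸n≤o (γ 0) w le) e≤T ,
      λ { zero → sym (m+[n∸m]≡n (≤-trans (≤-reflexive (sym (+-identityʳ w))) (Strip.below S 0))) ; (suc i) → rows i }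

-- Stacking a core on a multiple rectangle

module Towers (k T q : ℕ) (q+T : q + T ≡ k) (1≤T : 1 ≤ T) (a : ℕ) where
  open Cores k
  open Weaks k
  open Stacks k T q q+T 1≤T a public

  M : ℕ
  M = height (suc a)

  stack : ℕ → (f h : ℕ → ℕ) → ℕ → ℕ
  stack l f h = glue l (λ i → f i + w) h

  rotate : ℕ → ℕ
  rotate r = (r + w) % n

  rotate-inj : ∀ {x y} → x < n → y < n → rotate x ≡ rotate y → x ≡ y
  rotate-inj {x} {y} x<n y<n e with ≤-total x y
  ... | inj₁ h = go x<n y<n e h
    where
    go : ∀ {x y} → x < n → y < n → rotate x ≡ rotate y → x ≤ y → x ≡ y
    go {x} {y} x<n y<n e h with %-≡⇒∃ k e (+-monoˡ-≤ w h)
    ... | zero , eq = lin (x ∷ y ∷ w ∷ []) (λ x y w → y ⊕ w ≐ x ⊕ w ⊕ con 0 ⇒ ⊢ x ≐ y) eq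
    ... | suc m , eq = ⊥-elim (lin (x ∷ y ∷ w ∷ k ∷ m * n ∷ []) (λ x y w k m → y ⊕ w ≐ x ⊕ w ⊕ (con 1 ⊕ k ⊕ m) ⇒ y ≺ con 1 ⊕ k ⇒ ⊢⊥) eq y<n)
  ... | inj₂ h with %-≡⇒∃ k (sym e) (+-monoˡ-≤ w h)
  ...   | zero , eq = lin (x ∷ y ∷ w ∷ []) (λ x y w → x ⊕ w ≐ y ⊕ w ⊕ con 0 ⇒ ⊢ x ≐ y) eq
  ...   | suc m , eq = ⊥-elim (lin (x ∷ y ∷ w ∷ k ∷ m * n ∷ []) (λ x y w k m → x ⊕ w ≐ y ⊕ w ⊕ (con 1 ⊕ k ⊕ m) ⇒ x ≺ con 1 ⊕ k ⇒ ⊢⊥) eq x<n)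

  res-rotate : ∀ i j → rotate (res i j) ≡ res i (j + w)
  res-rotate i j = begin
    (res i j + w) % n                    ≡⟨ cong (λ z → (z + w) % n) (trans (res-def i j) (residue-% k (suc i) j)) ⟩
    ((j + suc i * k) % n + w) % n        ≡⟨ %-distribˡ-+ ((j + suc i * k) % n) w n ⟩
    ((j + suc i * k) % n % n + w % n) % n ≡⟨ cong (λ z → (z + w % n) % n) (m%n%n≡m%n (j + suc i * k) n) ⟩
    ((j + suc i * k) % n + w % n) % n    ≡⟨ sym (%-distribˡ-+ (j + suc i * k) w n) ⟩
    (j + suc i * k + w) % n              ≡⟨ cong (_% n) (lin (j ∷ suc i * k ∷ w ∷ []) (λ j x w → ⊢ j ⊕ x ⊕ w ≐ j ⊕ w ⊕ x)) ⟩
    (j + w + suc i * k) % n              ≡⟨ sym (trans (res-def i (j + w)) (residue-% k (suc i) (j + w))) ⟩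
    res i (j + w) ∎
    where open ≡-Reasoning

  res<n : ∀ i j → res i j < n
  res<n i j = subst (λ z → z < n) (sym (res-def i j)) (residue< k (suc i , j))

  -- A relation and not an equation for `f′`, because for a given strip over the tower the value of
  -- `e` is known only after its length has been counted.
  record Stacked (l : ℕ) (f f′ : ℕ → ℕ) (e : ℕ) : Set where
    field
      fits : Fit (f l) e
      bottom : ∀ i → i < l → f′ i ≡ f i + w
      top : ∀ x → f′ (l + x) ≡ sh (f l) e x
      beyond : ∀ i → l < i → f i ≡ 0

    top₀ : f′ l ≡ w + f l
    top₀ = trans (cong f′ (sym (+-identityʳ l))) (top 0)

  stacked : ∀ l f e → Fit (f l) e → (∀ i → l < i → f i ≡ 0) → Stacked l f (stack l f (sh (f l) e)) e
  stacked l f e F b = record { fits = F ; bottom = glue-lo l _ _ ; top = glue-hi l _ _ ; beyond = b }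

  base : ∀ l g → g l ≡ 0 → (∀ i → l < i → g i ≡ 0) → Stacked l g (stack l g S₀) 0
  base l g gl b = record { fits = small (≤-trans (≤-reflexive gl) z≤n) (sym gl) ; bottom = glue-lo l _ _
    ; top = λ x → trans (glue-hi l _ _ x) (cong (λ z → sh z 0 x) (sym gl)) ; beyond = b }

  stackedP : ∀ {l f f′ e} → (ℕ → ℕ) → Stacked l f f′ e → ℕ → ℕ
  stackedP {l} {e = e} p K = glue l p (shP (fitP (Stacked.fits K)) e)

  module _ {l f f′ e p} (K : Stacked l f f′ e) (C : IsC f p) (big-rows : ∀ i → i < l → T < f i) where
    open Stacked K

    -- For a row i < l the row met by `law` is below row `l`, or row `l`, or above it. In the last
    -- case it is empty in `f`, so `p i` = `f i` > `T`; hence it is one of the rows 1 to `q` of the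
    -- stacked part, whose length is `w`, and both sides have moved by `w`.
    stacked-IsC : IsC f′ (stackedP p K)
    stacked-IsC = record { anti = anti′ ; p≤k = p≤k′ ; law = law′ }
      where
      H = sh-IsC fits
      pK = stackedP p K
      anti′ : Anti f′
      anti′ i with split l i
      ... | hi x refl = subst₂ _≤_ (sym (trans (cong f′ (sym (+-suc l x))) (top (suc x)))) (sym (top x)) (anti H x)
      ... | lo i<l with m≤n⇒m<n∨m≡n i<l
      ...   | inj₁ h = subst₂ _≤_ (sym (bottom (suc i) h)) (sym (bottom i i<l)) (+-monoˡ-≤ w (anti C i))
      ...   | inj₂ refl = subst₂ _≤_ (sym top₀) (sym (bottom i i<l)) (≤-trans (+-monoʳ-≤ w (anti C i)) (≤-reflexive (+-comm w (f i))))
      p≤k′ : ∀ i → pK i ≤ k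
      p≤k′ i with split l i
      ... | hi x refl = ≤-trans (≤-reflexive (glue-hi l _ _ x)) (p≤k H x)
      ... | lo i<l = ≤-trans (≤-reflexive (glue-lo l _ _ i i<l)) (p≤k C i)
      law′ : ∀ i → f′ (suc (k ∸ pK i) + i) + pK i ≡ f′ i
      law′ i with split l i
      ... | hi x refl rewrite glue-hi l p (shP (fitP fits) e) x =
            trans (cong (λ z → z + shP (fitP fits) e x) (trans (cong f′ (lin (l ∷ x ∷ k ∸ shP (fitP fits) e x ∷ []) (λ l x y → ⊢ con 1 ⊕ y ⊕ (l ⊕ x) ≐ l ⊕ (con 1 ⊕ y ⊕ x)))) (top _)))
              (trans (law H x) (sym (top x)))
      ... | lo i<l rewrite glue-lo l p (shP (fitP fits) e) i i<l = trans (low (split l r)) (sym (bottom i i<l))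
        where
        r = suc (k ∸ p i) + i
        low : Split l r → f′ r + p i ≡ f i + w
        low (lo h) = lin (f′ r ∷ f r ∷ w ∷ p i ∷ f i ∷ []) (λ a b w p c → a ≐ b ⊕ w ⇒ b ⊕ p ≐ c ⇒ ⊢ a ⊕ p ≐ c ⊕ w) (bottom r h) (law C i)
        low (hi zero eq) = lin (f′ r ∷ f r ∷ w ∷ p i ∷ f i ∷ f l ∷ []) (λ a b w p c s → a ≐ w ⊕ s ⇒ b ≐ s ⇒ b ⊕ p ≐ c ⇒ ⊢ a ⊕ p ≐ c ⊕ w)
          (trans (cong f′ (trans eq (+-identityʳ l))) top₀) (cong f (trans eq (+-identityʳ l))) (law C i)
        low (hi (suc x) eq) = lin (f′ r ∷ w ∷ p i ∷ f i ∷ []) (λ a w p c → a ≐ w ⇒ p ≐ c ⇒ ⊢ a ⊕ p ≐ c ⊕ w)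
          (trans (cong f′ eq) (trans (top (suc x)) (sh-mid (f l) e x x<q))) pi≡
          where
          pi≡ : p i ≡ f i
          pi≡ = trans (cong (λ z → z + p i) (sym (trans (cong f eq) (beyond _ (m<m+n l (s≤s z≤n)))))) (law C i)
          x<q : suc x ≤ q
          x<q = lin (k ∸ p i ∷ p i ∷ k ∷ q ∷ T ∷ f i ∷ i ∷ l ∷ x ∷ [])
            (λ y p k q t c i l x → y ⊕ p ≐ k ⇒ q ⊕ t ≐ k ⇒ p ≐ c ⇒ t ≺ c ⇒ i ≺ l ⇒ con 1 ⊕ y ⊕ i ≐ l ⊕ (con 1 ⊕ x) ⇒ ⊢ con 1 ⊕ x ≼ q)
            (q+p C i) q+T pi≡ (big-rows i i<l) i<l eq

  module _ {l g g′} (B : Stacked l g g′ 0) (gl : g l ≡ 0) where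
    private module B = Stacked B

    base-top : ∀ x → g′ (l + x) ≡ S₀ x
    base-top x = trans (B.top x) (cong (λ z → sh z 0 x) gl)

    module _ {f f′ e} (K : Stacked l f f′ e) where
      private module K = Stacked K

      stacked-strip : Strip f g → Strip f′ g′
      stacked-strip S = record { below = below′ ; above = above′ }
        where
        open Strip S hiding (above′)
        below′ : ∀ i → g′ i ≤ f′ i
        below′ i with split l i
        ... | lo h = subst₂ _≤_ (sym (B.bottom i h)) (sym (K.bottom i h)) (+-monoˡ-≤ w (below i))
        ... | hi x refl = subst₂ _≤_ (sym (base-top x)) (sym (K.top x)) (sh-below x)
        above′ : ∀ i → f′ (suc i) ≤ g′ i
        above′ i with split l i
        ... | hi x refl = subst₂ _≤_ (sym (trans (cong f′ (sym (+-suc l x))) (K.top (suc x)))) (sym (base-top x)) (sh-above {f l} (fit-e K.fits) x)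
        ... | lo i<l with m≤n⇒m<n∨m≡n i<l
        ...   | inj₁ h = subst₂ _≤_ (sym (K.bottom (suc i) h)) (sym (B.bottom i i<l)) (+-monoˡ-≤ w (above i))
        ...   | inj₂ refl = subst₂ _≤_ (sym K.top₀) (sym (B.bottom i i<l)) (≤-trans (+-monoʳ-≤ w (above i)) (≤-reflexive (+-comm w (g i))))

      module _ (below : ∀ i → g i ≤ f i) (below′ : ∀ i → g′ i ≤ f′ i) where

        stacked-res : nDistinct (stripRes f g 0 (suc l)) ≡ nDistinct (stripRes f′ g′ 0 (l + M))
        stacked-res = nDistinct-map rotate inj sub sur
          where
          D D′ : List ℕ
          D = stripRes f g 0 (suc l)
          D′ = stripRes f′ g′ 0 (l + M)
          inj : ∀ {x y} → x ∈ D → y ∈ D → rotate x ≡ rotate y → x ≡ y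
          inj x∈ y∈ with stripRes⁻ f g 0 (suc l) below x∈ | stripRes⁻ f g 0 (suc l) below y∈
          ... | r , j , _ , _ , _ , _ , refl | r′ , j′ , _ , _ , _ , _ , refl = rotate-inj (res<n r j) (res<n r′ j′)
          sub : ∀ {x} → x ∈ D → rotate x ∈ D′
          sub x∈ with stripRes⁻ f g 0 (suc l) below x∈
          ... | r , j , _ , r≤l , u , v , refl = subst (_∈ D′) (sym (res-rotate r j))
                (stripRes⁺ f′ g′ 0 (l + M) r (j + w) z≤n (≤-trans r≤l (≤-trans (≤-reflexive (+-comm 1 l)) (+-monoʳ-≤ l (s≤s z≤n)))) (lower r≤l) (upper r≤l))
            where
            lower : r < suc l → g′ r < j + w
            lower (s≤s h) with m≤n⇒m<n∨m≡n h
            ... | inj₁ r<l = subst (λ z → z < j + w) (sym (B.bottom r r<l)) (+-monoˡ-< w u)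
            ... | inj₂ refl = subst (λ z → z < j + w) (sym B.top₀) (≤-trans (s≤s (≤-reflexive (+-comm w (g l)))) (+-monoˡ-< w u))
            upper : r < suc l → j + w ≤ f′ r
            upper (s≤s h) with m≤n⇒m<n∨m≡n h
            ... | inj₁ r<l = subst (λ z → j + w ≤ z) (sym (K.bottom r r<l)) (+-monoˡ-≤ w v)
            ... | inj₂ refl = subst (λ z → j + w ≤ z) (sym K.top₀) (≤-trans (+-monoˡ-≤ w v) (≤-reflexive (+-comm (f l) w)))
          sur : ∀ {y} → y ∈ D′ → ∃ λ x → x ∈ D × rotate x ≡ y
          sur y∈ with stripRes⁻ f′ g′ 0 (l + M) below′ y∈
          ... | r , j , _ , r< , u , v , refl with split l r
          ...   | lo r<l = res r (j ∸ w) , stripRes⁺ f g 0 (suc l) r (j ∸ w) z≤n (m≤n⇒m≤1+n r<l) lower upper ,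
                  trans (res-rotate r (j ∸ w)) (cong (res r) (m∸n+n≡m w≤j))
            where
            gj : g r + w < j
            gj = ≤-trans (s≤s (≤-reflexive (sym (B.bottom r r<l)))) u
            w≤j : w ≤ j
            w≤j = ≤-trans (m≤n+m w (g r)) (<⇒≤ gj)
            lower : g r < j ∸ w
            lower = lin (g r ∷ w ∷ j ∷ j ∸ w ∷ []) (λ g w j x → g ⊕ w ≺ j ⇒ x ⊕ w ≐ j ⇒ ⊢ g ≺ x) gj (m∸n+n≡m w≤j)
            upper : j ∸ w ≤ f r
            upper = lin (f r ∷ w ∷ j ∷ j ∸ w ∷ f′ r ∷ []) (λ g w j x z → j ≼ z ⇒ z ≐ g ⊕ w ⇒ x ⊕ w ≐ j ⇒ ⊢ x ≼ g) v (K.bottom r r<l) (m∸n+n≡m w≤j)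
          -- The cell lies `z` columns past the end of its row in `S₀`. The row ends where cells are
          -- added are congruent, so cell `z` of row `l` has this residue after rotation.
          ...   | hi x refl with sh-corner (fit-≤ K.fits) x (≤-trans (s≤s (≤-reflexive (sym (base-top x)))) (≤-trans u (≤-trans v (≤-reflexive (K.top x)))))
          ...     | c , b , d = res l z , stripRes⁺ f g 0 (suc l) l z z≤n ≤-refl lower upper ,
                  trans (res-rotate l z) (sym (⇒res (l + x) j l (z + w) b
                    (lin (z ∷ w ∷ l ∷ x ∷ j ∷ S₀ x ∷ b * n ∷ []) (λ z w l x j s b → z ⊕ s ≐ j ⇒ w ⊕ x ≐ s ⊕ b ⇒ ⊢ z ⊕ w ⊕ (l ⊕ x) ≐ j ⊕ l ⊕ b) zj d)))
            where
            z = j ∸ S₀ x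
            sj : S₀ x < j
            sj = ≤-trans (s≤s (≤-reflexive (sym (base-top x)))) u
            zj : z + S₀ x ≡ j
            zj = m∸n+n≡m (<⇒≤ sj)
            lower : g l < z
            lower = ≤-trans (s≤s (≤-reflexive gl)) (m<n⇒0<n∸m sj)
            upper : z ≤ f l
            upper = m≤n+o⇒m∸n≤o j (S₀ x) (≤-trans v (≤-trans (≤-reflexive (K.top x)) c))

  psum-glue : ∀ l p h → psum (glue l p h) 0 (l + M) ≡ psum p 0 l + psum h 0 M
  psum-glue l p h = trans (psum-+ (glue l p h) 0 l M)
    (cong₂ _+_ (psum-cong 0 0 l λ x x<l → glue-lo l p h x x<l) (psum-cong l 0 M λ x _ → glue-hi l p h x))

  S₀P : ℕ → ℕ
  S₀P = pst (suc a) 0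

  baseP : ∀ l → (ℕ → ℕ) → ℕ → ℕ
  baseP l p = glue l p S₀P

  base-IsC : ∀ {l g g′ p} (B : Stacked l g g′ 0) → g l ≡ 0 → IsC g p → (∀ i → i < l → T < g i) → IsC g′ (baseP l p)
  base-IsC {l} {g} {g′} {p} B gl C h = record { anti = anti C′ ; p≤k = λ i → subst (λ z → z ≤ k) (same i) (p≤k C′ i)
      ; law = λ i → subst (λ z → g′ (suc (k ∸ z) + i) + z ≡ g′ i) (same i) (law C′ i) }
    where
    C′ = stacked-IsC B C h
    same : ∀ i → stackedP p B i ≡ baseP l p i
    same i with Stacked.fits B
    ... | small _ _ = refl
    ... | big T<s _ _ = ⊥-elim (<⇒≱ T<s (≤-trans (≤-reflexive gl) z≤n))

  module _ {l f p′ g p} (W : Weak l f p′ g p) (gl : g l ≡ 0) (big-rows : ∀ i → i < l → T < g i) where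
    open Weak W

    private
      g-beyond : ∀ i → l < i → g i ≡ 0
      g-beyond i h = n≤0⇒n≡0 (≤-trans (mono coreG (<⇒≤ h)) (≤-reflexive gl))
      f-beyond : ∀ i → l < i → f i ≡ 0
      f-beyond i h = n≤0⇒n≡0 (≤-trans (above′ (anti coreG) h) (≤-reflexive gl))

    top-p′ : p′ l ≡ f l
    top-p′ = trans (cong (λ z → z + p′ l) (sym (f-beyond _ (s≤s (m≤n+m l (k ∸ p′ l)))))) (law coreF l)

    sizes : psum p′ 0 l + f l ≡ psum p 0 l + nDistinct (stripRes f g 0 (suc l))
    sizes = lin (psum p′ 0 l ∷ f l ∷ psum p 0 l ∷ nDistinct (stripRes f g 0 (suc l)) ∷ psum p′ 0 (suc l) ∷ psum p 0 (suc l) ∷ p′ l ∷ p l ∷ [])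
      (λ P s Q N P′ Q′ a b → P′ ≐ Q′ ⊕ N ⇒ P′ ≐ P ⊕ a ⇒ Q′ ≐ Q ⊕ b ⇒ a ≐ s ⇒ b ≼ con 0 ⇒ ⊢ P ⊕ s ≐ Q ⊕ N)
      size (psum-snoc p′ 0 l) (psum-snoc p 0 l) top-p′ (≤-trans (p≤f coreG l) (≤-reflexive gl))

    up : ℕ → ℕ
    up = stack l f (sh (f l) (f l ⊓ T))

    up-stacked : Stacked l f up (f l ⊓ T)
    up-stacked = stacked l f (f l ⊓ T) (fit (f l) (top≤k gl)) f-beyond

    fit-sum-≡ : ∀ s (s≤k : s ≤ k) → psum (shP (fitP (fit s s≤k)) (s ⊓ T)) 0 M ≡ psum S₀P 0 M + s
    fit-sum-≡ s s≤k with ≤-<-connex s T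
    ... | inj₁ h rewrite m≤n⇒m⊓n≡m h = pst-sum (suc a) s
    ... | inj₂ h rewrite m≥n⇒m⊓n≡n (<⇒≤ h) = +-cancelʳ-≡ T _ _ (shP-sum s T)

    up-Weak : Weak (l + (q + height a)) up (stackedP p′ up-stacked) (stack l g S₀) (baseP l p)
    up-Weak = record
      { coreF = stacked-IsC up-stacked coreF (λ i h → ≤-trans (big-rows i h) (below i))
      ; coreG = base-IsC B gl coreG big-rows
      ; strip = S′
      ; size = subst (λ z → psum (stackedP p′ up-stacked) 0 z ≡ psum (baseP l p) 0 z + nDistinct (stripRes up (stack l g S₀) 0 z)) (+-suc l (q + height a)) eq }
      where
      B = base l g gl g-beyond
      S′ = stacked-strip B gl up-stacked strip
      eq : psum (stackedP p′ up-stacked) 0 (l + M) ≡ psum (baseP l p) 0 (l + M) + nDistinct (stripRes up (stack l g S₀) 0 (l + M))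
      eq rewrite psum-glue l p′ (shP (fitP (fit (f l) (top≤k gl))) (f l ⊓ T)) | psum-glue l p S₀P | fit-sum-≡ (f l) (top≤k gl)
         | sym (stacked-res B gl up-stacked below (Strip.below S′)) =
           lin (psum p′ 0 l ∷ psum S₀P 0 M ∷ f l ∷ psum p 0 l ∷ nDistinct (stripRes f g 0 (suc l)) ∷ [])
             (λ P B s Q N → P ⊕ s ≐ Q ⊕ N ⇒ ⊢ P ⊕ (B ⊕ s) ≐ Q ⊕ B ⊕ N) sizes

-- Unstacking a weak strip, and the unblocked corners of a stacked one

module Downs (k T q : ℕ) (q+T : q + T ≡ k) (1≤T : 1 ≤ T) (a : ℕ) where
  open Cores k
  open Weaks k
  open Towers k T q q+T 1≤T a public

  module _ {l f′ pF g p} (W : Weak (l + (q + height a)) f′ pF (stack l g S₀) (baseP l p)) (C : IsC g p)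
    (gl : g l ≡ 0) (big-rows : ∀ i → i < l → T < g i) where
    private
      module W = Weak W
      g-beyond : ∀ i → l < i → g i ≡ 0
      g-beyond i h = n≤0⇒n≡0 (≤-trans (mono C (<⇒≤ h)) (≤-reflexive gl))
      g′ = stack l g S₀
      B = base l g gl g-beyond
      module B = Stacked B
      spike : ℕ → ℕ
      spike = cons (f′ l ∸ w) (λ _ → 0)

    down downP : ℕ → ℕ
    down = glue l (λ i → f′ i ∸ w) spike
    downP = glue l pF spike

    private
      down-lo : ∀ i → i < l → down i ≡ f′ i ∸ w
      down-lo = glue-lo l _ _
      down-l : down l ≡ f′ l ∸ w
      down-l = glue-at l _ _
      down-beyond : ∀ i → l < i → down i ≡ 0
      down-beyond i h with split l i
      ... | lo h′ = ⊥-elim (<⇒≱ h (<⇒≤ h′))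
      ... | hi zero refl = ⊥-elim (<⇒≢ h (sym (+-identityʳ l)))
      ... | hi (suc x) refl = glue-hi l _ _ (suc x)

      f′≥ : ∀ i → i < l → g i + w ≤ f′ i
      f′≥ i h = ≤-trans (≤-reflexive (sym (B.bottom i h))) (W.below i)

      w≤f′ : ∀ i → i ≤ l → w ≤ f′ i
      w≤f′ i h with m≤n⇒m<n∨m≡n h
      ... | inj₁ h′ = ≤-trans (m≤n+m w (g i)) (f′≥ i h′)
      ... | inj₂ refl = ≤-trans (m≤m+n w (g l)) (≤-trans (≤-reflexive (sym B.top₀)) (W.below l))

      γ : ℕ → ℕ
      γ x = f′ (l + x)
      Cγ : IsC γ (λ x → pF (l + x))
      Cγ = IsC-drop l W.coreF
      Sγ : Strip γ S₀
      Sγ = record { below = λ x → ≤-trans (≤-reflexive (sym (glue-hi l _ _ x))) (W.below (l + x))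
                  ; above = λ x → ≤-trans (≤-reflexive (cong f′ (+-suc l x))) (≤-trans (W.above (l + x)) (≤-reflexive (glue-hi l _ _ x))) }
      shape : ∃ λ e → Fit (γ 0 ∸ w) e × (∀ i → γ i ≡ sh (γ 0 ∸ w) e i)
      shape = strip-sh Cγ Sγ (≤-trans (≤-trans (m≤n+m∸n (γ 0) (S₀ 0)) (+-monoʳ-≤ (S₀ 0)
        (subst (λ z → f′ (l + 0) ∸ z ≤ k) (glue-hi l _ _ 0) (W.row-≤k (l + 0))))) (≤-reflexive (cong (λ z → z + k) (+-identityʳ w))))
      e : ℕ
      e = proj₁ shape
      s≡ : γ 0 ∸ w ≡ down l
      s≡ = trans (cong (λ z → f′ z ∸ w) (+-identityʳ l)) (sym down-l)

      K : Stacked l down f′ e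
      K = record
        { fits = subst (λ z → Fit z e) s≡ (proj₁ (proj₂ shape))
        ; bottom = λ i h → trans (sym (m∸n+n≡m (w≤f′ i (<⇒≤ h)))) (cong (λ z → z + w) (sym (down-lo i h)))
        ; top = λ x → trans (proj₂ (proj₂ shape) x) (cong (λ z → sh z e x) s≡)
        ; beyond = down-beyond }
      module K = Stacked K

    down-strip : Strip down g
    down-strip = record { below = below′ ; above = above′ }
      where
      below′ : ∀ i → g i ≤ down i
      below′ i with <-cmp i l
      ... | tri< h _ _ = ≤-trans (m+n≤o⇒m≤o∸n (g i) (f′≥ i h)) (≤-reflexive (sym (down-lo i h)))
      ... | tri≈ _ refl _ = ≤-trans (≤-reflexive gl) z≤n
      ... | tri> _ _ h = ≤-trans (≤-reflexive (g-beyond i h)) z≤n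
      above′ : ∀ i → down (suc i) ≤ g i
      above′ i with <-≤-connex i l
      ... | inj₂ h = ≤-trans (≤-reflexive (down-beyond (suc i) (s≤s h))) z≤n
      ... | inj₁ h = ≤-trans (≤-reflexive eq) (m≤n+o⇒m∸n≤o (f′ (suc i)) w
              (≤-trans (W.above i) (≤-trans (≤-reflexive (B.bottom i h)) (≤-reflexive (+-comm (g i) w)))))
        where
        eq : down (suc i) ≡ f′ (suc i) ∸ w
        eq with m≤n⇒m<n∨m≡n h
        ... | inj₁ h′ = down-lo (suc i) h′
        ... | inj₂ refl = down-l

    down-IsC : IsC down downP
    down-IsC = record { anti = λ i → ≤-trans (Strip.above down-strip i) (Strip.below down-strip i) ; p≤k = p≤k′ ; law = law′ }
      where
      s≤k : f′ l ∸ w ≤ k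
      s≤k = ≤-trans (≤-reflexive (sym down-l)) (top-≤ K.fits)
        where top-≤ : ∀ {s e} → Fit s e → s ≤ k
              top-≤ (small h _) = ≤-trans h T≤k
              top-≤ (big _ h _) = h
      p≤k′ : ∀ i → downP i ≤ k
      p≤k′ i with split l i
      ... | lo h = ≤-trans (≤-reflexive (glue-lo l _ _ i h)) (p≤k W.coreF i)
      ... | hi zero refl = ≤-trans (≤-reflexive (glue-hi l _ _ 0)) s≤k
      ... | hi (suc x) refl = ≤-trans (≤-reflexive (glue-hi l _ _ (suc x))) z≤n
      law′ : ∀ i → down (suc (k ∸ downP i) + i) + downP i ≡ down i
      law′ i with split l i
      ... | hi x refl rewrite glue-hi l pF spike x | glue-hi l (λ i → f′ i ∸ w) spike x =
            cong (λ z → z + spike x) (down-beyond (suc (k ∸ spike x) + (l + x)) (s≤s (≤-trans (m≤m+n l x) (m≤n+m (l + x) (k ∸ spike x)))))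
      ... | lo h rewrite glue-lo l pF spike i h = trans (low (split l r)) (sym (down-lo i h))
        where
        r = suc (k ∸ pF i) + i
        low : Split l r → down r + pF i ≡ f′ i ∸ w
        low (lo h′) = lin (down r ∷ pF i ∷ f′ i ∷ f′ i ∸ w ∷ w ∷ f′ r ∷ [])
          (λ d p f x w fr → fr ≐ d ⊕ w ⇒ fr ⊕ p ≐ f ⇒ x ⊕ w ≐ f ⇒ ⊢ d ⊕ p ≐ x) (K.bottom r h′) (law W.coreF i) (m∸n+n≡m (w≤f′ i (<⇒≤ h)))
        low (hi zero eq) = lin (down r ∷ pF i ∷ f′ i ∷ f′ i ∸ w ∷ w ∷ f′ r ∷ down l ∷ [])
          (λ d p f x w fr s → d ≐ s ⇒ fr ≐ w ⊕ s ⇒ fr ⊕ p ≐ f ⇒ x ⊕ w ≐ f ⇒ ⊢ d ⊕ p ≐ x)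
          (cong down (trans eq (+-identityʳ l))) (trans (cong f′ (trans eq (+-identityʳ l))) K.top₀) (law W.coreF i) (m∸n+n≡m (w≤f′ i (<⇒≤ h)))
        low (hi (suc x) eq) = lin (down r ∷ pF i ∷ f′ i ∷ f′ i ∸ w ∷ w ∷ f′ r ∷ [])
          (λ d p f x w fr → d ≐ con 0 ⇒ fr ≐ w ⇒ fr ⊕ p ≐ f ⇒ x ⊕ w ≐ f ⇒ ⊢ d ⊕ p ≐ x)
          (down-beyond r (≤-trans (m<m+n l (s≤s z≤n)) (≤-reflexive (sym eq)))) fr≡ (law W.coreF i) (m∸n+n≡m (w≤f′ i (<⇒≤ h)))
          where
          fr≤ : f′ r ≤ w
          fr≤ = ≤-trans (≤-reflexive (cong f′ eq)) (≤-trans (Strip.above Sγ x) (S₀-≤ x))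
          -- Row `r` of `f′` is at most `w` and row `i` is at least `g i` + `w`, so `pF i` ≥ `g i` >
          -- `T`. This keeps row `r` among those of constant length `w`.
          x<q : suc x ≤ q
          x<q = lin (k ∸ pF i ∷ pF i ∷ k ∷ q ∷ T ∷ f′ i ∷ i ∷ l ∷ x ∷ w ∷ f′ r ∷ g i ∷ [])
            (λ y p k q t c i l x w fr g → y ⊕ p ≐ k ⇒ q ⊕ t ≐ k ⇒ fr ⊕ p ≐ c ⇒ fr ≼ w ⇒ g ⊕ w ≼ c ⇒ t ≺ g ⇒ i ≺ l ⇒ con 1 ⊕ y ⊕ i ≐ l ⊕ (con 1 ⊕ x) ⇒ ⊢ con 1 ⊕ x ≼ q)
            (q+p W.coreF i) q+T (law W.coreF i) fr≤ (f′≥ i h) (big-rows i h) h eq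
          fr≡ : f′ r ≡ w
          fr≡ = trans (cong f′ eq) (trans (K.top (suc x)) (sh-mid (down l) e x x<q))

    private
      Γ B₀ : ℕ
      Γ = psum (λ x → pF (l + x)) 0 M
      B₀ = psum S₀P 0 M
      Γ≡ : Γ ≡ psum (shP (fitP K.fits) e) 0 M
      Γ≡ = psum-cong 0 0 M λ x _ → p-unique (sh-IsC K.fits) x (pF (l + x)) (p≤k Cγ x)
        (p-law x)
        where
        p-law : ∀ x → sh (down l) e (suc (k ∸ pF (l + x)) + x) + pF (l + x) ≡ sh (down l) e x
        p-law x = law (IsC-cong K.top Cγ) x

      total : psum pF 0 l + Γ ≡ psum p 0 l + B₀ + nDistinct (stripRes down g 0 (suc l))
      total = trans (sym (trans (psum-+ pF 0 l M) (cong (λ z → psum pF 0 l + z) (psum-cong l 0 M λ _ _ → refl))))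
        (trans (trans (cong (psum pF 0) (+-suc l (q + height a))) (trans W.size (cong (λ z → psum (baseP l p) 0 z + nDistinct (stripRes f′ g′ 0 z)) (sym (+-suc l (q + height a))))))
          (cong₂ _+_ (psum-glue l p S₀P) (sym (stacked-res B gl K (Strip.below down-strip) W.below))))

      downP-sum : psum downP 0 (suc l) ≡ psum pF 0 l + down l
      downP-sum = trans (psum-snoc downP 0 l) (cong₂ _+_ (psum-cong 0 0 l λ x h → glue-lo l _ _ x h) (trans (glue-at l _ _) (sym down-l)))

      p-sum : psum p 0 (suc l) ≡ psum p 0 l
      p-sum = trans (psum-snoc p 0 l) (trans (cong (λ z → psum p 0 l + z) (n≤0⇒n≡0 (≤-trans (p≤f C l) (≤-reflexive gl)))) (+-identityʳ _))

      ND : ℕ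
      ND = nDistinct (stripRes down g 0 (suc l))

      size≤ : psum pF 0 l + down l ≤ psum p 0 l + ND
      size≤ = subst₂ (λ x y → x ≤ y + ND) downP-sum p-sum (Over.size-≤ down-IsC C down-strip 0 (suc l))

    -- `size-≤` bounds the length of the unstacked strip from above. Weakness of the given strip,
    -- whose upper part contributes at most `down l` by `fit-sum`, gives the same bound from below.
    down-Weak : Weak l down downP g p
    down-Weak = record { coreF = down-IsC ; coreG = C ; strip = down-strip
      ; size = trans downP-sum (trans (lin (psum pF 0 l ∷ down l ∷ psum p 0 l ∷ ND ∷ Γ ∷ B₀ ∷ [])
          (λ A s Q N Γ B → A ⊕ s ≼ Q ⊕ N ⇒ A ⊕ Γ ≐ Q ⊕ B ⊕ N ⇒ Γ ≼ B ⊕ s ⇒ ⊢ A ⊕ s ≐ Q ⊕ N)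
          size≤ total (≤-trans (≤-reflexive Γ≡) (fit-sum K.fits))) (cong (λ z → z + ND) (sym p-sum))) }

    private
      -- For s > T the upper part gains s + e - T, but the bound on the lower part requires it to
      -- gain at least s.
      e≡ : e ≡ down l ⊓ T
      e≡ = go K.fits Γ≡
        where
        go : (F : Fit (down l) e) → Γ ≡ psum (shP (fitP F) e) 0 M → e ≡ down l ⊓ T
        go (small h eq) _ = trans eq (sym (m≤n⇒m⊓n≡m h))
        go (big h h′ e≤T) eq = trans (≤-antisym e≤T (lin (psum pF 0 l ∷ down l ∷ psum p 0 l ∷ ND ∷ Γ ∷ B₀ ∷ T ∷ e ∷ psum (shP (down l) e) 0 M ∷ [])
          (λ A s Q N Γ B t e Z → A ⊕ s ≼ Q ⊕ N ⇒ A ⊕ Γ ≐ Q ⊕ B ⊕ N ⇒ Γ ≐ Z ⇒ Z ⊕ t ≐ B ⊕ s ⊕ e ⇒ ⊢ t ≼ e)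
          size≤ total eq (shP-sum (down l) e))) (sym (m≥n⇒m⊓n≡n (<⇒≤ h)))

    up-down : ∀ i → stack l down (sh (down l) (down l ⊓ T)) i ≡ f′ i
    up-down i with split l i
    ... | lo h = trans (glue-lo l _ _ i h) (sym (K.bottom i h))
    ... | hi x refl = trans (glue-hi l _ _ x) (trans (cong (λ z → sh (down l) z x) (sym e≡)) (sym (K.top x)))

  module _ {l f p′ g p} (W : Weak l f p′ g p) (gl : g l ≡ 0) (big-rows : ∀ i → i < l → T < g i)
    {R R′ : List ℕ}
    (R⁻ : ∀ {x} → x ∈ R → UnblockedCorner f g x) (R⁺ : ∀ {x} → UnblockedCorner f g x → x ∈ R)
    (R′⁻ : ∀ {x} → x ∈ R′ → UnblockedCorner (up W gl big-rows) (stack l g S₀) x)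
    (R′⁺ : ∀ {x} → UnblockedCorner (up W gl big-rows) (stack l g S₀) x → x ∈ R′) where
    open Weak W
    private
      g-beyond : ∀ i → l ≤ i → g i ≡ 0
      g-beyond i h = n≤0⇒n≡0 (≤-trans (mono coreG h) (≤-reflexive gl))
      f′ = up W gl big-rows
      g′ = stack l g S₀
      B = base l g gl (λ i h → g-beyond i (<⇒≤ h))
      K = up-stacked W gl big-rows
      module B = Stacked B
      module K = Stacked K
      e = f l ⊓ T

      bottom≤ : ∀ {f f′ e} → Stacked l f f′ e → ∀ i → i ≤ l → f′ i ≡ f i + w
      bottom≤ {f} S i h with m≤n⇒m<n∨m≡n h
      ... | inj₁ h′ = Stacked.bottom S i h′
      ... | inj₂ refl = trans (Stacked.top₀ S) (+-comm w (f i))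

      corner<l : ∀ {i} → g (suc i) < g i → i < l
      corner<l {i} h with <-≤-connex i l
      ... | inj₁ h′ = h′
      ... | inj₂ h′ = ⊥-elim (<⇒≱ h (≤-trans (≤-reflexive (g-beyond i h′)) z≤n))

      -- The residue common to all corners of `S₀`: by `st-drop` each of them is `T` cells beyond
      -- the end of a row that is congruent to column `w` in row `l`, and lies one row lower than
      -- that end.
      new : ℕ
      new = res l (w + suc T)

      -- All rows of `g` below `l` exceed `T`, so column `suc T` is a gap of `g` at height `l`. A
      -- corner of `g` with this residue before rotation would be a bead congruent to that gap.
      new∉ : new ∉ map rotate R
      new∉ h with ∈-map⁻ rotate h
      ... | x , x∈ , eq with R⁻ x∈
      ... | i , c , _ , refl with res-⇒ l (w + suc T) i (g i + w) (trans eq (res-rotate i (g i)))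
              (lin (w ∷ T ∷ i ∷ g i ∷ l ∷ []) (λ w t i g l → t ≺ g ⇒ i ≺ l ⇒ ⊢ w ⊕ (con 1 ⊕ t) ⊕ i ≼ g ⊕ w ⊕ l) (big-rows i (corner<l c)) (corner<l c))
      ...   | m , eq′ = noBead coreG (gap-g gl (s≤s z≤n) big-rows) m i
              (lin (w ∷ T ∷ i ∷ g i ∷ l ∷ m * n ∷ []) (λ w t i g l m → g ⊕ w ⊕ l ≐ w ⊕ (con 1 ⊕ t) ⊕ i ⊕ m ⇒ ⊢ g ⊕ l ≐ con 1 ⊕ t ⊕ i ⊕ m) eq′)

      old : ∀ {x} → x ∈ R → rotate x ∈ R′
      old x∈ with R⁻ x∈
      ... | i , c , u , refl = R′⁺ (i ,
          subst₂ _<_ (sym (bottom≤ B (suc i) i<l)) (sym (B.bottom i i<l)) (+-monoˡ-< w c) ,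
          subst₂ _<_ (sym (bottom≤ K (suc i) i<l)) (sym (B.bottom i i<l)) (+-monoˡ-< w u) ,
          trans (res-rotate i (g i)) (cong (res i) (sym (B.bottom i i<l))))
        where i<l = corner<l c

      -- At a corner of the rectangle part the core drops by `T`, and the next row has `e` added
      -- cells. The corner is therefore unblocked exactly for e < T.
      classify : ∀ {y} → y ∈ R′ → (e < T × y ≡ new) ⊎ y ∈ map rotate R
      classify y∈ with R′⁻ y∈
      ... | i , c , u , refl with split l i
      ...   | lo i<l = inj₂ (subst (_∈ map rotate R) (trans (res-rotate i (g i)) (cong (res i) (sym (B.bottom i i<l))))
                (∈-map⁺ rotate (R⁺ (i , +-cancelʳ-< w _ _ (subst₂ _<_ (bottom≤ B (suc i) i<l) (B.bottom i i<l) c) ,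
                                        +-cancelʳ-< w _ _ (subst₂ _<_ (bottom≤ K (suc i) i<l) (B.bottom i i<l) u) , refl))))
      ...   | hi x refl with st-drop (suc a) e x (subst₂ _<_ (trans (cong g′ (sym (+-suc l x))) (glue-hi l _ _ (suc x))) (glue-hi l _ _ x) c)
      ...     | d , d′ , b , d″ = inj₁
                (+-cancelˡ-< (S₀ (suc x)) _ _ (subst₂ _<_ (trans (cong f′ (sym (+-suc l x))) (trans (glue-hi l _ _ (suc x)) d′)) (trans (glue-hi l _ _ x) d) u) ,
                 trans (cong (res (l + x)) (glue-hi l _ _ x)) (corner-res x b d d″))
        where
        corner-res : ∀ x b → S₀ x ≡ S₀ (suc x) + T → w + suc x ≡ S₀ (suc x) + b * n → res (l + x) (S₀ x) ≡ new
        corner-res x b d d″ = ⇒res (l + x) (S₀ x) l (w + suc T) b (lin (w ∷ T ∷ l ∷ x ∷ S₀ x ∷ S₀ (suc x) ∷ b * n ∷ [])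
          (λ w t l x s s′ b → s ≐ s′ ⊕ t ⇒ w ⊕ (con 1 ⊕ x) ≐ s′ ⊕ b ⇒ ⊢ w ⊕ (con 1 ⊕ t) ⊕ (l ⊕ x) ≐ s ⊕ l ⊕ b) d d″)

      -- The witness is the top row of the lowest block, row l + q, which is there for every number
      -- of rectangles.
      new∈ : e < T → new ∈ R′
      new∈ e<T with st-drop (suc a) e q (subst₂ _<_ (sym (lowrow 0)) (sym highrow) (≤-trans (s≤s (≤-reflexive (+-identityʳ (a * T)))) (m<n+m (a * T) 1≤T)))
        where
        lowrow : ∀ e → st (suc a) e (suc q) ≡ a * T + e
        lowrow e = trans (cong (st (suc a) e) (sym (+-identityʳ N))) (trans (st-hi a e 0) (st-head a e))
        top : ∀ i → i ≤ q → S₀ i ≡ w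
        top zero h = +-identityʳ _
        top (suc i) h = st-mid a 0 i h
        highrow : S₀ q ≡ w
        highrow = top q ≤-refl
      ... | d , d′ , b , d″ = R′⁺ (l + q ,
          subst₂ _<_ (sym (trans (cong g′ (sym (+-suc l q))) (glue-hi l _ _ (suc q)))) (sym (glue-hi l _ _ q)) (subst (S₀ (suc q) <_) (sym d) (m<m+n _ 1≤T)) ,
          subst₂ _<_ (sym (trans (cong f′ (sym (+-suc l q))) (trans (glue-hi l _ _ (suc q)) d′))) (sym (trans (glue-hi l _ _ q) d)) (+-monoʳ-< _ e<T) ,
          trans (sym (⇒res (l + q) (S₀ q) l (w + suc T) b (lin (w ∷ T ∷ l ∷ q ∷ S₀ q ∷ S₀ (suc q) ∷ b * n ∷ [])
            (λ w t l x s s′ b → s ≐ s′ ⊕ t ⇒ w ⊕ (con 1 ⊕ x) ≐ s′ ⊕ b ⇒ ⊢ w ⊕ (con 1 ⊕ t) ⊕ (l ⊕ x) ≐ s ⊕ l ⊕ b) d d″)))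
            (cong (res (l + q)) (sym (glue-hi l _ _ q))))

      rotated : nDistinct (map rotate R) ≡ nDistinct R
      rotated = sym (nDistinct-map rotate inj (∈-map⁺ rotate) λ p → let (x , q , eq) = ∈-map⁻ rotate p in x , q , sym eq)
        where
        inj : ∀ {x y} → x ∈ R → y ∈ R → rotate x ≡ rotate y → x ≡ y
        inj x∈ y∈ with R⁻ x∈ | R⁻ y∈
        ... | r , _ , _ , refl | r′ , _ , _ , refl = rotate-inj (res<n r (g r)) (res<n r′ (g r′))

      old′ : ∀ {y} → y ∈ map rotate R → y ∈ R′
      old′ p with ∈-map⁻ rotate p
      ... | x , q , refl = old q

    free-small : f l < T → nDistinct R′ ≡ suc (nDistinct R)
    free-small h = trans (nDistinct-≈ ⊆ ⊇) (trans (nDistinct-∉ new∉) (cong suc rotated))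
      where
      ⊆ : ∀ {y} → y ∈ R′ → y ∈ new ∷ map rotate R
      ⊆ p with classify p
      ... | inj₁ (_ , refl) = here refl
      ... | inj₂ r = there r
      ⊇ : ∀ {y} → y ∈ new ∷ map rotate R → y ∈ R′
      ⊇ (here refl) = new∈ (≤-trans (s≤s (m⊓n≤m (f l) T)) h)
      ⊇ (there r) = old′ r

    free-large : T ≤ f l → nDistinct R′ ≡ nDistinct R
    free-large h = trans (nDistinct-≈ ⊆ old′) rotated
      where
      ⊆ : ∀ {y} → y ∈ R′ → y ∈ map rotate R
      ⊆ p with classify p
      ... | inj₁ (e<T , _) = ⊥-elim (<⇒≱ e<T (≤-reflexive (sym (m≥n⇒m⊓n≡n h))))
      ... | inj₂ r = r

-- Diagrams as lists

∧⁻ : ∀ {a b} → T (a ∧ b) → T a × T b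
∧⁻ = Equivalence.to T-∧

∧⁺ : ∀ {a b} → T a → T b → T (a ∧ b)
∧⁺ p q = Equivalence.from T-∧ (p , q)

and⁻ : ∀ {A : Set} (f : A → Bool) xs → T (and (map f xs)) → ∀ {x} → x ∈ xs → T (f x)
and⁻ f (x ∷ xs) h (here refl) = proj₁ (∧⁻ h)
and⁻ f (x ∷ xs) h (there p) = and⁻ f xs (proj₂ (∧⁻ {f x} h)) p

and⁺ : ∀ {A : Set} (f : A → Bool) xs → (∀ {x} → x ∈ xs → T (f x)) → T (and (map f xs))
and⁺ f [] h = tt
and⁺ f (x ∷ xs) h = ∧⁺ (h (here refl)) (and⁺ f xs (h ∘ there))

not⁺ : ∀ {b} → ¬ T b → T (not b)
not⁺ {true} h = h tt
not⁺ {false} h = tt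

not⁻ : ∀ {b} → T (not b) → ¬ T b
not⁻ {true} h _ = h

range-def : ∀ m → range m ≡ applyUpTo suc m
range-def m = map-applyUpTo (λ x → x) suc m

∈-range⁺ : ∀ {j m} → 1 ≤ j → j ≤ m → j ∈ range m
∈-range⁺ {suc j} {m} _ h = subst (suc j ∈_) (sym (range-def m)) (∈-applyUpTo⁺ suc h)

∈-range⁻ : ∀ {j m} → j ∈ range m → 1 ≤ j × j ≤ m
∈-range⁻ {j} {m} p with ∈-applyUpTo⁻ suc (subst (j ∈_) (range-def m) p)
... | i , h , refl = s≤s z≤n , h

row : List ℕ → ℕ → ℕ
row κ i = part κ (suc i)

row-beyond : ∀ κ i → length κ ≤ i → row κ i ≡ 0
row-beyond [] i h = refl
row-beyond (x ∷ κ) (suc i) (s≤s h) = row-beyond κ i h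

row-inside : ∀ κ i → 1 ≤ row κ i → i < length κ
row-inside κ i h with <-≤-connex i (length κ)
... | inj₁ h′ = h′
... | inj₂ h′ = ⊥-elim (<⇒≱ h (≤-reflexive (row-beyond κ i h′)))

record Partition (κ : List ℕ) : Set where
  field
    anti : Anti (row κ)
    pos : ∀ i → i < length κ → 1 ≤ row κ i

partition-∷ : ∀ {x y κ} → y ≤ x → Partition (y ∷ κ) → Partition (x ∷ y ∷ κ)
partition-∷ y≤x P = record
  { anti = λ { zero → y≤x ; (suc i) → Partition.anti P i }
  ; pos = λ { zero _ → ≤-trans (Partition.pos P 0 (s≤s z≤n)) y≤x ; (suc i) (s≤s l) → Partition.pos P i l } }

isPartition⁻ : ∀ κ → T (isPartitionᵇ κ) → Partition κ
isPartition⁻ [] h = record { anti = λ _ → z≤n ; pos = λ _ () }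
isPartition⁻ (x ∷ []) h = record { anti = λ _ → z≤n ; pos = λ { zero _ → ≤ᵇ⇒≤ 1 x h ; (suc i) (s≤s ()) } }
isPartition⁻ (x ∷ y ∷ κ) h = partition-∷ (≤ᵇ⇒≤ y x (proj₁ (∧⁻ {y ≤ᵇ x} h))) (isPartition⁻ (y ∷ κ) (proj₂ (∧⁻ {y ≤ᵇ x} h)))

isPartition⁺ : ∀ κ → Partition κ → T (isPartitionᵇ κ)
isPartition⁺ [] P = tt
isPartition⁺ (x ∷ []) P = ≤⇒≤ᵇ (Partition.pos P 0 (s≤s z≤n))
isPartition⁺ (x ∷ y ∷ κ) P = ∧⁺ (≤⇒≤ᵇ (Partition.anti P 0))
  (isPartition⁺ (y ∷ κ) (record { anti = λ i → Partition.anti P (suc i) ; pos = λ i h → Partition.pos P (suc i) (s≤s h) }))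

row-ext : ∀ {κ κ′} → Partition κ → Partition κ′ → (∀ i → row κ i ≡ row κ′ i) → κ ≡ κ′
row-ext {[]} {[]} P Q h = refl
row-ext {[]} {y ∷ κ′} P Q h = ⊥-elim (<⇒≢ (Partition.pos Q 0 (s≤s z≤n)) (h 0))
row-ext {x ∷ κ} {[]} P Q h = ⊥-elim (<⇒≢ (Partition.pos P 0 (s≤s z≤n)) (sym (h 0)))
row-ext {x ∷ κ} {y ∷ κ′} P Q h = cong₂ _∷_ (h 0) (row-ext (tail P) (tail Q) (h ∘ suc))
  where
  tail : ∀ {x κ} → Partition (x ∷ κ) → Partition κ
  tail P = record { anti = λ i → Partition.anti P (suc i) ; pos = λ i h → Partition.pos P (suc i) (s≤s h) }

strip0 : List ℕ → List ℕ
strip0 = filterᵇ (λ x → 1 ≤ᵇ x)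

compress : (ℕ → ℕ) → ℕ → List ℕ
compress f m = strip0 (applyUpTo f m)

strip0-zeros : ∀ f m → (∀ i → f i ≡ 0) → compress f m ≡ []
strip0-zeros f zero h = refl
strip0-zeros f (suc m) h rewrite h 0 = strip0-zeros (f ∘ suc) m (h ∘ suc)

row-compress : ∀ f m → Anti f → (∀ i → m ≤ i → f i ≡ 0) → ∀ i → row (compress f m) i ≡ f i
row-compress f zero a h i = sym (h i z≤n)
row-compress f (suc m) a h i with f 0 in eq
... | zero rewrite strip0-zeros (f ∘ suc) m (λ j → n≤0⇒n≡0 (≤-trans (anti-≤ {f} a {0} {suc j} z≤n) (≤-reflexive eq))) =
      sym (n≤0⇒n≡0 (≤-trans (anti-≤ {f} a {0} {i} z≤n) (≤-reflexive eq)))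
row-compress f (suc m) a h zero | suc x = sym eq
row-compress f (suc m) a h (suc i) | suc x = row-compress (f ∘ suc) m (a ∘ suc) (λ j le → h (suc j) (s≤s le)) i

strip0-pos : ∀ xs i → i < length (strip0 xs) → 1 ≤ row (strip0 xs) i
strip0-pos (zero ∷ xs) i h = strip0-pos xs i h
strip0-pos (suc x ∷ xs) zero h = s≤s z≤n
strip0-pos (suc x ∷ xs) (suc i) (s≤s h) = strip0-pos xs i h

compress-partition : ∀ f m → Anti f → (∀ i → m ≤ i → f i ≡ 0) → Partition (compress f m)
compress-partition f m a h = record
  { anti = λ i → subst₂ _≤_ (sym (row-compress f m a h (suc i))) (sym (row-compress f m a h i)) (a i)
  ; pos = strip0-pos (applyUpTo f m) }

abstract
  toList : (ℕ → ℕ) → ℕ → List ℕ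
  toList = compress

  toList-def : ∀ f m → toList f m ≡ compress f m
  toList-def f m = refl

  row-toList : ∀ f m → Anti f → (∀ i → m ≤ i → f i ≡ 0) → ∀ i → row (toList f m) i ≡ f i
  row-toList = row-compress

  toList-partition : ∀ f m → Anti f → (∀ i → m ≤ i → f i ≡ 0) → Partition (toList f m)
  toList-partition = compress-partition

length-≤ : ∀ {κ} → Partition κ → ∀ m → row κ m ≡ 0 → length κ ≤ m
length-≤ {κ} P m h with ≤-<-connex (length κ) m
... | inj₁ l = l
... | inj₂ l = ⊥-elim (<⇒≱ (Partition.pos P m l) (≤-reflexive h))

conj-≥ : ∀ κ j r → Anti (row κ) → 1 ≤ j → j ≤ row κ r → r < conj κ j
conj-≥ [] j r a p h = ⊥-elim (<⇒≱ p h)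
conj-≥ (x ∷ κ) j r a p h with j ≤ᵇ x in eq
conj-≥ (x ∷ κ) j zero a p h | true = s≤s z≤n
conj-≥ (x ∷ κ) j (suc r) a p h | true = s≤s (conj-≥ κ j r (a ∘ suc) p h)
... | false = ⊥-elim (subst T eq (≤⇒≤ᵇ (≤-trans h (anti-≤ {row (x ∷ κ)} a {0} {r} z≤n))))

conj-< : ∀ κ j r → Anti (row κ) → r < conj κ j → j ≤ row κ r
conj-< (x ∷ κ) j r a h with j ≤ᵇ x in eq
conj-< (x ∷ κ) j zero a h | true = ≤ᵇ⇒≤ j x (subst T (sym eq) tt)
conj-< (x ∷ κ) j (suc r) a (s≤s h) | true = conj-< κ j r (a ∘ suc) h
... | false = ⊥-elim (subst T eq (≤⇒≤ᵇ (≤-trans (conj-< κ j r (a ∘ suc) h) (anti-≤ {row (x ∷ κ)} a {0} {suc r} z≤n))))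

count : (ℕ → Bool) → ℕ → ℕ
count P m = length (filterᵇ P (range m))

record Threshold (P : ℕ → Bool) (m c : ℕ) : Set where
  field
    c≤m : c ≤ m
    lower : ∀ j → 1 ≤ j → j ≤ c → ¬ T (P j)
    upper : ∀ j → c < j → j ≤ m → T (P j)

count-threshold : ∀ {P m c} → Threshold P m c → count P m ≡ m ∸ c
count-threshold {P} {m} {c} t = trans (cong (length ∘ filterᵇ P) (range-def m))
  (go suc m c (λ i h → lower (suc i) (s≤s z≤n) h) (λ i h h′ → upper (suc i) (s≤s h) h′))
  where
  open Threshold t
  go : ∀ f m c → (∀ i → i < c → ¬ T (P (f i))) → (∀ i → c ≤ i → i < m → T (P (f i))) → length (filterᵇ P (applyUpTo f m)) ≡ m ∸ c
  go f zero c l u = sym (0∸n≡0 c)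
  go f (suc m) c l u with P (f 0) in eq
  go f (suc m) zero l u | true = cong suc (go (f ∘ suc) m 0 (λ _ ()) (λ i _ h → u (suc i) z≤n (s≤s h)))
  go f (suc m) (suc c) l u | true = ⊥-elim (l 0 (s≤s z≤n) (subst T (sym eq) tt))
  go f (suc m) zero l u | false = ⊥-elim (subst T eq (u 0 z≤n (s≤s z≤n)))
  go f (suc m) (suc c) l u | false = go (f ∘ suc) m c (λ i h → l (suc i) (s≤s h)) (λ i h h′ → u (suc i) (s≤s h) (s≤s h′))

threshold : ∀ P m → (∀ j → 1 ≤ j → j < m → T (P j) → T (P (suc j))) → ∃ (Threshold P m)
threshold P zero up = 0 , record { c≤m = z≤n ; lower = λ { _ (s≤s _) () } ; upper = λ { _ (s≤s _) () } }
threshold P (suc m) up with T? (P (suc m))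
... | no h = suc m , record { c≤m = ≤-refl ; lower = λ j 1≤j j≤ p → h (climb (suc m ∸ j) j 1≤j (m+[n∸m]≡n j≤) p)
                            ; upper = λ j c<j j≤ → ⊥-elim (<⇒≱ c<j j≤) }
  where
  climb : ∀ d j → 1 ≤ j → j + d ≡ suc m → T (P j) → T (P (suc m))
  climb zero j 1≤j e p = subst (T ∘ P) (trans (sym (+-identityʳ j)) e) p
  climb (suc d) j 1≤j e p = climb d (suc j) (s≤s z≤n) (trans (sym (+-suc j d)) e)
    (up j 1≤j (≤-trans (m<m+n j (s≤s z≤n)) (≤-reflexive e)) p)
... | yes h with threshold P m (λ j a b → up j a (m≤n⇒m≤1+n b))
...   | c , t = c , record { c≤m = m≤n⇒m≤1+n c≤m ; lower = lower ; upper = upper′ }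
  where
  open Threshold t
  upper′ : ∀ j → c < j → j ≤ suc m → T (P j)
  upper′ j a b with m≤n⇒m<n∨m≡n b
  ... | inj₁ b′ = upper j a (≤-pred b′)
  ... | inj₂ refl = h

∈-cells⁺ : ∀ {κ i j} → 1 ≤ j → j ≤ row κ i → (suc i , j) ∈ cells κ
∈-cells⁺ {κ} {i} {j} 1≤j h = ∈-concat⁺′ (∈-map⁺ (suc i ,_) (∈-range⁺ 1≤j h))
  (∈-map⁺ (λ i → map (i ,_) (range (part κ i))) (∈-range⁺ (s≤s z≤n) (row-inside κ i (≤-trans 1≤j h))))

∈-cells⁻ : ∀ {κ c} → c ∈ cells κ → ∃[ i ] ∃[ j ] (c ≡ (suc i , j) × 1 ≤ j × j ≤ row κ i)
∈-cells⁻ {κ} {c} p with ∈-concat⁻′ (map (λ i → map (i ,_) (range (part κ i))) (range (length κ))) p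
... | xs , c∈ , xs∈ with ∈-map⁻ (λ i → map (i ,_) (range (part κ i))) xs∈
... | suc i , i∈ , refl with ∈-map⁻ (suc i ,_) c∈
... | j , j∈ , refl = i , j , refl , proj₁ (∈-range⁻ j∈) , proj₂ (∈-range⁻ {m = row κ i} j∈)
∈-cells⁻ {κ} {c} p | xs , c∈ , xs∈ | zero , i∈ , refl = ⊥-elim (<⇒≱ (proj₁ (∈-range⁻ i∈)) z≤n)

-- Cores by hook lengths and cores by beads

module Diagrams (k : ℕ) where
  open Cores k
  open Weaks k

  bounded : List ℕ → ℕ → ℕ
  bounded κ i = count (λ j → hook κ (suc i , j) ≤ᵇ k) (row κ i)

  hook-≤⁻ : ∀ κ i j {x} → hook κ (suc i , j) ≤ x → row κ i + conj κ j + 1 ≤ suc i + j + x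
  hook-≤⁻ κ i j {x} h = ≤-trans (m≤n+m∸n (row κ i + conj κ j + 1) (suc i + j)) (+-monoʳ-≤ (suc i + j) h)

  hook-≤⁺ : ∀ κ i j {x} → row κ i + conj κ j + 1 ≤ suc i + j + x → hook κ (suc i , j) ≤ x
  hook-≤⁺ κ i j {x} h = m≤n+o⇒m∸n≤o (row κ i + conj κ j + 1) (suc i + j) h

  hook->⁻ : ∀ κ i j {x} → x < hook κ (suc i , j) → suc i + j + x < row κ i + conj κ j + 1
  hook->⁻ κ i j {x} h with ≤-<-connex (row κ i + conj κ j + 1) (suc i + j + x)
  ... | inj₂ h′ = h′
  ... | inj₁ h′ = ⊥-elim (<⇒≱ h (hook-≤⁺ κ i j h′))

  hook->⁺ : ∀ κ i j {x} → suc i + j + x < row κ i + conj κ j + 1 → x < hook κ (suc i , j)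
  hook->⁺ κ i j {x} h with ≤-<-connex (hook κ (suc i , j)) x
  ... | inj₂ h′ = h′
  ... | inj₁ h′ = ⊥-elim (<⇒≱ h (hook-≤⁻ κ i j h′))

  module _ {κ p} (C : IsC (row κ) p) where

    private
      f = row κ
      c : ℕ → ℕ
      c i = f (suc (k ∸ p i) + i)

    -- The arm is at least `p i` and the leg at least k + 1 - `p i`, so the hook length is at least
    -- k + 2. In `hook-high` arm and leg are at most `p i` - 1 and k - `p i`. The value k + 1 is
    -- skipped.
    hook-low : ∀ i j → 1 ≤ j → j ≤ c i → suc k < hook κ (suc i , j)
    hook-low i j 1≤j h = hook->⁺ κ i j (lin (i ∷ j ∷ k ∷ f i ∷ conj κ j ∷ c i ∷ p i ∷ k ∸ p i ∷ [])
      (λ i j k f cj c p q → c ⊕ p ≐ f ⇒ q ⊕ p ≐ k ⇒ con 1 ⊕ q ⊕ i ≺ cj ⇒ j ≼ c ⇒ ⊢ con 1 ⊕ i ⊕ j ⊕ (con 1 ⊕ k) ≺ f ⊕ cj ⊕ con 1)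
      (law C i) (q+p C i) (conj-≥ κ j _ (anti C) 1≤j h) h)

    hook-high : ∀ i j → c i < j → hook κ (suc i , j) ≤ k
    hook-high i j h = hook-≤⁺ κ i j (lin (i ∷ j ∷ k ∷ f i ∷ conj κ j ∷ c i ∷ p i ∷ k ∸ p i ∷ [])
      (λ i j k f cj c p q → c ⊕ p ≐ f ⇒ q ⊕ p ≐ k ⇒ cj ≼ con 1 ⊕ q ⊕ i ⇒ c ≺ j ⇒ ⊢ f ⊕ cj ⊕ con 1 ≼ con 1 ⊕ i ⊕ j ⊕ k)
      (law C i) (q+p C i) conj≤ h)
      where
      conj≤ : conj κ j ≤ suc (k ∸ p i) + i
      conj≤ with ≤-<-connex (conj κ j) (suc (k ∸ p i) + i)
      ... | inj₁ le = le
      ... | inj₂ lt = ⊥-elim (<⇒≱ h (conj-< κ j _ (anti C) lt))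

    IsC⇒bounded : ∀ i → bounded κ i ≡ p i
    IsC⇒bounded i = trans (count-threshold {c = c i} record
      { c≤m = mono C (m≤n+m i _)
      ; lower = λ j 1≤j h t → <⇒≱ (hook-low i j 1≤j h) (≤-trans (≤ᵇ⇒≤ _ k t) (n≤1+n k))
      ; upper = λ j h _ → ≤⇒≤ᵇ (hook-high i j h) })
      (trans (cong (λ z → z ∸ c i) (sym (law C i))) (m+n∸m≡n (c i) (p i)))

    IsC⇒IsCore : Partition κ → IsCore k κ
    IsC⇒IsCore P = ∧⁺ (isPartition⁺ κ P) (and⁺ _ (cells κ) no-hook)
      where
      no-hook : ∀ {x} → x ∈ cells κ → T (not (hook κ x ≡ᵇ suc k))
      no-hook {x} x∈ with ∈-cells⁻ {κ} x∈
      ... | i , j , refl , 1≤j , j≤ with ≤-<-connex j (c i)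
      ...   | inj₁ h = not⁺ λ t → <⇒≢ (hook-low i j 1≤j h) (sym (≡ᵇ⇒≡ _ (suc k) t))
      ...   | inj₂ h = not⁺ λ t → <⇒≱ (≤-reflexive (sym (≡ᵇ⇒≡ (hook κ (suc i , j)) (suc k) t))) (hook-high i j h)

  core-partition : ∀ {κ} → IsCore k κ → Partition κ
  core-partition {κ} h = isPartition⁻ κ (proj₁ (∧⁻ {isPartitionᵇ κ} h))

  -- Hook lengths decrease along a row, so the cells of hook length > k are the first `c`. The cell
  -- c + 1 has hook length ≤ k, hence row `r` does not reach it. The cell `c` has hook length > k
  -- and ≠ k + 1, hence ≥ k + 2, and row `r` reaches it.
  IsCore⇒IsC : ∀ {κ} → IsCore k κ → IsC (row κ) (bounded κ)
  IsCore⇒IsC {κ} core = record { anti = anti-κ ; p≤k = λ i → proj₁ (row-law i) ; law = λ i → proj₂ (row-law i) }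
    where
    f = row κ
    anti-κ = Partition.anti (core-partition {κ} core)
    no-hook : ∀ {i j} → 1 ≤ j → j ≤ f i → hook κ (suc i , j) ≢ suc k
    no-hook {i} {j} 1≤j j≤ e = not⁻ (and⁻ _ (cells κ) (proj₂ (∧⁻ {isPartitionᵇ κ} core)) (∈-cells⁺ {κ} 1≤j j≤))
      (≡⇒≡ᵇ (hook κ (suc i , j)) (suc k) e)
    conj-mono : ∀ j → 1 ≤ j → conj κ (suc j) ≤ conj κ j
    conj-mono j 1≤j with ≤-<-connex (conj κ (suc j)) (conj κ j)
    ... | inj₁ h = h
    ... | inj₂ h = ⊥-elim (<-irrefl refl (conj-≥ κ j (conj κ j) anti-κ 1≤j (<⇒≤ (conj-< κ (suc j) _ anti-κ h))))
    row-law : ∀ i → bounded κ i ≤ k × f (suc (k ∸ bounded κ i) + i) + bounded κ i ≡ f i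
    row-law i with threshold (λ j → hook κ (suc i , j) ≤ᵇ k) (f i) up
      where
      up : ∀ j → 1 ≤ j → j < f i → T (hook κ (suc i , j) ≤ᵇ k) → T (hook κ (suc i , suc j) ≤ᵇ k)
      up j 1≤j _ t = ≤⇒≤ᵇ (hook-≤⁺ κ i (suc j) (lin (f i ∷ conj κ j ∷ conj κ (suc j) ∷ i ∷ j ∷ k ∷ [])
        (λ f c c′ i j k → f ⊕ c ⊕ con 1 ≼ con 1 ⊕ i ⊕ j ⊕ k ⇒ c′ ≼ c ⇒ ⊢ f ⊕ c′ ⊕ con 1 ≼ con 1 ⊕ i ⊕ (con 1 ⊕ j) ⊕ k)
        (hook-≤⁻ κ i j (≤ᵇ⇒≤ _ k t)) (conj-mono j 1≤j)))
    ... | c , t rewrite count-threshold t = p≤k′ , trans (cong (λ z → z + p) row≡c) (m+[n∸m]≡n (Threshold.c≤m t))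
      where
      open Threshold t
      p = f i ∸ c
      c+p : c + p ≡ f i
      c+p = m+[n∸m]≡n c≤m
      p≤k′ : p ≤ k
      p≤k′ with m≤n⇒m<n∨m≡n c≤m
      ... | inj₂ refl = ≤-trans (≤-reflexive (n∸n≡0 (f i))) z≤n
      ... | inj₁ h = lin (f i ∷ conj κ (suc c) ∷ i ∷ c ∷ p ∷ k ∷ [])
            (λ f cj i c p k → f ⊕ cj ⊕ con 1 ≼ con 1 ⊕ i ⊕ (con 1 ⊕ c) ⊕ k ⇒ i ≺ cj ⇒ c ⊕ p ≐ f ⇒ ⊢ p ≼ k)
            (hook-≤⁻ κ i (suc c) (≤ᵇ⇒≤ _ k (upper (suc c) ≤-refl h))) (conj-≥ κ (suc c) i anti-κ (s≤s z≤n) h) c+p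
      r = suc (k ∸ p) + i
      row≤ : f r ≤ c
      row≤ with m≤n⇒m<n∨m≡n c≤m
      ... | inj₂ refl = anti-≤ {row κ} anti-κ (m≤n+m i _)
      ... | inj₁ h with ≤-<-connex (f r) c
      ...   | inj₁ le = le
      ...   | inj₂ lt = ⊥-elim (lin (f i ∷ conj κ (suc c) ∷ i ∷ c ∷ p ∷ k ∷ k ∸ p ∷ [])
            (λ f cj i c p k q → f ⊕ cj ⊕ con 1 ≼ con 1 ⊕ i ⊕ (con 1 ⊕ c) ⊕ k ⇒ con 1 ⊕ q ⊕ i ≺ cj ⇒ c ⊕ p ≐ f ⇒ q ⊕ p ≐ k ⇒ ⊢⊥)
            (hook-≤⁻ κ i (suc c) (≤ᵇ⇒≤ _ k (upper (suc c) ≤-refl h))) (conj-≥ κ (suc c) r anti-κ (s≤s z≤n) lt) c+p (m∸n+n≡m p≤k′))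
      row≥ : c ≤ f r
      row≥ with m≤n⇒m<n∨m≡n (z≤n {c})
      ... | inj₂ refl = z≤n
      ... | inj₁ 1≤c = conj-< κ c r anti-κ (lin (f i ∷ conj κ c ∷ i ∷ c ∷ p ∷ k ∷ k ∸ p ∷ [])
            (λ f cj i c p k q → con 1 ⊕ i ⊕ c ⊕ (con 1 ⊕ k) ≺ f ⊕ cj ⊕ con 1 ⇒ c ⊕ p ≐ f ⇒ q ⊕ p ≐ k ⇒ ⊢ con 1 ⊕ q ⊕ i ≺ cj)
            (hook->⁻ κ i c big) c+p (m∸n+n≡m p≤k′))
        where
        big : suc k < hook κ (suc i , c)
        big = ≤∧≢⇒< (≰⇒> λ h → lower c 1≤c ≤-refl (≤⇒≤ᵇ h)) (λ e → no-hook 1≤c c≤m (sym e))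
      row≡c : f r ≡ c
      row≡c = ≤-antisym row≤ row≥

Unique-map : ∀ {A B : Set} (f : A → B) {xs} → (∀ {x y} → x ∈ xs → y ∈ xs → f x ≡ f y → x ≡ y) → Unique xs → Unique (map f xs)
Unique-map f {[]} inj [] = []
Unique-map f {x ∷ xs} inj (x∉ ∷ u) = All.tabulate new ∷ Unique-map f (λ p q → inj (there p) (there q)) u
  where
  new : ∀ {y} → y ∈ map f xs → f x ≢ y
  new p e with ∈-map⁻ f p
  ... | z , q , refl = All.lookup x∉ q (inj (here refl) (there q) e)

compress-extend : ∀ f m d → (∀ i → m ≤ i → f i ≡ 0) → compress f (m + d) ≡ compress f m
compress-extend f zero d h = strip0-zeros f d (λ i → h i z≤n)
compress-extend f (suc m) d h with f 0
... | zero = compress-extend (f ∘ suc) m d (λ i le → h (suc i) (s≤s le))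
... | suc x = cong (suc x ∷_) (compress-extend (f ∘ suc) m d (λ i le → h (suc i) (s≤s le)))

compress-cong : ∀ {f f′} m → (∀ i → f i ≡ f′ i) → compress f m ≡ compress f′ m
compress-cong {f} {f′} zero h = refl
compress-cong {f} {f′} (suc m) h rewrite h 0 with f′ 0
... | zero = compress-cong m (h ∘ suc)
... | suc x = cong (suc x ∷_) (compress-cong m (h ∘ suc))

toList-extend : ∀ f m d → (∀ i → m ≤ i → f i ≡ 0) → toList f (m + d) ≡ toList f m
toList-extend f m d h = trans (toList-def f (m + d)) (trans (compress-extend f m d h) (sym (toList-def f m)))

toList-cong : ∀ {f f′} m → (∀ i → f i ≡ f′ i) → toList f m ≡ toList f′ m
toList-cong {f} {f′} m h = trans (toList-def f m) (trans (compress-cong m h) (sym (toList-def f′ m)))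

length-filter-map : ∀ {A B : Set} (Q : B → Bool) (f : A → B) xs → length (filterᵇ Q (map f xs)) ≡ length (filterᵇ (Q ∘ f) xs)
length-filter-map Q f [] = refl
length-filter-map Q f (x ∷ xs) with Q (f x)
... | true = cong suc (length-filter-map Q f xs)
... | false = length-filter-map Q f xs

hstrip⁻ : ∀ κ τ → T (hstripᵇ κ τ) → Strip (row κ) (row τ)
hstrip⁻ κ τ h = record { below = below ; above = above }
  where
  below : ∀ i → row τ i ≤ row κ i
  below i with <-≤-connex i (length τ)
  ... | inj₁ l = ≤ᵇ⇒≤ (row τ i) (row κ i) (and⁻ _ (range (length τ)) (proj₁ (∧⁻ {containedᵇ τ κ} h)) (∈-range⁺ (s≤s z≤n) l))
  ... | inj₂ l = ≤-trans (≤-reflexive (row-beyond τ i l)) z≤n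
  above : ∀ i → row κ (suc i) ≤ row τ i
  above i with <-≤-connex i (length κ)
  ... | inj₁ l = ≤ᵇ⇒≤ (row κ (suc i)) (row τ i) (and⁻ _ (range (length κ)) (proj₂ (∧⁻ {containedᵇ τ κ} h)) (∈-range⁺ (s≤s z≤n) l))
  ... | inj₂ l = ≤-trans (≤-reflexive (row-beyond κ (suc i) (m≤n⇒m≤1+n l))) z≤n

hstrip⁺ : ∀ κ τ → Strip (row κ) (row τ) → T (hstripᵇ κ τ)
hstrip⁺ κ τ S = ∧⁺ (and⁺ (λ i → part τ i ≤ᵇ part κ i) (range (length τ)) b) (and⁺ (λ i → part κ (suc i) ≤ᵇ part τ i) (range (length κ)) a)
  where
  b : ∀ {i} → i ∈ range (length τ) → T (part τ i ≤ᵇ part κ i)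
  b {suc i} _ = ≤⇒≤ᵇ (Strip.below S i)
  b {zero} p = ⊥-elim (<⇒≱ (proj₁ (∈-range⁻ p)) z≤n)
  a : ∀ {i} → i ∈ range (length κ) → T (part κ (suc i) ≤ᵇ part τ i)
  a {suc i} _ = ≤⇒≤ᵇ (Strip.above S i)
  a {zero} p = ⊥-elim (<⇒≱ (proj₁ (∈-range⁻ p)) z≤n)

row-++0 : ∀ τ i → row (τ ++ [ 0 ]) i ≡ row τ i
row-++0 [] zero = refl
row-++0 [] (suc i) = refl
row-++0 (x ∷ τ) zero = refl
row-++0 (x ∷ τ) (suc i) = row-++0 τ i

∈-between⁺ : ∀ {x y u} → x ≤ y → y ≤ u → y ∈ between x u
∈-between⁺ {x} {y} {u} x≤y y≤u = subst (_∈ between x u) (m+[n∸m]≡n x≤y) (∈-map⁺ (λ d → x + d) (∈-upTo⁺ (s≤s (∸-monoˡ-≤ x y≤u))))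

ext⁺ : ∀ u xs f → (∀ i → row xs i ≤ f i) → f 0 ≤ u → (∀ i → f (suc i) ≤ row xs i) → applyUpTo f (length xs) ∈ ext u xs
ext⁺ u [] f a b c = here refl
ext⁺ u (x ∷ xs) f a b c = ∈-concat⁺′ (∈-map⁺ (f 0 ∷_) (ext⁺ x xs (f ∘ suc) (a ∘ suc) (c 0) (c ∘ suc)))
  (∈-map⁺ (λ y → map (y ∷_) (ext x xs)) (∈-between⁺ (a 0) b))

ext⁻ : ∀ u xs {e} → Anti (row xs) → row xs 0 ≤ u → e ∈ ext u xs →
  length e ≡ length xs × (∀ i → row xs i ≤ row e i) × (∀ i → row e (suc i) ≤ row xs i) × row e 0 ≤ u
ext⁻ u [] a h (here refl) = refl , (λ _ → z≤n) , (λ _ → z≤n) , z≤n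
ext⁻ u (x ∷ xs) {e} a h p with ∈-concat⁻′ (map (λ y → map (y ∷_) (ext x xs)) (between x u)) p
... | ys , e∈ , ys∈ with ∈-map⁻ (λ y → map (y ∷_) (ext x xs)) ys∈
... | y , y∈ , refl with ∈-map⁻ (y ∷_) e∈ | ∈-map⁻ (λ d → x + d) y∈
... | e′ , e′∈ , refl | d , d∈ , refl with ext⁻ x xs (a ∘ suc) (a 0) e′∈
... | l , b , c , t = cong suc l , (λ { zero → m≤m+n x d ; (suc i) → b i }) , (λ { zero → t ; (suc i) → c i }) ,
      ≤-trans (+-monoʳ-≤ x (≤-pred (∈-upTo⁻ d∈))) (≤-reflexive (m+[n∸m]≡n h))

ext-unique : ∀ u xs → Unique (ext u xs)
ext-unique u [] = [] ∷ []
ext-unique u (x ∷ xs) = go (between x u) (Uniq.map⁺ (+-cancelˡ-≡ x _ _) (Uniq.upTo⁺ (suc (u ∸ x))))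
  where
  go : ∀ ys → Unique ys → Unique (concatMap (λ y → map (y ∷_) (ext x xs)) ys)
  go [] [] = []
  go (y ∷ ys) (y∉ ∷ uy) = Uniq.++⁺ (Uniq.map⁺ ∷-injectiveʳ (ext-unique x xs)) (go ys uy) disjoint
    where
    disjoint : ∀ {e} → e ∈ map (y ∷_) (ext x xs) × e ∈ concatMap (λ y → map (y ∷_) (ext x xs)) ys → ⊥
    disjoint (p , q) with ∈-map⁻ (y ∷_) p | ∈-concat⁻′ (map (λ y → map (y ∷_) (ext x xs)) ys) q
    ... | _ , _ , refl | zs , e∈ , zs∈ with ∈-map⁻ (λ y → map (y ∷_) (ext x xs)) zs∈
    ... | y′ , y′∈ , refl with ∈-map⁻ (y′ ∷_) e∈
    ... | _ , _ , refl = All.lookup y∉ y′∈ refl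

list-ext : ∀ {xs ys : List ℕ} → length xs ≡ length ys → (∀ i → row xs i ≡ row ys i) → xs ≡ ys
list-ext {[]} {[]} l h = refl
list-ext {x ∷ xs} {y ∷ ys} l h = cong₂ _∷_ (h 0) (list-ext (suc-injective l) (h ∘ suc))

applyUpTo-row : ∀ xs → applyUpTo (row xs) (length xs) ≡ xs
applyUpTo-row [] = refl
applyUpTo-row (x ∷ xs) = cong (x ∷_) (applyUpTo-row xs)

-- Weak strips as lists of parts

module Interfaces (k : ℕ) where
  open Cores k
  open Weaks k
  open Diagrams k public

  klen-psum : ∀ κ m → length κ ≤ m → klen k κ ≡ psum (bounded κ) 0 m
  klen-psum κ m le = trans (trans (cong (λ z → length (filterᵇ Q (concatMap F z))) (range-def (length κ))) (go suc (length κ)))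
    (trans (sym (trans (psum-+ (bounded κ) 0 (length κ) (m ∸ length κ)) (trans (cong (λ z → psum (bounded κ) 0 (length κ) + z) zeros) (+-identityʳ _))))
      (cong (psum (bounded κ) 0) (m+[n∸m]≡n le)))
    where
    Q : Cell → Bool
    Q c = hook κ c ≤ᵇ k
    F : ℕ → List Cell
    F i = map (i ,_) (range (part κ i))
    cnt : ℕ → ℕ
    cnt i = count (λ j → Q (i , j)) (part κ i)
    go : ∀ g m → length (filterᵇ Q (concatMap F (applyUpTo g m))) ≡ psum (cnt ∘ g) 0 m
    go g zero = refl
    go g (suc m) = trans (cong length (filter-++ (T? ∘ Q) (F (g 0)) _)) (trans (length-++ (filterᵇ Q (F (g 0))))
      (cong₂ _+_ (length-filter-map Q (g 0 ,_) (range (part κ (g 0)))) (trans (go (g ∘ suc) m) (psum-cong 0 1 m λ _ _ → refl))))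
    zeros : psum (bounded κ) (length κ) (m ∸ length κ) ≡ 0
    zeros = trans (psum-cong {q = λ _ → 0} (length κ) 0 (m ∸ length κ) λ x _ → cong (λ z → count (λ j → hook κ (suc (length κ + x) , j) ≤ᵇ k) z)
              (row-beyond κ (length κ + x) (m≤m+n _ x))) (const0 0 (m ∸ length κ))
      where const0 : ∀ i m → psum (λ _ → 0) i m ≡ 0
            const0 i zero = refl
            const0 i (suc m) = const0 (suc i) m

  bounded-beyond : ∀ κ i → length κ ≤ i → bounded κ i ≡ 0
  bounded-beyond κ i h = cong (λ z → count (λ j → hook κ (suc i , j) ≤ᵇ k) z) (row-beyond κ i h)

  pmap-toList : ∀ κ m → length κ ≤ m → pmap k κ ≡ toList (bounded κ) m
  pmap-toList κ m le = trans (cong (λ z → strip0 (map (λ i → count (λ j → hook κ (i , j) ≤ᵇ k) (part κ i)) z)) (range-def (length κ)))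
    (trans (cong strip0 (map-applyUpTo suc _ (length κ)))
      (trans (sym (toList-def (bounded κ) (length κ))) (trans (sym (toList-extend (bounded κ) (length κ) (m ∸ length κ) (bounded-beyond κ))) (cong (toList (bounded κ)) (m+[n∸m]≡n le)))))

  skew-count : ∀ κ τ m → length κ ≤ m → (∀ i → row τ i ≤ row κ i) →
    nDistinct (map (residue k) (skewCells κ τ)) ≡ nDistinct (stripRes (row κ) (row τ) 0 m)
  skew-count κ τ m le below = nDistinct-≈ ⊆ ⊇
    where
    ⊆ : ∀ {x} → x ∈ map (residue k) (skewCells κ τ) → x ∈ stripRes (row κ) (row τ) 0 m
    ⊆ p with ∈-map⁻ (residue k) p
    ... | c , c∈ , refl with ∈-filter⁻ (T? ∘ _) {xs = cells κ} c∈
    ... | c∈′ , t with ∈-cells⁻ {κ} c∈′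
    ... | i , j , refl , 1≤j , j≤ = subst (_∈ _) (res-def i j)
          (stripRes⁺ (row κ) (row τ) 0 m i j z≤n (≤-trans (row-inside κ i (≤-trans 1≤j j≤)) le) (<ᵇ⇒< (row τ i) j t) j≤)
    ⊇ : ∀ {x} → x ∈ stripRes (row κ) (row τ) 0 m → x ∈ map (residue k) (skewCells κ τ)
    ⊇ p with stripRes⁻ (row κ) (row τ) 0 m below p
    ... | i , j , _ , _ , u , v , refl = subst (_∈ _) (sym (res-def i j))
          (∈-map⁺ (residue k) (∈-filter⁺ (T? ∘ _) (∈-cells⁺ {κ} (≤-trans (s≤s z≤n) u) v) (<⇒<ᵇ u)))

  freeList : List ℕ → List ℕ → List ℕ
  freeList κ τ = map (residue k) (filterᵇ (λ { (i , j) → (j ≡ᵇ part τ i) ∧ (part τ (suc i) <ᵇ j) ∧ not (j ≤ᵇ part κ (suc i)) }) (cells τ))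

  freeList⁻ : ∀ κ τ {x} → x ∈ freeList κ τ → UnblockedCorner (row κ) (row τ) x
  freeList⁻ κ τ p with ∈-map⁻ (residue k) p
  ... | c , c∈ , refl with ∈-filter⁻ (T? ∘ _) {xs = cells τ} c∈
  ... | c∈′ , t with ∈-cells⁻ {τ} c∈′
  ... | i , j , refl , 1≤j , j≤ with ∧⁻ {j ≡ᵇ part τ (suc i)} t
  ... | t₁ , t₂₃ with ∧⁻ {part τ (suc (suc i)) <ᵇ j} t₂₃ | ≡ᵇ⇒≡ j (part τ (suc i)) t₁
  ... | t₂ , t₃ | refl = i , <ᵇ⇒< _ _ t₂ , ≰⇒> (λ h → not⁻ t₃ (≤⇒≤ᵇ h)) , sym (res-def i j)

  freeList⁺ : ∀ κ τ {x} → UnblockedCorner (row κ) (row τ) x → x ∈ freeList κ τ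
  freeList⁺ κ τ (i , u , v , refl) = subst (_∈ _) (sym (res-def i (row τ i)))
    (∈-map⁺ (residue k) (∈-filter⁺ (T? ∘ _) (∈-cells⁺ {τ} {i} (≤-trans (s≤s z≤n) u) ≤-refl)
      (∧⁺ (≡⇒≡ᵇ (row τ i) (row τ i) refl) (∧⁺ (<⇒<ᵇ u) (not⁺ λ t → <⇒≱ v (≤ᵇ⇒≤ (row τ i) _ t))))))

  module _ {τ} (P : Partition τ) where

    private
      τ₀ = τ ++ [ 0 ]
      len₀ : length τ₀ ≡ suc (length τ)
      len₀ = trans (length-++ τ) (+-comm (length τ) 1)
      anti₀ : Anti (row τ₀)
      anti₀ i = subst₂ _≤_ (sym (row-++0 τ (suc i))) (sym (row-++0 τ i)) (Partition.anti P i)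

    cands⁺ : ∀ {κ} → Partition κ → Strip (row κ) (row τ) → row κ 0 ≤ row τ 0 + k → κ ∈ cands k τ
    cands⁺ {κ} Q S h = subst (_∈ cands k τ) κ≡ (∈-map⁺ strip0 (ext⁺ (row τ 0 + k) τ₀ (row κ)
        (λ i → ≤-trans (≤-reflexive (row-++0 τ i)) (Strip.below S i)) h (λ i → ≤-trans (Strip.above S i) (≤-reflexive (sym (row-++0 τ i))))))
      where
      zero-above : ∀ i → length τ₀ ≤ i → row κ i ≡ 0
      zero-above i h with subst (λ z → z ≤ i) len₀ h
      zero-above (suc i) _ | s≤s h′ = n≤0⇒n≡0 (≤-trans (Strip.above S i) (≤-reflexive (row-beyond τ i h′)))
      κ≡ : compress (row κ) (length τ₀) ≡ κ
      κ≡ = row-ext (compress-partition (row κ) (length τ₀) (Partition.anti Q) zero-above) Q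
             (row-compress (row κ) (length τ₀) (Partition.anti Q) zero-above)

    -- The Pieri sum runs over a list, so a repeated candidate would count twice. Dropping zeros is
    -- injective here: all extensions have the same length and their zeros are at the end.
    cands-unique : Unique (cands k τ)
    cands-unique = Unique-map strip0 inj (ext-unique (row τ 0 + k) τ₀)
      where
      E = ext (row τ 0 + k) τ₀
      facts : ∀ {e} → e ∈ E → length e ≡ length τ₀ × (∀ i → row (strip0 e) i ≡ row e i)
      facts {e} p with ext⁻ (row τ 0 + k) τ₀ anti₀ (≤-trans (≤-reflexive (row-++0 τ 0)) (m≤m+n _ k)) p
      ... | l , b , c , _ = l , λ i → trans (cong (λ z → row (strip0 z) i) (sym (applyUpTo-row e)))
                (row-compress (row e) (length e) (λ i → ≤-trans (c i) (b i)) (row-beyond e) i)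
      inj : ∀ {x y} → x ∈ E → y ∈ E → strip0 x ≡ strip0 y → x ≡ y
      inj p q eq = list-ext (trans (proj₁ (facts p)) (sym (proj₁ (facts q))))
        (λ i → trans (sym (proj₂ (facts p) i)) (trans (cong (λ z → row z i) eq) (proj₂ (facts q) i)))

  -- The size is read off from the lengths, which makes the weak strips of all sizes a single list.
  isWeak : List ℕ → List ℕ → Bool
  isWeak τ κ = isCoreᵇ k κ ∧ weakStripᵇ k (klen k κ ∸ klen k τ) κ τ

  abstract
    weakStrips : List ℕ → List (List ℕ)
    weakStrips τ = filterᵇ (isWeak τ) (cands k τ)

    weakStrips-def : ∀ τ → weakStrips τ ≡ filterᵇ (isWeak τ) (cands k τ)
    weakStrips-def τ = refl

  weakStrips-unique : ∀ {τ} → Partition τ → Unique (weakStrips τ)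
  weakStrips-unique {τ} P = subst Unique (sym (weakStrips-def τ)) (Uniq.filter⁺ (T? ∘ isWeak τ) (cands-unique P))

  strip-length : ∀ {κ τ} → Partition κ → Strip (row κ) (row τ) → ∀ l → length τ ≤ l → length κ ≤ suc l
  strip-length {κ} {τ} P S l h = length-≤ P (suc l) (n≤0⇒n≡0 (≤-trans (Strip.above S l) (≤-reflexive (row-beyond τ l h))))

  isWeak⁻ : ∀ {τ κ} → IsCore k τ → T (isWeak τ κ) → ∀ l → length τ ≤ l →
    IsCore k κ × Weak l (row κ) (bounded κ) (row τ) (bounded τ)
  isWeak⁻ {τ} {κ} Cτ t l τ≤l with ∧⁻ {isCoreᵇ k κ} t
  ... | Cκ , t₁ with ∧⁻ {hstripᵇ κ τ} t₁
  ... | h , t₂ with ∧⁻ {klen k κ ≡ᵇ klen k τ + (klen k κ ∸ klen k τ)} t₂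
  ... | t₃ , t₄ = Cκ , record { coreF = IsCore⇒IsC {κ} Cκ ; coreG = IsCore⇒IsC {τ} Cτ ; strip = S ; size = size }
    where
    S = hstrip⁻ κ τ h
    κ≤ : length κ ≤ suc l
    κ≤ = strip-length {κ} {τ} (core-partition {κ} Cκ) S l τ≤l
    size : psum (bounded κ) 0 (suc l) ≡ psum (bounded τ) 0 (suc l) + nDistinct (stripRes (row κ) (row τ) 0 (suc l))
    size = begin
      psum (bounded κ) 0 (suc l) ≡⟨ sym (klen-psum κ (suc l) κ≤) ⟩
      klen k κ ≡⟨ ≡ᵇ⇒≡ _ _ t₃ ⟩
      klen k τ + (klen k κ ∸ klen k τ) ≡⟨ cong₂ _+_ (klen-psum τ (suc l) (m≤n⇒m≤1+n τ≤l))
        (trans (sym (≡ᵇ⇒≡ _ _ t₄)) (skew-count κ τ (suc l) κ≤ (Strip.below S))) ⟩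
      psum (bounded τ) 0 (suc l) + nDistinct (stripRes (row κ) (row τ) 0 (suc l)) ∎
      where open ≡-Reasoning

  weakStrips⁻ : ∀ {τ κ} → IsCore k τ → κ ∈ weakStrips τ → ∀ l → length τ ≤ l →
    IsCore k κ × Weak l (row κ) (bounded κ) (row τ) (bounded τ)
  weakStrips⁻ {τ} {κ} Cτ κ∈ = isWeak⁻ {τ} {κ} Cτ (proj₂ (∈-filter⁻ (T? ∘ isWeak τ) {xs = cands k τ} (subst (κ ∈_) (weakStrips-def τ) κ∈)))

  weakStrips⁺ : ∀ {τ κ l} → IsCore k τ → Partition κ → length τ ≤ l →
    Weak l (row κ) (bounded κ) (row τ) (bounded τ) → κ ∈ weakStrips τ
  weakStrips⁺ {τ} {κ} {l} Cτ P τ≤l W = subst (κ ∈_) (sym (weakStrips-def τ)) (∈-filter⁺ (T? ∘ isWeak τ) (cands⁺ (core-partition {τ} Cτ) P strip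
      (≤-trans (m≤n+m∸n (row κ 0) (row τ 0)) (+-monoʳ-≤ (row τ 0) (row-≤k 0))))
      (∧⁺ (IsC⇒IsCore coreF P) (∧⁺ (hstrip⁺ κ τ strip) (∧⁺ (≡⇒≡ᵇ (klen k κ) _ (sym (m+[n∸m]≡n le))) (≡⇒≡ᵇ (nDistinct (map (residue k) (skewCells κ τ))) _ nd)))))
    where
    open Weak W
    κ≤ : length κ ≤ suc l
    κ≤ = strip-length {κ} {τ} P strip l τ≤l
    eq : klen k κ ≡ klen k τ + nDistinct (map (residue k) (skewCells κ τ))
    eq = trans (klen-psum κ (suc l) κ≤) (trans size (cong₂ _+_ (sym (klen-psum τ (suc l) (m≤n⇒m≤1+n τ≤l))) (sym (skew-count κ τ (suc l) κ≤ below))))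
    le : klen k τ ≤ klen k κ
    le = ≤-trans (m≤m+n _ _) (≤-reflexive (sym eq))
    nd : nDistinct (map (residue k) (skewCells κ τ)) ≡ klen k κ ∸ klen k τ
    nd = sym (trans (cong (λ z → z ∸ klen k τ) eq) (m+n∸m≡n (klen k τ) _))

-- The Pieri rule

module Pieris (k : ℕ) where
  open Interfaces k

  size : List ℕ → List ℕ → ℕ
  size τ κ = klen k κ ∸ klen k τ

  module _ {φ : Poly k → ℤ} (A : Additive φ) (g : List ℕ → Poly k) (τ : List ℕ) (r : ℕ) where
    open Additive A

    -- After the exchange of the two sums a core contributes only for `s` equal to its size. If that
    -- exceeds `r`, `pieriCoeff` is 0.
    pieri-sum : φ (pieriRHS k g τ r) ≡ sumZ (λ κ → pieriCoeff r (size τ κ) (rCount k κ τ) ℤ.* φ (g (pmap k κ))) (weakStrips τ)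
    pieri-sum = begin
      φ (pieriRHS k g τ r) ≡⟨ φ-sumP (map inner (upTo (suc r))) ⟩
      sumZ φ (map inner (upTo (suc r))) ≡⟨ sumZ-map φ inner (upTo (suc r)) ⟩
      sumZ (λ s → φ (inner s)) (upTo (suc r)) ≡⟨ sumZ-cong (upTo (suc r)) (λ { {s} _ → inner-sum s }) ⟩
      sumZ (λ s → sumZ (term s) (cands k τ)) (upTo (suc r)) ≡⟨ sumZ-swap term (upTo (suc r)) (cands k τ) ⟩
      sumZ (λ κ → sumZ (λ s → term s κ) (upTo (suc r))) (cands k τ) ≡⟨ sumZ-cong (cands k τ) (λ { {κ} _ → collapse κ }) ⟩
      sumZ (λ κ → if isWeak τ κ then total κ else + 0) (cands k τ) ≡⟨ sym (trans (cong (sumZ total) (weakStrips-def τ)) (sumZ-filter total (isWeak τ) (cands k τ))) ⟩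
      sumZ total (weakStrips τ) ∎
      where
      open ≡-Reasoning
      c : ℕ → List ℕ → ℤ
      c s κ = pieriTerm r s (rCount k κ τ)
      isStrip : ℕ → List ℕ → Bool
      isStrip s κ = isCoreᵇ k κ ∧ weakStripᵇ k s κ τ
      inner : ℕ → Poly k
      inner s = sumP (map (λ κ → scale (c s κ) (g (pmap k κ))) (filterᵇ (isStrip s) (cands k τ)))
      total : List ℕ → ℤ
      total κ = pieriCoeff r (size τ κ) (rCount k κ τ) ℤ.* φ (g (pmap k κ))
      term : ℕ → List ℕ → ℤ
      term s κ = if isStrip s κ then c s κ ℤ.* φ (g (pmap k κ)) else + 0
      inner-sum : ∀ s → φ (inner s) ≡ sumZ (term s) (cands k τ)
      inner-sum s = trans (φ-sumP (map f xs)) (trans (sumZ-map φ f xs)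
        (trans (sumZ-cong xs (λ { {κ} _ → φ-scale (c s κ) (g (pmap k κ)) })) (sumZ-filter _ (isStrip s) (cands k τ))))
        where
        f : List ℕ → Poly k
        f κ = scale (c s κ) (g (pmap k κ))
        xs = filterᵇ (isStrip s) (cands k τ)
      strip-size : ∀ s κ → T (isStrip s κ) → s ≡ size τ κ
      strip-size s κ t with ∧⁻ {isCoreᵇ k κ} t
      ... | _ , t₁ with ∧⁻ {hstripᵇ κ τ} t₁
      ... | _ , t₂ = sym (trans (cong (_∸ klen k τ) (≡ᵇ⇒≡ (klen k κ) _ (proj₁ (∧⁻ {klen k κ ≡ᵇ klen k τ + s} t₂)))) (m+n∸m≡n (klen k τ) s))
      off : ∀ κ s → s ≢ size τ κ → term s κ ≡ + 0
      off κ s ne with isStrip s κ in eq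
      ... | true = ⊥-elim (ne (strip-size s κ (subst T (sym eq) tt)))
      ... | false = refl
      collapse : ∀ κ → sumZ (λ s → term s κ) (upTo (suc r)) ≡ (if isWeak τ κ then total κ else + 0)
      collapse κ with ≤-<-connex (size τ κ) r
      ... | inj₁ h = trans (sumZ-single (Uniq.upTo⁺ (suc r)) (∈-upTo⁺ (s≤s h)) (λ _ ne → off κ _ ne)) (diag (isWeak τ κ))
        where
        diag : ∀ b → (if b then c (size τ κ) κ ℤ.* φ (g (pmap k κ)) else + 0) ≡ (if b then total κ else + 0)
        diag true = cong (ℤ._* φ (g (pmap k κ))) (sym (pieriCoeff-≤ {r} _ h))
        diag false = refl
      ... | inj₂ h = trans (sumZ-vanish (upTo (suc r)) (λ { {s} p → off κ s (λ e → <⇒≱ h (≤-pred (subst (_< suc r) e (∈-upTo⁻ p)))) })) (none (isWeak τ κ))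
        where
        none : ∀ b → + 0 ≡ (if b then total κ else + 0)
        none true = sym (trans (cong (ℤ._* φ (g (pmap k κ))) (pieriCoeff-> {r} _ h)) (ℤₚ.*-zeroˡ (φ (g (pmap k κ)))))
        none false = refl

sumZ-↭ : ∀ {A : Set} (F : A → ℤ) {xs ys} → xs ↭ ys → sumZ F xs ≡ sumZ F ys
sumZ-↭ F ↭-refl′ = refl
sumZ-↭ F (prep x p) = cong (λ z → F x ℤ.+ z) (sumZ-↭ F p)
sumZ-↭ F (swap x y p) = trans (cong (λ z → F x ℤ.+ (F y ℤ.+ z)) (sumZ-↭ F p))
  (trans (sym (ℤₚ.+-assoc (F x) (F y) _)) (trans (cong (λ z → z ℤ.+ _) (ℤₚ.+-comm (F x) (F y))) (ℤₚ.+-assoc (F y) (F x) _)))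
sumZ-↭ F (↭-trans′ p q) = trans (sumZ-↭ F p) (sumZ-↭ F q)

sumZ-bij : ∀ {A B : Set} (F : B → ℤ) {xs : List A} {ys : List B} (f : A → B) (g : B → A) → Unique xs → Unique ys →
  (∀ {x} → x ∈ xs → f x ∈ ys) → (∀ {y} → y ∈ ys → g y ∈ xs) →
  (∀ {x} → x ∈ xs → g (f x) ≡ x) → (∀ {y} → y ∈ ys → f (g y) ≡ y) → sumZ (F ∘ f) xs ≡ sumZ F ys
sumZ-bij F {xs} {ys} f g ux uy f∈ g∈ gf fg = trans (sym (sumZ-map F f xs)) (sumZ-↭ F (∼bag⇒↭ (unique∧set⇒bag
  (Unique-map f (λ p q e → trans (sym (gf p)) (trans (cong g e) (gf q))) ux) uy (mk⇔ to (λ p → subst (_∈ map f xs) (fg p) (∈-map⁺ f (g∈ p)))))))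
  where
  to : ∀ {y} → y ∈ map f xs → y ∈ ys
  to p with ∈-map⁻ f p
  ... | x , q , refl = f∈ q

glue-cong : ∀ l {f f′ h h′} → (∀ i → i < l → f i ≡ f′ i) → (∀ x → h x ≡ h′ x) → ∀ i → glue l f h i ≡ glue l f′ h′ i
glue-cong l {f} {f′} {h} {h′} a b i with split l i
... | lo p = trans (glue-lo l f h i p) (trans (a i p) (sym (glue-lo l f′ h′ i p)))
... | hi x refl = trans (glue-hi l f h x) (trans (b x) (sym (glue-hi l f′ h′ x)))

-- Partitions with prescribed row functions

module Realize (k : ℕ) where
  open Cores k
  open Weaks k
  open Shifts k
  open Interfaces k public
  open Pieris k public

  stripRes-cong : ∀ {f f′ g g′} → (∀ i → f i ≡ f′ i) → (∀ i → g i ≡ g′ i) → ∀ i c → stripRes f g i c ≡ stripRes f′ g′ i c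
  stripRes-cong hf hg i zero = refl
  stripRes-cong hf hg i (suc c) = cong₂ _++_ (cong₂ (cellsRes i) (hg i) (cong₂ _∸_ (hf i) (hg i))) (stripRes-cong hf hg (suc i) c)

  IsC-cong′ : ∀ {f f′ p p′} → (∀ i → f i ≡ f′ i) → (∀ i → p i ≡ p′ i) → IsC f p → IsC f′ p′
  IsC-cong′ {f} {f′} {p} {p′} hf hp C = record
    { anti = λ i → subst₂ _≤_ (hf (suc i)) (hf i) (anti C i) ; p≤k = λ i → subst (_≤ k) (hp i) (p≤k C i)
    ; law = λ i → trans (cong₂ _+_ (trans (sym (hf _)) (cong (λ z → f (suc (k ∸ z) + i)) (sym (hp i)))) (sym (hp i))) (trans (law C i) (hf i)) }

  Weak-cong : ∀ {l f f′ p p′ g g′ π π′} → (∀ i → f i ≡ f′ i) → (∀ i → p i ≡ p′ i) → (∀ i → g i ≡ g′ i) → (∀ i → π i ≡ π′ i) →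
    Weak l f p g π → Weak l f′ p′ g′ π′
  Weak-cong {l} hf hp hg hπ W = record
    { coreF = IsC-cong′ hf hp W.coreF ; coreG = IsC-cong′ hg hπ W.coreG
    ; strip = record { below = λ i → subst₂ _≤_ (hg i) (hf i) (W.below i) ; above = λ i → subst₂ _≤_ (hf (suc i)) (hg i) (W.above i) }
    ; size = trans (psum-cong 0 0 (suc l) (λ x _ → sym (hp x))) (trans W.size
        (cong₂ _+_ (psum-cong 0 0 (suc l) (λ x _ → hπ x)) (cong nDistinct (stripRes-cong hf hg 0 (suc l))))) }
    where module W = Weak W

  UnblockedCorner-cong : ∀ {f f′ g g′} → (∀ i → f i ≡ f′ i) → (∀ i → g i ≡ g′ i) → ∀ {x} → UnblockedCorner f g x → UnblockedCorner f′ g′ x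
  UnblockedCorner-cong hf hg (i , a , b , c) =
    i , subst₂ _<_ (hg (suc i)) (hg i) a , subst₂ _<_ (hf (suc i)) (hg i) b , trans c (cong (res i) (hg i))

  record Realizes (κ : List ℕ) (f p : ℕ → ℕ) : Set where
    field
      rows≡ : ∀ i → row κ i ≡ f i
      bounded≡ : ∀ i → bounded κ i ≡ p i
      partition : Partition κ

  realize : ∀ {f p} m → IsC f p → (∀ i → m ≤ i → f i ≡ 0) → Realizes (toList f m) f p
  realize {f} {p} m C z = record { rows≡ = R ; bounded≡ = IsC⇒bounded {toList f m} (IsC-cong′ (sym ∘ R) (λ _ → refl) C) ; partition = toList-partition f m (anti C) z }
    where R = row-toList f m (anti C) z

  realize-core : ∀ {κ f p} → Realizes κ f p → IsC f p → IsCore k κ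
  realize-core {κ} R C = IsC⇒IsCore {κ} (IsC-cong′ (sym ∘ rows≡) (λ _ → refl) C) partition
    where open Realizes R

  weak-beyond : ∀ {l f p g π} → Weak l f p g π → g l ≡ 0 → ∀ i → suc l ≤ i → f i ≡ 0
  weak-beyond W gl i h = n≤0⇒n≡0 (≤-trans (Weak.above′ W (anti (Weak.coreG W)) h) (≤-reflexive gl))

  module _ {τ l} (Cτ : IsCore k τ) (τ≤l : length τ ≤ l) where

    top-zero : row τ l ≡ 0
    top-zero = row-beyond τ l τ≤l

    isC-τ : IsC (row τ) (bounded τ)
    isC-τ = IsCore⇒IsC {τ} Cτ

    realize-weak : ∀ {f p g π} → (∀ i → g i ≡ row τ i) → (W : Weak l f p g π) →
      toList f (suc l) ∈ weakStrips τ × Realizes (toList f (suc l)) f p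
    realize-weak {f} {p} {g} {π} hg W = weakStrips⁺ {τ} {toList f (suc l)} {l} Cτ (Realizes.partition R) τ≤l
        (Weak-cong (sym ∘ Realizes.rows≡ R) (sym ∘ Realizes.bounded≡ R) hg
          (λ i → p-unique isC-τ i (π i) (p≤k (Weak.coreG W) i) (law (IsC-cong′ hg (λ _ → refl) (Weak.coreG W)) i)) W) , R
      where R = realize (suc l) (Weak.coreF W) (weak-beyond W (trans (hg l) top-zero))

    module Member {κ} (κ∈ : κ ∈ weakStrips τ) where
      core : IsCore k κ
      core = proj₁ (weakStrips⁻ {τ} {κ} Cτ κ∈ l τ≤l)
      weak : Weak l (row κ) (bounded κ) (row τ) (bounded τ)
      weak = proj₂ (weakStrips⁻ {τ} {κ} Cτ κ∈ l τ≤l)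
      partition : Partition κ
      partition = core-partition {κ} core
      κ-length : length κ ≤ suc l
      κ-length = strip-length {κ} {τ} partition (Weak.strip weak) l τ≤l

      klen-≡ : klen k κ ≡ klen k τ + nDistinct (stripRes (row κ) (row τ) 0 (suc l))
      klen-≡ = trans (klen-psum κ (suc l) κ-length) (trans (Weak.size weak) (cong (λ z → z + nDistinct (stripRes (row κ) (row τ) 0 (suc l))) (sym (klen-psum τ (suc l) (m≤n⇒m≤1+n τ≤l)))))

      size-≡ : size τ κ ≡ nDistinct (stripRes (row κ) (row τ) 0 (suc l))
      size-≡ = trans (cong (λ z → z ∸ klen k τ) klen-≡) (m+n∸m≡n (klen k τ) _)

      klen-size : klen k κ ≡ klen k τ + size τ κ
      klen-size = trans klen-≡ (cong (λ z → klen k τ + z) (sym size-≡))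

    member-ext : ∀ {κ f p} → (κ∈ : κ ∈ weakStrips τ) → Realizes (toList f (suc l)) f p → (∀ i → row κ i ≡ f i) → toList f (suc l) ≡ κ
    member-ext κ∈ R h = row-ext (Realizes.partition R) (Member.partition κ∈) (λ i → trans (Realizes.rows≡ R i) (sym (h i)))

  -- The filters on the two sides come from different pattern-matching lambdas, which agree only
  -- pointwise.
  rCount-≡ : ∀ κ τ → rCount k κ τ ≡ nDistinct (freeList κ τ)
  rCount-≡ κ τ = cong (nDistinct ∘ map (residue k)) (filter-≗ (λ _ → refl) (cells τ))
    where
    filter-≗ : ∀ {A : Set} {b b′ : A → Bool} → (∀ x → b x ≡ b′ x) → ∀ xs → filterᵇ b xs ≡ filterᵇ b′ xs
    filter-≗ h [] = refl
    filter-≗ {b = b} {b′} h (x ∷ xs) with b x | b′ x | h x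
    ... | true | .true | refl = cong (x ∷_) (filter-≗ h xs)
    ... | false | .false | refl = filter-≗ h xs

-- The bijections between lists of weak strips

module Bijs (k T q : ℕ) (q+T : q + T ≡ k) (1≤T : 1 ≤ T) (1≤q : 1 ≤ q) (a : ℕ) where
  open Cores k
  open Weaks k
  open Shifts k
  open Realize k public
  open Downs k T q q+T 1≤T a public

  T<k : T < k
  T<k = ≤-trans (+-monoˡ-≤ T 1≤q) (≤-reflexive q+T)

  linked-cong : ∀ {f f′ l} → (∀ i → f i ≡ f′ i) → ∀ i → linked f l i ≡ linked f′ l i
  linked-cong {f} {f′} {l} h i with linked f l i | linked? f l i
  ... | .1 | is-linked x e = sym (linked-yes f′ l i x (trans (cong (res i) (sym (h i))) (trans e (cong (res l) (h l)))))
  ... | .0 | unlinked n = sym (linked-no f′ l i (λ x e → n x (trans (cong (res i) (h i)) (trans e (cong (res l) (sym (h l)))))))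

  plus-cong : ∀ {f f′ l} → (∀ i → f i ≡ f′ i) → ∀ i → plus f l i ≡ plus f′ l i
  plus-cong h i = cong₂ _+_ (h i) (linked-cong h i)

  minus-cong : ∀ {f f′ l} → (∀ i → f i ≡ f′ i) → ∀ i → minus f l i ≡ minus f′ l i
  minus-cong h i = cong₂ _∸_ (h i) (linked-cong h i)

  plusL minusL : ℕ → List ℕ → List ℕ
  plusL l κ = toList (plus (row κ) l) (suc l)
  minusL l κ = toList (minus (row κ) l) (suc l)

  upF downF : ℕ → (ℕ → ℕ) → ℕ → ℕ
  upF l f = stack l f (sh (f l) (f l ⊓ T))
  downF l f = glue l (λ i → f i ∸ w) (cons (f l ∸ w) (λ _ → 0))

  upF-cong : ∀ {f f′} l → (∀ i → f i ≡ f′ i) → ∀ i → upF l f i ≡ upF l f′ i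
  upF-cong l h = glue-cong l (λ i _ → cong (λ z → z + w) (h i)) (λ x → cong (λ z → sh z (z ⊓ T) x) (h l))

  downF-cong : ∀ {f f′} l → (∀ i → f i ≡ f′ i) → ∀ i → downF l f i ≡ downF l f′ i
  downF-cong l h = glue-cong l (λ i _ → cong (λ z → z ∸ w) (h i)) (λ x → cong (λ z → cons (z ∸ w) (λ _ → 0) x) (h l))

  downF-upF : ∀ l f → (∀ i → suc l ≤ i → f i ≡ 0) → ∀ i → downF l (upF l f) i ≡ f i
  downF-upF l f z i with split l i
  ... | lo h = trans (glue-lo l _ _ i h) (trans (cong (λ z → z ∸ w) (glue-lo l _ _ i h)) (m+n∸n≡m (f i) w))
  ... | hi zero refl = trans (glue-hi l _ _ 0) (trans (cong (λ z → z ∸ w) (glue-at l _ _)) (trans (m+n∸m≡n w (f l)) (cong f (sym (+-identityʳ l)))))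
  ... | hi (suc x) refl = trans (glue-hi l _ _ (suc x)) (sym (z (l + suc x) (m<m+n l (s≤s z≤n))))

  upL downL : ℕ → List ℕ → List ℕ
  upL l κ = toList (upF l (row κ)) (suc (l + (q + height a)))
  downL l κ = toList (downF l (row κ)) (suc l)

  tower : ℕ → List ℕ → List ℕ
  tower l τ = toList (stack l (row τ) S₀) (suc (l + (q + height a)))

  st-last : ∀ b x → suc x ≡ height b → st b 0 x ≡ 0
  st-last zero zero e = refl
  st-last zero (suc x) ()
  st-last (suc b) x e with height b in eq | st-last b
  ... | zero | _ = ⊥-elim (positive b eq)
    where positive : ∀ b → height b ≢ 0
          positive zero ()
          positive (suc b) ()
  ... | suc y | ih = trans (cong (st (suc b) 0) (trans (suc-injective e) (+-suc q y))) (trans (st-hi b 0 y) (ih y refl))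

  module _ {τ l} (Cτ : IsCore k τ) (τ≤l : length τ ≤ l) (big-rows : ∀ i → i < l → T < row τ i) where

    private
      gl : row τ l ≡ 0
      gl = top-zero {τ} Cτ τ≤l
      module Mem {κ} (κ∈ : κ ∈ weakStrips τ) = Member {τ} {l} Cτ τ≤l {κ} κ∈

      τ-beyond : ∀ i → l < i → row τ i ≡ 0
      τ-beyond i h = row-beyond τ i (≤-trans τ≤l (<⇒≤ h))

      hi< : ∀ {s} → s ≤ T → ∀ b → b < l → suc s ≤ row τ b
      hi< h b lt = ≤-trans (s≤s h) (big-rows b lt)

    member-beyond : ∀ {κ} → κ ∈ weakStrips τ → ∀ i → suc l ≤ i → row κ i ≡ 0
    member-beyond κ∈ = weak-beyond (Mem.weak κ∈) gl

    plusL-data : ∀ {κ} → κ ∈ weakStrips τ → row κ l < T →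
      plusL l κ ∈ weakStrips τ × Realizes (plusL l κ) (plus (row κ) l) (plusP (bounded κ) l)
    plusL-data κ∈ h = realize-weak {τ} {l} Cτ τ≤l (λ _ → refl) (plus-Weak (Mem.weak κ∈) gl (hi< (<⇒≤ h)) (≤-trans h T≤k))

    minusL-data : ∀ {κ} → κ ∈ weakStrips τ → 1 ≤ row κ l → row κ l ≤ T →
      minusL l κ ∈ weakStrips τ × Realizes (minusL l κ) (minus (row κ) l) (minusP (bounded κ) l)
    -- This uses `T` < `k`: `minus-Weak` asks for room for one more cell beyond a top row of length
    -- up to `T`.
    minusL-data κ∈ 1≤ h = realize-weak {τ} {l} Cτ τ≤l (λ _ → refl) (minus-Weak (Mem.weak κ∈) gl (hi< h) 1≤ (≤-trans (s≤s h) T<k))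

    plusL-top : ∀ {κ} (κ∈ : κ ∈ weakStrips τ) (h : row κ l < T) → row (plusL l κ) l ≡ suc (row κ l)
    plusL-top κ∈ h = trans (Realizes.rows≡ (proj₂ (plusL-data κ∈ h)) l) (plus-top (Mem.weak κ∈) gl (hi< (<⇒≤ h)))

    minusL-top : ∀ {κ} (κ∈ : κ ∈ weakStrips τ) (1≤ : 1 ≤ row κ l) (h : row κ l ≤ T) → suc (row (minusL l κ) l) ≡ row κ l
    minusL-top κ∈ 1≤ h = trans (cong suc (Realizes.rows≡ (proj₂ (minusL-data κ∈ 1≤ h)) l)) (minus-top (Mem.weak κ∈) gl (hi< h) 1≤)

    minusL-plusL : ∀ {κ} → κ ∈ weakStrips τ → row κ l < T → minusL l (plusL l κ) ≡ κ
    minusL-plusL {κ} κ∈ h = member-ext {τ} {l} Cτ τ≤l κ∈ (proj₂ (minusL-data p∈ (≤-trans (s≤s z≤n) (≤-reflexive (sym t))) (≤-trans (≤-reflexive t) h)))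
        (λ i → sym (trans (minus-cong (Realizes.rows≡ R) i) (minus-plus (Mem.weak κ∈) gl (hi< (<⇒≤ h)) i)))
      where
      p∈ = proj₁ (plusL-data κ∈ h)
      R = proj₂ (plusL-data κ∈ h)
      t = plusL-top κ∈ h

    plusL-minusL : ∀ {κ} → κ ∈ weakStrips τ → 1 ≤ row κ l → row κ l ≤ T → plusL l (minusL l κ) ≡ κ
    plusL-minusL {κ} κ∈ 1≤ h = member-ext {τ} {l} Cτ τ≤l κ∈ (proj₂ (plusL-data m∈ (≤-trans (≤-reflexive (minusL-top κ∈ 1≤ h)) h)))
        (λ i → sym (trans (plus-cong (Realizes.rows≡ R) i) (plus-minus (Mem.weak κ∈) gl (hi< h) 1≤ i)))
      where
      m∈ = proj₁ (minusL-data κ∈ 1≤ h)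
      R = proj₂ (minusL-data κ∈ 1≤ h)

    plusL-size : ∀ {κ} → κ ∈ weakStrips τ → row κ l < T → size τ (plusL l κ) ≡ suc (size τ κ)
    plusL-size {κ} κ∈ h = +-cancelˡ-≡ (klen k τ) _ _ (trans (sym (Mem.klen-size p∈)) (trans klen⁺ (trans (cong suc (Mem.klen-size κ∈)) (sym (+-suc _ _)))))
      where
      p∈ = proj₁ (plusL-data κ∈ h)
      R = proj₂ (plusL-data κ∈ h)
      klen⁺ : klen k (plusL l κ) ≡ suc (klen k κ)
      klen⁺ = trans (klen-psum (plusL l κ) (suc l) (Mem.κ-length p∈)) (trans (psum-cong 0 0 (suc l) (λ x _ → Realizes.bounded≡ R x))
        (trans (psum-atTop suc (bounded κ) l) (trans (+-suc _ _) (cong suc (trans (sym (psum-snoc (bounded κ) 0 l)) (sym (klen-psum κ (suc l) (Mem.κ-length κ∈))))))))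

    plusL-rCount : ∀ {κ} → κ ∈ weakStrips τ → row κ l < T → rCount k (plusL l κ) τ ≡ rCount k κ τ
    plusL-rCount {κ} κ∈ h = trans (rCount-≡ (plusL l κ) τ) (trans (nDistinct-≈
        (λ p → freeList⁺ κ τ (narrow (UnblockedCorner-cong (Realizes.rows≡ R) (λ _ → refl) (freeList⁻ (plusL l κ) τ p))))
        (λ p → freeList⁺ (plusL l κ) τ (UnblockedCorner-cong (sym ∘ Realizes.rows≡ R) (λ _ → refl) (widen (freeList⁻ κ τ p)))))
        (sym (rCount-≡ κ τ)))
      where
      R = proj₂ (plusL-data κ∈ h)
      narrow : ∀ {x} → UnblockedCorner (plus (row κ) l) (row τ) x → UnblockedCorner (row κ) (row τ) x
      narrow (i , u , v , e) = i , u , ≤-trans (s≤s (m≤m+n _ _)) v , e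
      widen : ∀ {x} → UnblockedCorner (row κ) (row τ) x → UnblockedCorner (plus (row κ) l) (row τ) x
      -- Two columns beyond the top row must be gaps of `τ`; a top row shorter than `T` under rows
      -- longer than `T` provides them.
      widen (i , u , v , e) = i , u , plus-unblocked (Mem.weak κ∈) gl (hi< (<⇒≤ h)) (hi< h) i v , e

    private
      l′ : ℕ
      l′ = l + (q + height a)
      B : Stacked l (row τ) (stack l (row τ) S₀) 0
      B = base l (row τ) gl τ-beyond
      CB : IsC (stack l (row τ) S₀) (baseP l (bounded τ))
      CB = base-IsC B gl (isC-τ {τ} {l} Cτ τ≤l) big-rows
      stack-beyond : ∀ i → l′ ≤ i → stack l (row τ) S₀ i ≡ 0
      stack-beyond i h = n≤0⇒n≡0 (≤-trans (mono CB h) (≤-reflexive (trans (glue-hi l _ _ (q + height a)) (st-last (suc a) (q + height a) refl))))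

    tower-realizes : Realizes (tower l τ) (stack l (row τ) S₀) (baseP l (bounded τ))
    tower-realizes = realize (suc l′) CB (λ i h → stack-beyond i (<⇒≤ h))

    tower-core : IsCore k (tower l τ)
    tower-core = realize-core {tower l τ} tower-realizes CB

    tower-length : length (tower l τ) ≤ l′
    tower-length = length-≤ (Realizes.partition tower-realizes) l′ (trans (Realizes.rows≡ tower-realizes l′) (stack-beyond l′ ≤-refl))

    private
      module Mem′ {κ} (κ∈ : κ ∈ weakStrips (tower l τ)) = Member {tower l τ} {l′} tower-core tower-length {κ} κ∈

    upL-data : ∀ {κ} (κ∈ : κ ∈ weakStrips τ) → upL l κ ∈ weakStrips (tower l τ) × Realizes (upL l κ) (upF l (row κ)) (stackedP (bounded κ) (up-stacked (Mem.weak κ∈) gl big-rows))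
    upL-data κ∈ = realize-weak {tower l τ} {l′} tower-core tower-length (sym ∘ Realizes.rows≡ tower-realizes) (up-Weak (Mem.weak κ∈) gl big-rows)

    private
      unstack : ∀ {κ} → κ ∈ weakStrips (tower l τ) → Weak l′ (row κ) (bounded κ) (stack l (row τ) S₀) (baseP l (bounded τ))
      unstack κ∈ = Weak-cong (λ _ → refl) (λ _ → refl) (Realizes.rows≡ tower-realizes) (Realizes.bounded≡ tower-realizes) (Mem′.weak κ∈)

    downL-data : ∀ {κ} (κ∈ : κ ∈ weakStrips (tower l τ)) →
      downL l κ ∈ weakStrips τ × Realizes (downL l κ) (downF l (row κ)) (downP (unstack κ∈) (isC-τ {τ} {l} Cτ τ≤l) gl big-rows)
    downL-data κ∈ = realize-weak {τ} {l} Cτ τ≤l (λ _ → refl) (down-Weak (unstack κ∈) (isC-τ {τ} {l} Cτ τ≤l) gl big-rows)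

    upL-downL : ∀ {κ} → κ ∈ weakStrips (tower l τ) → upL l (downL l κ) ≡ κ
    upL-downL {κ} κ∈ = member-ext {tower l τ} {l′} tower-core tower-length κ∈ (proj₂ (upL-data (proj₁ (downL-data κ∈))))
      (λ i → sym (trans (upF-cong l (Realizes.rows≡ (proj₂ (downL-data κ∈))) i) (up-down (unstack κ∈) (isC-τ {τ} {l} Cτ τ≤l) gl big-rows i)))

    downL-upL : ∀ {κ} → κ ∈ weakStrips τ → downL l (upL l κ) ≡ κ
    downL-upL {κ} κ∈ = member-ext {τ} {l} Cτ τ≤l κ∈ (proj₂ (downL-data (proj₁ (upL-data κ∈))))
      (λ i → sym (trans (downF-cong l (Realizes.rows≡ (proj₂ (upL-data κ∈))) i) (downF-upF l (row κ) (member-beyond κ∈) i)))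

    upL-size : ∀ {κ} → κ ∈ weakStrips τ → size (tower l τ) (upL l κ) ≡ size τ κ
    upL-size {κ} κ∈ = trans (Mem′.size-≡ u∈) (trans (cong nDistinct (stripRes-cong (Realizes.rows≡ R) (Realizes.rows≡ tower-realizes) 0 (suc l′)))
      (trans (cong (λ z → nDistinct (stripRes (upF l (row κ)) (stack l (row τ) S₀) 0 z)) (sym (+-suc l (q + height a))))
        (trans (sym (stacked-res B gl K W.below (Strip.below (stacked-strip B gl K W.strip)))) (sym (Mem.size-≡ κ∈)))))
      where
      u∈ = proj₁ (upL-data κ∈)
      R = proj₂ (upL-data κ∈)
      module W = Weak (Mem.weak κ∈)
      K = up-stacked (Mem.weak κ∈) gl big-rows

    module _ {κ} (κ∈ : κ ∈ weakStrips τ) where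
      private
        u = upL l κ
        R = proj₂ (upL-data κ∈)
        to : ∀ {x} → x ∈ freeList u (tower l τ) → UnblockedCorner (upF l (row κ)) (stack l (row τ) S₀) x
        to p = UnblockedCorner-cong (Realizes.rows≡ R) (Realizes.rows≡ tower-realizes) (freeList⁻ u (tower l τ) p)
        from : ∀ {x} → UnblockedCorner (upF l (row κ)) (stack l (row τ) S₀) x → x ∈ freeList u (tower l τ)
        from c = freeList⁺ u (tower l τ) (UnblockedCorner-cong (sym ∘ Realizes.rows≡ R) (sym ∘ Realizes.rows≡ tower-realizes) c)

      upL-rCount-small : row κ l < T → rCount k u (tower l τ) ≡ suc (rCount k κ τ)
      upL-rCount-small h = trans (rCount-≡ u (tower l τ)) (trans
        (free-small (Mem.weak κ∈) gl big-rows {freeList κ τ} {freeList u (tower l τ)} (freeList⁻ κ τ) (freeList⁺ κ τ) to from h) (cong suc (sym (rCount-≡ κ τ))))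

      upL-rCount-large : T ≤ row κ l → rCount k u (tower l τ) ≡ rCount k κ τ
      upL-rCount-large h = trans (rCount-≡ u (tower l τ)) (trans
        (free-large (Mem.weak κ∈) gl big-rows {freeList κ τ} {freeList u (tower l τ)} (freeList⁻ κ τ) (freeList⁺ κ τ) to from h) (sym (rCount-≡ κ τ)))

if-yes : ∀ {A : Set} b {x y : A} → T b → (if b then x else y) ≡ x
if-yes true _ = refl

if-no : ∀ {A : Set} b {x y : A} → ¬ T b → (if b then x else y) ≡ y
if-no true h = ⊥-elim (h tt)
if-no false _ = refl

-- The Pieri rule over a tower

module Twists (k T′ q : ℕ) (q+T : q + T′ ≡ k) (1≤T : 1 ≤ T′) (1≤q : 1 ≤ q) (a : ℕ) (g : List ℕ → Poly k) where
  open Bijs k T′ q q+T 1≤T 1≤q a public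

  isLow isMid : ℕ → List ℕ → Bool
  isLow l κ = row κ l <ᵇ T′
  isMid l κ = (1 ≤ᵇ row κ l) ∧ (row κ l ≤ᵇ T′)

  isMid⁻ : ∀ {l κ} → T (isMid l κ) → 1 ≤ row κ l × row κ l ≤ T′
  isMid⁻ {l} {κ} t with ∧⁻ {1 ≤ᵇ row κ l} t
  ... | t₁ , t₂ = ≤ᵇ⇒≤ 1 (row κ l) t₁ , ≤ᵇ⇒≤ (row κ l) T′ t₂

  isMid⁺ : ∀ {l κ} → 1 ≤ row κ l → row κ l ≤ T′ → T (isMid l κ)
  isMid⁺ {l} {κ} p q = ∧⁺ (≤⇒≤ᵇ p) (≤⇒≤ᵇ q)

  -- the value of φ at g_{λ ∪ R ∪ (s)} − g_{λ ∪ R ∪ (s − 1)}, to be compared with g_R g_{λ ∪ (s)}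
  upper twisted : (Poly k → ℤ) → ℕ → List ℕ → ℤ
  upper φ l κ = φ (g (pmap k (upL l κ)))
  twisted φ l κ = upper φ l κ ℤ.+ ℤ.- (if isMid l κ then upper φ l (minusL l κ) else + 0)

  twisted-plain : ∀ φ {l κ} → ¬ T (isMid l κ) → twisted φ l κ ≡ upper φ l κ
  twisted-plain φ {l} {κ} h = trans (cong (λ z → upper φ l κ ℤ.+ ℤ.- z) (if-no (isMid l κ) h)) (ℤₚ.+-identityʳ _)

  module _ {φ : Poly k → ℤ} (A : Additive φ) {τ l} (Cτ : IsCore k τ) (τ≤l : length τ ≤ l)
    (big-rows : ∀ i → i < l → T′ < row τ i) (r : ℕ) where

    private
      W = weakStrips τ
      W′ = weakStrips (tower l τ)
      y = upper φ l
      K K⁺ : List ℕ → ℤ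
      K κ = pieriCoeff r (size τ κ) (rCount k κ τ)
      K⁺ κ = pieriCoeff r (suc (size τ κ)) (rCount k κ τ)
      F′ : List ℕ → ℤ
      F′ κ = pieriCoeff r (size (tower l τ) κ) (rCount k κ (tower l τ)) ℤ.* φ (g (pmap k κ))
      H : List ℕ → ℤ
      H κ = K κ ℤ.* y (minusL l κ)

      F′-up : ∀ {κ} → κ ∈ W → F′ (upL l κ) ≡ K κ ℤ.* y κ ℤ.+ ℤ.- (if isLow l κ then K⁺ κ ℤ.* y κ else + 0)
      F′-up {κ} κ∈ = go (<-≤-connex (row κ l) T′)
        where
        go : row κ l < T′ ⊎ T′ ≤ row κ l → F′ (upL l κ) ≡ K κ ℤ.* y κ ℤ.+ ℤ.- (if isLow l κ then K⁺ κ ℤ.* y κ else + 0)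
        go (inj₁ h) = trans (cong₂ (λ a b → pieriCoeff r a b ℤ.* y κ) (upL-size {τ} {l} Cτ τ≤l big-rows κ∈) (upL-rCount-small {τ} {l} Cτ τ≤l big-rows κ∈ h))
          (trans (cong (λ z → z ℤ.* y κ) (pieriCoeff-suc r (size τ κ) (rCount k κ τ))) (trans (ℤₚ.*-distribʳ-+ (y κ) (K κ) (ℤ.- K⁺ κ))
            (cong (λ z → K κ ℤ.* y κ ℤ.+ z) (trans (sym (ℤₚ.neg-distribˡ-* (K⁺ κ) (y κ))) (cong ℤ.-_ (sym (if-yes (isLow l κ) (<⇒<ᵇ h))))))))
        go (inj₂ h) = trans (cong₂ (λ a b → pieriCoeff r a b ℤ.* y κ) (upL-size {τ} {l} Cτ τ≤l big-rows κ∈) (upL-rCount-large {τ} {l} Cτ τ≤l big-rows κ∈ h))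
          (trans (sym (ℤₚ.+-identityʳ _)) (cong (λ z → K κ ℤ.* y κ ℤ.+ ℤ.- z) (sym (if-no (isLow l κ) (λ t → <⇒≱ (<ᵇ⇒< (row κ l) T′ t) h)))))

      -- `K⁺ κ` is the coefficient `K` at `plusL l κ`, and `y κ` is `y` at the shortening of
      -- `plusL l κ`; so this is a change of the summation index.
      low-mid : sumZ (λ κ → if isLow l κ then K⁺ κ ℤ.* y κ else + 0) W ≡ sumZ (λ κ → if isMid l κ then H κ else + 0) W
      low-mid = begin
        sumZ (λ κ → if isLow l κ then K⁺ κ ℤ.* y κ else + 0) W ≡⟨ sym (sumZ-filter _ (isLow l) W) ⟩
        sumZ (λ κ → K⁺ κ ℤ.* y κ) (filterᵇ (isLow l) W) ≡⟨ sumZ-cong (filterᵇ (isLow l) W) (λ p → same (low⁻ p)) ⟩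
        sumZ (H ∘ plusL l) (filterᵇ (isLow l) W) ≡⟨ sumZ-bij H (plusL l) (minusL l) (Uniq.filter⁺ (T? ∘ isLow l) uW) (Uniq.filter⁺ (T? ∘ isMid l) uW)
            (λ p → to (low⁻ p)) (λ p → from (mid⁻ p)) (λ p → let (κ∈ , h) = low⁻ p in minusL-plusL {τ} {l} Cτ τ≤l big-rows κ∈ h)
            (λ p → let (κ∈ , h , h′) = mid⁻ p in plusL-minusL {τ} {l} Cτ τ≤l big-rows κ∈ h h′) ⟩
        sumZ H (filterᵇ (isMid l) W) ≡⟨ sumZ-filter H (isMid l) W ⟩
        sumZ (λ κ → if isMid l κ then H κ else + 0) W ∎
        where
        open ≡-Reasoning
        uW : Unique W
        uW = weakStrips-unique (core-partition {τ} Cτ)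
        low⁻ : ∀ {κ} → κ ∈ filterᵇ (isLow l) W → κ ∈ W × row κ l < T′
        low⁻ {κ} p with ∈-filter⁻ (T? ∘ isLow l) {xs = W} p
        ... | κ∈ , t = κ∈ , <ᵇ⇒< (row κ l) T′ t
        mid⁻ : ∀ {κ} → κ ∈ filterᵇ (isMid l) W → κ ∈ W × 1 ≤ row κ l × row κ l ≤ T′
        mid⁻ {κ} p with ∈-filter⁻ (T? ∘ isMid l) {xs = W} p
        ... | κ∈ , t = κ∈ , isMid⁻ {l} {κ} t
        same : ∀ {κ} → κ ∈ W × row κ l < T′ → K⁺ κ ℤ.* y κ ≡ H (plusL l κ)
        same (κ∈ , h) = sym (cong₂ ℤ._*_ (cong₂ (pieriCoeff r) (plusL-size {τ} {l} Cτ τ≤l big-rows κ∈ h) (plusL-rCount {τ} {l} Cτ τ≤l big-rows κ∈ h))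
          (cong y (minusL-plusL {τ} {l} Cτ τ≤l big-rows κ∈ h)))
        to : ∀ {κ} → κ ∈ W × row κ l < T′ → plusL l κ ∈ filterᵇ (isMid l) W
        to {κ} (κ∈ , h) = ∈-filter⁺ (T? ∘ isMid l) (proj₁ (plusL-data {τ} {l} Cτ τ≤l big-rows κ∈ h))
          (isMid⁺ {l} {plusL l κ} (≤-trans (s≤s z≤n) (≤-reflexive (sym t))) (≤-trans (≤-reflexive t) h))
          where t = plusL-top {τ} {l} Cτ τ≤l big-rows κ∈ h
        from : ∀ {κ} → κ ∈ W × 1 ≤ row κ l × row κ l ≤ T′ → minusL l κ ∈ filterᵇ (isLow l) W
        from {κ} (κ∈ , h , h′) = ∈-filter⁺ (T? ∘ isLow l) (proj₁ (minusL-data {τ} {l} Cτ τ≤l big-rows κ∈ h h′))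
          (<⇒<ᵇ (≤-trans (≤-reflexive (minusL-top {τ} {l} Cτ τ≤l big-rows κ∈ h h′)) h′))

    twisted-pieri : φ (pieriRHS k g (tower l τ) r) ≡ sumZ (λ κ → K κ ℤ.* twisted φ l κ) W
    twisted-pieri = begin
      φ (pieriRHS k g (tower l τ) r) ≡⟨ pieri-sum A g (tower l τ) r ⟩
      sumZ F′ W′ ≡⟨ sym (sumZ-bij F′ (upL l) (downL l) (weakStrips-unique (core-partition {τ} Cτ))
          (weakStrips-unique (core-partition {tower l τ} (tower-core {τ} {l} Cτ τ≤l big-rows)))
          (λ κ∈ → proj₁ (upL-data {τ} {l} Cτ τ≤l big-rows κ∈)) (λ κ∈ → proj₁ (downL-data {τ} {l} Cτ τ≤l big-rows κ∈))
          (downL-upL {τ} {l} Cτ τ≤l big-rows) (upL-downL {τ} {l} Cτ τ≤l big-rows)) ⟩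
      sumZ (F′ ∘ upL l) W ≡⟨ sumZ-cong W F′-up ⟩
      sumZ (λ κ → K κ ℤ.* y κ ℤ.+ ℤ.- (if isLow l κ then K⁺ κ ℤ.* y κ else + 0)) W ≡⟨ sumZ-+ _ _ W ⟩
      sumZ (λ κ → K κ ℤ.* y κ) W ℤ.+ sumZ (λ κ → ℤ.- (if isLow l κ then K⁺ κ ℤ.* y κ else + 0)) W
        ≡⟨ cong (λ z → sumZ (λ κ → K κ ℤ.* y κ) W ℤ.+ z) (trans (sumZ-neg _ W) (trans (cong ℤ.-_ low-mid) (sym (sumZ-neg _ W)))) ⟩
      sumZ (λ κ → K κ ℤ.* y κ) W ℤ.+ sumZ (λ κ → ℤ.- (if isMid l κ then H κ else + 0)) W ≡⟨ sym (sumZ-+ _ _ W) ⟩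
      sumZ (λ κ → K κ ℤ.* y κ ℤ.+ ℤ.- (if isMid l κ then H κ else + 0)) W ≡⟨ sumZ-cong W (λ { {κ} _ → factor κ (isMid l κ) }) ⟩
      sumZ (λ κ → K κ ℤ.* twisted φ l κ) W ∎
      where
      open ≡-Reasoning
      factor : ∀ κ b → K κ ℤ.* y κ ℤ.+ ℤ.- (if b then H κ else + 0) ≡ K κ ℤ.* (y κ ℤ.+ ℤ.- (if b then y (minusL l κ) else + 0))
      factor κ true = trans (cong (λ z → K κ ℤ.* y κ ℤ.+ z) (ℤₚ.neg-distribʳ-* (K κ) (y (minusL l κ)))) (sym (ℤₚ.*-distribˡ-+ (K κ) (y κ) _))
      factor κ false = trans (ℤₚ.+-identityʳ _) (cong (K κ ℤ.*_) (sym (ℤₚ.+-identityʳ (y κ))))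

-- Bounded partitions

row-applyUpTo : ∀ f m i → i < m → row (applyUpTo f m) i ≡ f i
row-applyUpTo f (suc m) zero h = refl
row-applyUpTo f (suc m) (suc i) (s≤s h) = row-applyUpTo (f ∘ suc) m i h

module CoreOf (k : ℕ) where
  open Cores k
  open Weaks k
  open Shifts k
  open Realize k

  -- The inverse 𝔠, built from the top row downwards. The length of a new bottom row is dictated by
  -- `law`: row `suc (k ∸ x)` of the new core is row `k ∸ x` of the old one.
  coreOf : List ℕ → List ℕ
  coreOf [] = []
  coreOf (x ∷ μ) = x + row (coreOf μ) (k ∸ x) ∷ coreOf μ

  coreOf-length : ∀ μ → length (coreOf μ) ≡ length μ
  coreOf-length [] = refl
  coreOf-length (x ∷ μ) = cong suc (coreOf-length μ)

  coreOf-IsC : ∀ μ → Anti (row μ) → row μ 0 ≤ k → IsC (row (coreOf μ)) (row μ)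
  coreOf-IsC [] a h = record { anti = λ _ → z≤n ; p≤k = λ _ → z≤n ; law = λ _ → refl }
  coreOf-IsC (x ∷ μ) a h = record { anti = anti′ ; p≤k = p≤k′ ; law = law′ }
    where
    C = coreOf-IsC μ (a ∘ suc) (≤-trans (a 0) h)
    anti′ : Anti (row (coreOf (x ∷ μ)))
    anti′ zero = lin (row (coreOf μ) 0 ∷ row (coreOf μ) (suc (k ∸ row μ 0) + 0) ∷ row μ 0 ∷ x ∷ row (coreOf μ) (k ∸ x) ∷ [])
      (λ c d y x e → d ⊕ y ≐ c ⇒ d ≼ e ⇒ y ≼ x ⇒ ⊢ c ≼ x ⊕ e) (law C 0)
      (mono C (≤-trans (∸-monoʳ-≤ k (a 0)) (≤-trans (n≤1+n _) (s≤s (≤-reflexive (sym (+-identityʳ _))))))) (a 0)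
    anti′ (suc i) = anti C i
    p≤k′ : ∀ i → row (x ∷ μ) i ≤ k
    p≤k′ zero = h
    p≤k′ (suc i) = p≤k C i
    law′ : ∀ i → row (coreOf (x ∷ μ)) (suc (k ∸ row (x ∷ μ) i) + i) + row (x ∷ μ) i ≡ row (coreOf (x ∷ μ)) i
    law′ zero = trans (cong (λ z → row (coreOf μ) z + x) (+-identityʳ (k ∸ x))) (+-comm _ x)
    law′ (suc i) = trans (cong (λ z → row (coreOf μ) z + row μ i) (+-suc (k ∸ row μ i) i)) (law C i)

  -- `law` expresses a row by a higher one, so `p` determines the rows by descending induction.
  core-unique : ∀ {f f′ p p′} m → IsC f p → IsC f′ p′ → (∀ i → p i ≡ p′ i) → (∀ i → m ≤ i → f i ≡ f′ i) → ∀ i → f i ≡ f′ i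
  core-unique {f} {f′} {p} {p′} m C C′ hp h i = go m i (m≤n+m m i)
    where
    go : ∀ d i → m ≤ i + d → f i ≡ f′ i
    go zero i le = h i (≤-trans le (≤-reflexive (+-identityʳ i)))
    go (suc d) i le = trans (sym (law C i)) (trans (cong₂ _+_ (trans (go d _ le′) (cong (λ z → f′ (suc (k ∸ z) + i)) (hp i))) (hp i)) (law C′ i))
      where
      le′ : m ≤ suc (k ∸ p i) + i + d
      le′ = ≤-trans le (≤-trans (≤-reflexive (+-suc i d)) (s≤s (+-monoˡ-≤ d (m≤n+m i _))))

  bounded-anti : ∀ {f p} → IsC f p → Anti p
  bounded-anti {f} {p} C i with ≤-<-connex (p (suc i)) (p i)
  ... | inj₁ h = h
  ... | inj₂ h = ⊥-elim (lin (f i ∷ f (suc i) ∷ p i ∷ p (suc i) ∷ f (suc (k ∸ p i) + i) ∷ f (suc (k ∸ p (suc i)) + suc i) ∷ [])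
      (λ f f′ p p′ c c′ → c ⊕ p ≐ f ⇒ c′ ⊕ p′ ≐ f′ ⇒ f′ ≼ f ⇒ p ≺ p′ ⇒ c ≼ c′ ⇒ ⊢⊥) (law C i) (law C (suc i)) (anti C i) h
      (mono C (s≤s (≤-trans (≤-reflexive (+-suc _ i)) (+-monoˡ-≤ i (∸-monoʳ-< h (p≤k C (suc i))))))))

  module _ {τ l} (Cτ : IsCore k τ) (τ≤l : length τ ≤ l) where
    private
      gl : row τ l ≡ 0
      gl = top-zero {τ} {l} Cτ τ≤l
      C = isC-τ {τ} {l} Cτ τ≤l

    empty-strip : Weak l (row τ) (bounded τ) (row τ) (bounded τ)
    empty-strip = record { coreF = C ; coreG = C ; strip = record { below = λ _ → ≤-refl ; above = anti C }
      ; size = trans (sym (+-identityʳ _)) (cong (λ z → psum (bounded τ) 0 (suc l) + nDistinct z) (sym (none 0 (suc l)))) }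
      where
      none : ∀ i c → stripRes (row τ) (row τ) i c ≡ []
      none i zero = refl
      none i (suc c) = cong₂ _++_ (cong (cellsRes i (row τ i)) (n∸n≡0 (row τ i))) (none (suc i) c)

    -- The part `s` is added on top by `s` applications of `plus`, each of which adds one residue
    -- and changes only the top part. So 𝔠(μ ∪ (s)) / 𝔠(μ) is a weak s-strip.
    new-row : ∀ s → (∀ b → b < l → s ≤ row τ b) → s ≤ k →
      ∃[ f ] ∃[ p ] (Weak l f p (row τ) (bounded τ) × f l ≡ s × (∀ i → i < l → p i ≡ bounded τ i))
    new-row zero fits s≤k = row τ , bounded τ , empty-strip , gl , λ _ _ → refl
    new-row (suc s) fits s≤k with new-row s (λ b h → <⇒≤ (fits b h)) (<⇒≤ s≤k)
    ... | f , p , W , refl , same = plus f l , plusP p l , plus-Weak W gl fits s≤k , plus-top W gl fits ,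
          λ i i<l → trans (atTop-other suc p l i (<⇒≢ i<l)) (same i i<l)

  top-row : ∀ {f p l} → IsC f p → (∀ i → l < i → f i ≡ 0) → p l ≡ f l
  top-row {f} {p} {l} C z = trans (cong (λ y → y + p l) (sym (z _ (s≤s (m≤n+m l (k ∸ p l)))))) (law C l)

  module _ {κ l} (Cκ : IsCore k κ) (κ≤ : length κ ≤ suc l) where
    private
      C = IsCore⇒IsC {κ} Cκ

    beyond-top : ∀ i → l < i → row κ i ≡ 0
    beyond-top i h = row-beyond κ i (≤-trans κ≤ h)

    μ : List ℕ
    μ = applyUpTo (bounded κ) l

    base-core : List ℕ
    base-core = coreOf μ

    private
      μ-row : ∀ i → i < l → row μ i ≡ bounded κ i
      μ-row = row-applyUpTo (bounded κ) l
      μ-beyond : ∀ i → l ≤ i → row μ i ≡ 0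
      μ-beyond i h = row-beyond μ i (≤-trans (≤-reflexive (length-applyUpTo (bounded κ) l)) h)
      μ-anti : Anti (row μ)
      μ-anti i with <-≤-connex (suc i) l
      ... | inj₁ h = subst₂ _≤_ (sym (μ-row (suc i) h)) (sym (μ-row i (<⇒≤ h))) (bounded-anti C i)
      ... | inj₂ h = ≤-trans (≤-reflexive (μ-beyond (suc i) h)) z≤n
      μ-≤k : row μ 0 ≤ k
      μ-≤k with <-≤-connex 0 l
      ... | inj₁ h = ≤-trans (≤-reflexive (μ-row 0 h)) (p≤k C 0)
      ... | inj₂ h = ≤-trans (≤-reflexive (μ-beyond 0 h)) z≤n
      Cμ = coreOf-IsC μ μ-anti μ-≤k

    base-core-length : length base-core ≡ l
    base-core-length = trans (coreOf-length μ) (length-applyUpTo (bounded κ) l)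

    base-core-bounded : ∀ i → bounded base-core i ≡ row μ i
    base-core-bounded = IsC⇒bounded {base-core} Cμ

    base-core-bounded< : ∀ i → i < l → bounded base-core i ≡ bounded κ i
    base-core-bounded< i h = trans (base-core-bounded i) (μ-row i h)

    module _ (pos : ∀ i → i < l → 1 ≤ bounded κ i) where

      base-core-IsCore : IsCore k base-core
      base-core-IsCore = IsC⇒IsCore {base-core} Cμ (record { anti = anti Cμ
        ; pos = λ i h → ≤-trans (pos i (lt h)) (≤-trans (≤-reflexive (sym (μ-row i (lt h)))) (p≤f Cμ i)) })
        where lt : ∀ {i} → i < length base-core → i < l
              lt h = ≤-trans h (≤-reflexive base-core-length)

      private
        τ = base-core
        Cτ = base-core-IsCore
        τ≤l : length τ ≤ l
        τ≤l = ≤-reflexive base-core-length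

      base-core-weak : κ ∈ weakStrips base-core
      base-core-weak with new-row {τ} {l} Cτ τ≤l (row κ l)
          (λ b h → ≤-trans (≤-reflexive (sym (top-row C beyond-top)))
             (≤-trans (anti-≤ {bounded κ} (bounded-anti C) (<⇒≤ h)) (≤-trans (≤-reflexive (trans (sym (μ-row b h)) refl)) (p≤f Cμ b))))
          (≤-trans (≤-reflexive (sym (top-row C beyond-top))) (p≤k C l))
      ... | f , p , W , top , same = weakStrips⁺ {τ} {κ} {l} Cτ (core-partition {κ} Cκ) τ≤l
            (Weak-cong {g = row τ} {π = bounded τ} f≡ p≡ (λ _ → refl) (λ _ → refl) W)
        where
        fz : ∀ i → suc l ≤ i → f i ≡ 0
        fz = weak-beyond W (top-zero {τ} {l} Cτ τ≤l)
        p≡ : ∀ i → p i ≡ bounded κ i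
        p≡ i with <-cmp i l
        ... | tri< h _ _ = trans (same i h) (base-core-bounded< i h)
        ... | tri≈ _ refl _ = trans (top-row (Weak.coreF W) fz) (trans top (sym (top-row C beyond-top)))
        ... | tri> _ _ h = trans (n≤0⇒n≡0 (≤-trans (p≤f (Weak.coreF W) i) (≤-reflexive (fz i h)))) (sym (n≤0⇒n≡0 (≤-trans (p≤f C i) (≤-reflexive (beyond-top i h)))))
        f≡ : ∀ i → f i ≡ row κ i
        f≡ = core-unique (suc l) (Weak.coreF W) C p≡ (λ i h → trans (fz i h) (sym (beyond-top i h)))

      base-core-size : klen k κ ≡ klen k base-core + row κ l
      base-core-size = trans (klen-psum κ (suc l) κ≤) (trans (psum-snoc (bounded κ) 0 l) (cong₂ _+_
        (trans (psum-cong 0 0 l (λ x h → sym (base-core-bounded< x h))) (sym (klen-psum τ l τ≤l))) (top-row C beyond-top)))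

      -- By `row-tight` no part decreases in a weak strip. At equal length the top row is therefore
      -- at most `row κ l`, and if it is equal, then all other parts are those of the base and the
      -- cores coincide.
      base-core-top : ∀ {κ′} → κ′ ∈ weakStrips base-core → size base-core κ′ ≤ row κ l → κ′ ≢ κ →
        klen k κ′ < klen k κ ⊎ (klen k κ′ ≡ klen k κ × row κ′ l < row κ l)
      base-core-top {κ′} κ′∈ h κ′≢ with m≤n⇒m<n∨m≡n h
      ... | inj₁ lt = inj₁ (subst₂ _<_ (sym M.klen-size) (sym base-core-size) (+-monoʳ-< (klen k τ) lt))
        where module M = Member {τ} {l} Cτ τ≤l {κ′} κ′∈
      ... | inj₂ eq = inj₂ (klen≡ , ≤∧≢⇒< s′≤s λ s≡ → κ′≢ (row-ext M.partition (core-partition {κ} Cκ) (rows s≡)))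
        where
        module M = Member {τ} {l} Cτ τ≤l {κ′} κ′∈
        C′ = Weak.coreF M.weak
        bz : ∀ i → l < i → row κ′ i ≡ 0
        bz i h = row-beyond κ′ i (≤-trans M.κ-length h)
        klen≡ : klen k κ′ ≡ klen k κ
        klen≡ = trans M.klen-size (trans (cong (λ z → klen k τ + z) eq) (sym base-core-size))
        grows : ∀ x → 0 ≤ x → x < 0 + l → bounded τ x ≤ bounded κ′ x
        grows x _ h = proj₁ (Weak.row-tight M.weak x (<⇒≤ h))
        sums : psum (bounded κ′) 0 l + row κ′ l ≡ psum (bounded τ) 0 l + row κ l
        sums = trans (trans (cong (λ z → psum (bounded κ′) 0 l + z) (sym (top-row C′ bz))) (trans (sym (psum-snoc (bounded κ′) 0 l)) (sym (klen-psum κ′ (suc l) M.κ-length))))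
          (trans klen≡ (trans base-core-size (cong (λ z → z + row κ l) (klen-psum τ l τ≤l))))
        s′≤s : row κ′ l ≤ row κ l
        s′≤s = lin (psum (bounded κ′) 0 l ∷ row κ′ l ∷ psum (bounded τ) 0 l ∷ row κ l ∷ []) (λ A s B t → A ⊕ s ≐ B ⊕ t ⇒ B ≼ A ⇒ ⊢ s ≼ t) sums (psum-≤ 0 l grows)
        rows : row κ′ l ≡ row κ l → ∀ i → row κ′ i ≡ row κ i
        rows s≡ = core-unique (suc l) C′ C p≡ (λ i h → trans (bz i h) (sym (beyond-top i h)))
          where
          p≡ : ∀ i → bounded κ′ i ≡ bounded κ i
          p≡ i with <-cmp i l
          ... | tri< h _ _ = trans (sym (psum-≡⇒ 0 l grows (lin (psum (bounded κ′) 0 l ∷ row κ′ l ∷ psum (bounded τ) 0 l ∷ row κ l ∷ [])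
                  (λ A s B t → A ⊕ s ≐ B ⊕ t ⇒ s ≐ t ⇒ ⊢ B ≐ A) sums s≡) i z≤n h)) (base-core-bounded< i h)
          ... | tri≈ _ refl _ = trans (top-row C′ bz) (trans s≡ (sym (top-row C beyond-top)))
          ... | tri> _ _ h = trans (n≤0⇒n≡0 (≤-trans (p≤f C′ i) (≤-reflexive (bz i h)))) (sym (n≤0⇒n≡0 (≤-trans (p≤f C i) (≤-reflexive (beyond-top i h)))))

-- Factorization

≈-sym : ∀ {k} {p q : Poly k} → p ≈ q → q ≈ p
≈-sym h m = sym (h m)

compress-rep : ∀ m y r c → 1 ≤ y → compress (rep m y r) (m + c) ≡ replicate m y ++ compress r c
compress-rep zero y r c h = refl
compress-rep (suc m) (suc y) r c h = cong (suc y ∷_) (compress-rep m (suc y) r c h)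

compress-glue : ∀ l p r c → compress (glue l p r) (l + c) ≡ compress p l ++ compress r c
compress-glue zero p r c = refl
compress-glue (suc l) p r c with p 0
... | zero = compress-glue l (p ∘ suc) r c
... | suc x = cong (suc x ∷_) (compress-glue l (p ∘ suc) r c)

toList-glue : ∀ l p r c → toList (glue l p r) (l + c) ≡ toList p l ++ toList r c
toList-glue l p r c = trans (toList-def (glue l p r) (l + c)) (trans (compress-glue l p r c) (sym (cong₂ _++_ (toList-def p l) (toList-def r c))))

replicate-+ : ∀ {A : Set} m n (x : A) → replicate (m + n) x ≡ replicate m x ++ replicate n x
replicate-+ zero n x = refl
replicate-+ (suc m) n x = cong (x ∷_) (replicate-+ m n x)

toList-row : ∀ {κ} → Partition κ → toList (row κ) (length κ) ≡ κ
toList-row {κ} P = row-ext (toList-partition (row κ) (length κ) (Partition.anti P) (row-beyond κ)) P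
  (row-toList (row κ) (length κ) (Partition.anti P) (row-beyond κ))

module Factors (k T′ q : ℕ) (q+T : q + T′ ≡ k) (1≤T : 1 ≤ T′) (1≤q : 1 ≤ q) (a : ℕ)
  (g : List ℕ → Poly k) (KS : IsKkSchur k g) where
  open Cores k
  open Weaks k
  open Twists k T′ q q+T 1≤T 1≤q a g
  open CoreOf k
  open IsKkSchur KS

  P : Poly k
  P = g (Rpow k T′ (suc a))

  Factored : ℕ → List ℕ → Set
  Factored l κ = ∀ m → twisted (λ p → coeff p m) l κ ≡ coeff (P *P g (pmap k κ)) m

  -- The cores of μ ∪ (s), where μ has `l` parts and all of them exceed `T′`; `s` may be 0.
  record Long (l : ℕ) (κ : List ℕ) : Set where
    field
      core : IsCore k κ
      len : length κ ≤ suc l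
      wide : ∀ i → i < l → T′ < bounded κ i

  Tower : ℕ → Set
  Tower l = ∀ τ → IsCore k τ → length τ ≤ l → (∀ i → i < l → T′ < bounded τ i) →
    g (pmap k (tower l τ)) ≈ P *P g (pmap k τ)

  bounded≤row : ∀ {κ} → IsCore k κ → ∀ i → bounded κ i ≤ row κ i
  bounded≤row {κ} C = p≤f (IsCore⇒IsC {κ} C)

  upL-zero : ∀ l κ → row κ l ≡ 0 → upL l κ ≡ tower l κ
  upL-zero l κ e = toList-cong _ (glue-cong l (λ _ _ → refl) (λ x → cong (λ z → sh z (z ⊓ T′) x) e))

  -- The Pieri rules at τ and at its tower differ only in terms that are already known, except for the top one.
  factored-step : ∀ {l} → Tower l → ∀ κ → Long l κ →
    (∀ κ′ → Long l κ′ → klen k κ′ < klen k κ ⊎ (klen k κ′ ≡ klen k κ × row κ′ l < row κ l) → Factored l κ′) → Factored l κ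
  factored-step {l} tw κ L rec m with m≤n⇒m<n∨m≡n (z≤n {row κ l})
  -- With an empty top row `upL` is the tower over `κ` itself, and there is no correction term.
  ... | inj₂ s≡ = trans (twisted-plain (λ p → coeff p m) {l} {κ} (λ t → <⇒≢ (proj₁ (isMid⁻ {l} {κ} t)) s≡))
      (trans (cong (λ z → coeff (g (pmap k z)) m) (upL-zero l κ (sym s≡)))
        (tw κ (Long.core L) (length-≤ (core-partition {κ} (Long.core L)) l (sym s≡)) (Long.wide L) m))
  ... | inj₁ 1≤s = ℤₚ.i-j≡0⇒i≡j (Δ κ) (Y κ) (trans (sym top-term) diff-zero)
    where
    open Long L
    pos : ∀ i → i < l → 1 ≤ bounded κ i
    pos i h = ≤-trans (s≤s z≤n) (wide i h)
    τ : List ℕ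
    τ = base-core {κ} {l} core len
    Cτ : IsCore k τ
    Cτ = base-core-IsCore {κ} {l} core len pos
    τ≤l : length τ ≤ l
    τ≤l = ≤-reflexive (base-core-length {κ} {l} core len)
    bigτ : ∀ i → i < l → T′ < bounded τ i
    bigτ i h = ≤-trans (wide i h) (≤-reflexive (sym (base-core-bounded< {κ} {l} core len i h)))
    big-rows : ∀ i → i < l → T′ < row τ i
    big-rows i h = ≤-trans (bigτ i h) (bounded≤row {τ} Cτ i)
    κ∈ : κ ∈ weakStrips τ
    κ∈ = base-core-weak {κ} {l} core len pos
    -- The Pieri rule for this `r` gives `κ` the coefficient 1, since `κ` is a strip of size exactly
    -- `r`, and it kills all larger strips.
    r : ℕ
    r = row κ l
    r≤k : r ≤ k
    r≤k = ≤-trans (≤-reflexive (sym (top-row (IsCore⇒IsC {κ} core) (beyond-top {κ} {l} core len)))) (p≤k (IsCore⇒IsC {κ} core) l)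
    K Δ Y D : List ℕ → ℤ
    K x = pieriCoeff r (size τ x) (rCount k x τ)
    Δ = twisted (λ p → coeff p m) l
    Y x = coeff (P *P g (pmap k x)) m
    D x = K x ℤ.* (Δ x ℤ.- Y x)
    W = weakStrips τ

    pieri-equal : sumZ (λ x → K x ℤ.* Δ x) W ≡ sumZ (λ x → K x ℤ.* Y x) W
    pieri-equal = begin
      sumZ (λ x → K x ℤ.* Δ x) W ≡⟨ sym (twisted-pieri (coeff-additive m) {τ} {l} Cτ τ≤l big-rows r) ⟩
      coeff (pieriRHS k g (tower l τ) r) m ≡⟨ sym (pieri (tower l τ) (tower-core {τ} {l} Cτ τ≤l big-rows) r r≤k m) ⟩
      coeff (h k r *P g (pmap k (tower l τ))) m ≡⟨ *P-congʳ (h k r) {g (pmap k (tower l τ))} {P *P g (pmap k τ)} (tw τ Cτ τ≤l bigτ) m ⟩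
      coeff (h k r *P (P *P g (pmap k τ))) m ≡⟨ *P-leftComm (h k r) P (g (pmap k τ)) m ⟩
      coeff (P *P (h k r *P g (pmap k τ))) m ≡⟨ *P-congʳ P {h k r *P g (pmap k τ)} {pieriRHS k g τ r} (pieri τ Cτ r r≤k) m ⟩
      coeff (P *P pieriRHS k g τ r) m ≡⟨ pieri-sum (coeff-*-additive P m) g τ r ⟩
      sumZ (λ x → K x ℤ.* Y x) W ∎
      where open ≡-Reasoning

    size≡r : size τ κ ≡ r
    size≡r = trans (cong (λ z → z ∸ klen k τ) (base-core-size {κ} {l} core len pos)) (m+n∸m≡n (klen k τ) (row κ l))

    others : ∀ {x} → x ∈ W → x ≢ κ → D x ≡ + 0
    others {x} x∈ ne with ≤-<-connex (size τ x) r
    ... | inj₂ lt = trans (cong (λ z → z ℤ.* (Δ x ℤ.- Y x)) (pieriCoeff-> {r} (rCount k x τ) lt)) (ℤₚ.*-zeroˡ (Δ x ℤ.- Y x))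
    ... | inj₁ le = trans (cong (K x ℤ.*_) (ℤₚ.i≡j⇒i-j≡0 {Δ x} {Y x} (rec x
          (record { core = M.core ; len = M.κ-length ; wide = λ i h → ≤-trans (bigτ i h) (proj₁ (Weak.row-tight M.weak i (<⇒≤ h))) })
          (base-core-top {κ} {l} core len pos x∈ le ne) m))) (ℤₚ.*-zeroʳ (K x))
      where
      module M = Member {τ} {l} Cτ τ≤l {x} x∈

    top-term : D κ ≡ Δ κ ℤ.- Y κ
    top-term = trans (cong (λ z → z ℤ.* (Δ κ ℤ.- Y κ)) (trans (cong (λ z → pieriCoeff r z (rCount k κ τ)) size≡r) (pieriCoeff-diag r (rCount k κ τ)))) (ℤₚ.*-identityˡ _)

    diff-zero : D κ ≡ + 0
    diff-zero = begin
      D κ ≡⟨ sym (sumZ-single (weakStrips-unique (core-partition {τ} Cτ)) κ∈ others) ⟩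
      sumZ D W ≡⟨ sumZ-cong W (λ { {x} _ → trans (ℤₚ.*-distribˡ-+ (K x) (Δ x) (ℤ.- Y x)) (cong (λ z → K x ℤ.* Δ x ℤ.+ z) (sym (ℤₚ.neg-distribʳ-* (K x) (Y x)))) }) ⟩
      sumZ (λ x → K x ℤ.* Δ x ℤ.+ ℤ.- (K x ℤ.* Y x)) W ≡⟨ trans (sumZ-+ _ _ W) (cong (λ z → sumZ (λ x → K x ℤ.* Δ x) W ℤ.+ z) (sumZ-neg _ W)) ⟩
      sumZ (λ x → K x ℤ.* Δ x) W ℤ.- sumZ (λ x → K x ℤ.* Y x) W ≡⟨ ℤₚ.i≡j⇒i-j≡0 pieri-equal ⟩
      + 0 ∎
      where open ≡-Reasoning

  factored : ∀ {l} → Tower l → ∀ κ → Long l κ → Factored l κ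
  factored {l} tw κ L = go (klen k κ) (suc (row κ l)) κ L (inj₂ (refl , ≤-refl))
    where
    top≤k : ∀ {κ} → Long l κ → row κ l ≤ k
    top≤k {κ} L = ≤-trans (≤-reflexive (sym (top-row C (beyond-top {κ} {l} (Long.core L) (Long.len L))))) (p≤k C l)
      where C = IsCore⇒IsC {κ} (Long.core L)
    -- Lexicographic induction on the length and the top row. When `u` is used up, `N` drops by one
    -- and `u` restarts at k + 1, because no top row exceeds k.
    go : ∀ N u κ → Long l κ → klen k κ < N ⊎ (klen k κ ≡ N × row κ l < u) → Factored l κ
    go N (suc u) κ L (inj₁ h) = go N u κ L (inj₁ h)
    go N (suc u) κ L (inj₂ (e , h)) = factored-step tw κ L λ κ′ L′ →
      λ { (inj₁ h′) → go N u κ′ L′ (inj₁ (≤-trans h′ (≤-reflexive e)))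
        ; (inj₂ (e′ , h′)) → go N u κ′ L′ (inj₂ (trans e′ e , ≤-trans h′ (≤-pred h))) }
    go zero zero κ L (inj₁ ())
    go zero zero κ L (inj₂ (_ , ()))
    go (suc N) zero κ L (inj₂ (_ , ()))
    go (suc N) zero κ L (inj₁ h) with m≤n⇒m<n∨m≡n (≤-pred h)
    ... | inj₁ h′ = go N (suc k) κ L (inj₁ h′)
    ... | inj₂ e = go N (suc k) κ L (inj₂ (e , s≤s (top≤k L)))

  Rpow-toList : toList S₀P (height (suc a)) ≡ Rpow k T′ (suc a)
  Rpow-toList = trans (toList-def S₀P (height (suc a))) (trans (go (suc a)) (cong (λ z → replicate (suc a * z) T′) N≡))
    where
    N≡ : N ≡ suc k ∸ T′
    N≡ = sym (trans (cong (λ z → suc z ∸ T′) (sym q+T)) (m+n∸n≡m N T′))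
    go : ∀ b → compress (pst b 0) (height b) ≡ replicate (b * N) T′
    go zero = refl
    go (suc b) = trans (compress-rep N T′ (pst b 0) (height b) 1≤T) (trans (cong (replicate N T′ ++_) (go b)) (sym (replicate-+ N (b * N) T′)))

  -- One part `T′` more at the bottom: the core of R_T^(b+1) ∪ (T) without its lowest row is the
  -- core of R_T^(b+1).
  st-shift : ∀ b x → st (suc b) T′ (suc x) ≡ st (suc b) 0 x
  st-shift b x with split q x
  st-shift b .(q + 0) | hi zero refl = trans (st-hi b T′ 0) (trans (st-head b T′) (trans (+-comm (b * T′) T′) (sym (top (q + 0) (≤-reflexive (+-identityʳ q))))))
    where
    top : ∀ i → i ≤ q → st (suc b) 0 i ≡ suc b * T′
    top zero h = +-identityʳ _
    top (suc i) h = st-mid b 0 i h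
  st-shift b .(q + suc y) | hi (suc y) refl = trans (st-hi b T′ (suc y)) (trans (next b y) (sym (trans (cong (st (suc b) 0) (+-suc q y)) (st-hi b 0 y))))
    where
    next : ∀ b y → st b T′ (suc y) ≡ st b 0 y
    next zero zero = refl
    next zero (suc y) = refl
    next (suc b) y = st-shift b y
  st-shift b zero | lo h = trans (st-mid b T′ 0 h) (sym (+-identityʳ _))
  st-shift b (suc x) | lo h = trans (st-mid b T′ (suc x) h) (sym (st-mid b 0 x (<⇒≤ h)))

  -- A part of size at least `T′` is sorted below the rectangles, so it can be counted among the
  -- rows on which they are stacked.
  upL-tower : ∀ {l κ} → length κ ≤ suc l → T′ ≤ row κ l → upL l κ ≡ tower (suc l) κ
  -- The tower over `suc l` rows lists one row more, and that row is empty.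
  upL-tower {l} {κ} len h = trans (toList-cong m same) (sym (trans (cong (toList F) (sym (+-comm m 1))) (toList-extend F m 1 zero-above)))
    where
    m = suc (l + (q + height a))
    shifted : ℕ → ℕ
    shifted i = row κ i + w
    F = stack (suc l) (row κ) S₀
    same : ∀ i → upF l (row κ) i ≡ F i
    same i with split l i
    ... | lo i<l = trans (glue-lo l shifted (sh (row κ l) (row κ l ⊓ T′)) i i<l) (sym (glue-lo (suc l) shifted S₀ i (m≤n⇒m≤1+n i<l)))
    ... | hi zero refl = trans (glue-hi l shifted (sh (row κ l) (row κ l ⊓ T′)) 0) (trans (+-comm w (row κ l)) (trans (cong (λ z → row κ z + w) (sym (+-identityʳ l)))
          (sym (glue-lo (suc l) shifted S₀ (l + 0) (s≤s (≤-reflexive (+-identityʳ l)))))))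
    ... | hi (suc x) refl = trans (glue-hi l shifted (sh (row κ l) (row κ l ⊓ T′)) (suc x)) (trans (cong (λ z → st (suc a) z (suc x)) (m≥n⇒m⊓n≡n h)) (trans (st-shift a x)
          (sym (trans (cong F (+-suc l x)) (glue-hi (suc l) shifted S₀ x)))))
    zero-above : ∀ i → m ≤ i → F i ≡ 0
    zero-above i le with split (suc l) i
    ... | lo i<l = ⊥-elim (<⇒≱ i<l (≤-trans (s≤s (m≤m+n l _)) le))
    ... | hi x refl with m≤n⇒m<n∨m≡n (+-cancelˡ-≤ (suc l) _ _ le)
    ...   | inj₁ h = trans (glue-hi (suc l) shifted S₀ x) (st-beyond (suc a) 0 x h)
    ...   | inj₂ e = trans (glue-hi (suc l) shifted S₀ x) (st-last (suc a) x (cong suc (sym e)))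

  tower-pmap : ∀ {τ l} → IsCore k τ → length τ ≡ l → (∀ i → i < l → T′ < bounded τ i) → pmap k (tower l τ) ≡ pmap k τ ++ Rpow k T′ (suc a)
  tower-pmap {τ} {l} Cτ τ≡l wide = begin
    pmap k (tower l τ) ≡⟨ pmap-toList (tower l τ) (suc l′) (m≤n⇒m≤1+n (tower-length {τ} {l} Cτ τ≤l big-rows)) ⟩
    toList (bounded (tower l τ)) (suc l′) ≡⟨ toList-cong (suc l′) (Realizes.bounded≡ (tower-realizes {τ} {l} Cτ τ≤l big-rows)) ⟩
    toList (baseP l (bounded τ)) (suc l′) ≡⟨ cong (toList (baseP l (bounded τ))) (sym (+-suc l (q + height a))) ⟩
    toList (baseP l (bounded τ)) (l + height (suc a)) ≡⟨ toList-glue l (bounded τ) S₀P (height (suc a)) ⟩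
    toList (bounded τ) l ++ toList S₀P (height (suc a)) ≡⟨ cong₂ _++_ (sym (pmap-toList τ l τ≤l)) Rpow-toList ⟩
    pmap k τ ++ Rpow k T′ (suc a) ∎
    where
    open ≡-Reasoning
    l′ = l + (q + height a)
    τ≤l : length τ ≤ l
    τ≤l = ≤-reflexive τ≡l
    big-rows : ∀ i → i < l → T′ < row τ i
    big-rows i h = ≤-trans (wide i h) (bounded≤row {τ} Cτ i)

  -- The last row is longer than `T′`, so the twisted value has no correction term and is the value
  -- at the tower over `suc l` rows. Thus `factored` for `l` rows is the claim for one row more.
  towers : ∀ l → Tower l
  towers zero [] Cτ _ wide m = trans (cong (λ z → coeff (g z) m) (tower-pmap {[]} {0} Cτ refl wide))
    (trans (sym (*P-identityʳ P m)) (*P-congʳ P {1P} {g []} (≈-sym {p = g []} {1P} g-empty) m))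
  towers (suc l) κ C len wide m = trans (trans (sym (cong (λ z → coeff (g (pmap k z)) m) (upL-tower {l} {κ} len (<⇒≤ T<s))))
      (sym (twisted-plain (λ p → coeff p m) {l} {κ} (λ t → <⇒≱ T<s (proj₂ (isMid⁻ {l} {κ} t))))))
      (factored (towers l) κ (record { core = C ; len = len ; wide = λ i h → wide i (m≤n⇒m≤1+n h) }) m)
    where
    T<s : T′ < row κ l
    T<s = ≤-trans (wide l ≤-refl) (bounded≤row {κ} C l)

  factor : ∀ μ → Partition μ → All (_≤ k) μ → All (T′ <_) μ → g (μ ++ Rpow k T′ (suc a)) ≈ P *P g μ
  factor μ Pμ μ≤k μ>T m = subst₂ (λ x y → coeff (g x) m ≡ coeff (P *P g y) m) (trans (tower-pmap {τ} {l} Cτ len wide) (cong (_++ Rpow k T′ (suc a)) pmap≡)) pmap≡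
      (towers l τ Cτ (≤-reflexive len) wide m)
    where
    l = length μ
    τ = coreOf μ
    all-row : ∀ {Q : ℕ → Set} {xs} → All Q xs → ∀ i → i < length xs → Q (row xs i)
    all-row (q ∷ _) zero h = q
    all-row (_ ∷ qs) (suc i) (s≤s h) = all-row qs i h
    first≤k : row μ 0 ≤ k
    first≤k with <-≤-connex 0 (length μ)
    ... | inj₁ h = all-row μ≤k 0 h
    ... | inj₂ h = ≤-trans (≤-reflexive (row-beyond μ 0 h)) z≤n
    C : IsC (row τ) (row μ)
    C = coreOf-IsC μ (Partition.anti Pμ) first≤k
    len : length τ ≡ l
    len = coreOf-length μ
    Cτ : IsCore k τ
    Cτ = IsC⇒IsCore {τ} C (record { anti = anti C ; pos = λ i h → ≤-trans (Partition.pos Pμ i (≤-trans h (≤-reflexive len))) (p≤f C i) })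
    bounded≡ : ∀ i → bounded τ i ≡ row μ i
    bounded≡ = IsC⇒bounded {τ} C
    wide : ∀ i → i < l → T′ < bounded τ i
    wide i h = ≤-trans (all-row μ>T i h) (≤-reflexive (sym (bounded≡ i)))
    pmap≡ : pmap k τ ≡ μ
    pmap≡ = trans (pmap-toList τ l (≤-reflexive len)) (trans (toList-cong l bounded≡) (toList-row Pμ))

insertD-block : ∀ x μ c → All (x <_) μ → insertD x (μ ++ replicate c x) ≡ μ ++ replicate (suc c) x
insertD-block x [] zero h = refl
insertD-block x [] (suc c) h with x ≤ᵇ x in eq
... | true = refl
... | false = ⊥-elim (subst T eq (≤⇒≤ᵇ (≤-refl {x})))
insertD-block x (y ∷ μ) c (h ∷ hs) with y ≤ᵇ x in eq
... | true = ⊥-elim (<⇒≱ h (≤ᵇ⇒≤ y x (subst T (sym eq) tt)))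
... | false = cong (y ∷_) (insertD-block x μ c hs)

∪P-block : ∀ x μ c → All (x <_) μ → replicate c x ∪P μ ≡ μ ++ replicate c x
∪P-block x μ zero h = sym (++-identityʳ μ)
∪P-block x μ (suc c) h = trans (cong (insertD x) (∪P-block x μ c h)) (insertD-block x μ c h)

partition-cons : ∀ {x κ} → row κ 0 ≤ x → 1 ≤ x → Partition κ → Partition (x ∷ κ)
partition-cons h 1≤x P = record
  { anti = λ { zero → h ; (suc i) → Partition.anti P i } ; pos = λ { zero _ → 1≤x ; (suc i) (s≤s l) → Partition.pos P i l } }

partition-block : ∀ x μ c → 1 ≤ x → All (x <_) μ → Partition μ → Partition (μ ++ replicate c x)
partition-block x [] zero 1≤x h P = P
partition-block x [] (suc c) 1≤x h P = partition-cons (first c) 1≤x (partition-block x [] c 1≤x [] P)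
  where first : ∀ c → row (replicate c x) 0 ≤ x
        first zero = z≤n
        first (suc c) = ≤-refl
partition-block x (y ∷ μ) c 1≤x (h ∷ hs) P = partition-cons (first μ c (Partition.anti P 0)) (≤-trans 1≤x (<⇒≤ h))
    (partition-block x μ c 1≤x hs (record { anti = Partition.anti P ∘ suc ; pos = λ i l → Partition.pos P (suc i) (s≤s l) }))
  where first : ∀ μ c → row μ 0 ≤ y → row (μ ++ replicate c x) 0 ≤ y
        first [] zero _ = z≤n
        first [] (suc c) _ = <⇒≤ h
        first (z ∷ μ) c h = h

map-allFin-suc : ∀ {A : Set} {m} (f : Fin (suc m) → A) → map f (allFin (suc m)) ≡ f Fin.zero ∷ map (f ∘ Fin.suc) (allFin m)
map-allFin-suc f = cong (f Fin.zero ∷_) (trans (map-tabulate Fin.suc f) (sym (map-tabulate (λ x → x) (f ∘ Fin.suc))))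

module _ (k : ℕ) (g : List ℕ → Poly k) (KS : IsKkSchur k g) where

  -- The product formula alone does not carry the induction: to put the next smaller rectangle on
  -- top, the union must be known to be a k-bounded partition with all parts larger.
  record Union {m} (t a : Fin m → ℕ) : Set where
    field
      partition : Partition (bigUnion m (λ i → Rpow k (t i) (a i)))
      ≤k : All (_≤ k) (bigUnion m (λ i → Rpow k (t i) (a i)))
      above : ∀ b → (∀ i → b < t i) → All (b <_) (bigUnion m (λ i → Rpow k (t i) (a i)))
      product : g (bigUnion m (λ i → Rpow k (t i) (a i))) ≈ prodP (map (λ i → g (Rpow k (t i) (a i))) (allFin m))

  union : ∀ m (t a : Fin m → ℕ) → (∀ i j → i Fin.< j → t i < t j) → (∀ i → 1 ≤ t i × t i ≤ k) → (∀ i → 1 ≤ a i) → Union t a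
  union zero t a inc bnd pos = record
    { partition = record { anti = λ _ → z≤n ; pos = λ _ () } ; ≤k = [] ; above = λ _ _ → [] ; product = IsKkSchur.g-empty KS }
  union (suc m) t a inc bnd pos = record
    { partition = subst Partition (sym whole≡) (partition-block x rest c (proj₁ (bnd Fin.zero)) rest>x U.partition)
    ; ≤k = subst (All (_≤ k)) (sym whole≡) (Allₚ.++⁺ U.≤k (Allₚ.replicate⁺ c (proj₂ (bnd Fin.zero))))
    ; above = λ b h → subst (All (b <_)) (sym whole≡) (Allₚ.++⁺ (U.above b (h ∘ Fin.suc)) (Allₚ.replicate⁺ c (h Fin.zero)))
    ; product = λ e → trans (cong (λ z → coeff (g z) e) whole≡) (trans (split-off m refl e)
        (trans (*P-congʳ (g (replicate c x)) {g rest} {prodP (map (G ∘ Fin.suc) (allFin m))} U.product e)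
          (cong (λ z → coeff (prodP z) e) (sym (map-allFin-suc G))))) }
    where
    t′ a′ : Fin m → ℕ
    t′ = t ∘ Fin.suc
    a′ = a ∘ Fin.suc
    module U = Union (union m t′ a′ (λ i j h → inc (Fin.suc i) (Fin.suc j) (s≤s h)) (bnd ∘ Fin.suc) (pos ∘ Fin.suc))
    x c : ℕ
    x = t Fin.zero
    c = a Fin.zero * (suc k ∸ x)
    G : Fin (suc m) → Poly k
    G i = g (Rpow k (t i) (a i))
    rest whole : List ℕ
    rest = bigUnion m (λ i → Rpow k (t′ i) (a′ i))
    whole = bigUnion (suc m) (λ i → Rpow k (t i) (a i))
    rest>x : All (x <_) rest
    rest>x = U.above x (λ i → inc Fin.zero (Fin.suc i) (s≤s z≤n))
    whole≡ : whole ≡ rest ++ replicate c x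
    whole≡ = trans (cong (L.foldr _∪P_ []) (map-allFin-suc (λ i → Rpow k (t i) (a i)))) (∪P-block x rest c rest>x)
    -- A single rectangle may have t = k and needs only the value at ∅. Otherwise a larger rectangle
    -- bounds x < k. `Factors` handles the exponent `suc a`, hence the ∸ 1 below.
    split-off : ∀ m′ → m ≡ m′ → g (rest ++ replicate c x) ≈ g (replicate c x) *P g rest
    split-off zero refl e = trans (sym (*P-identityʳ (g (replicate c x)) e)) (*P-congʳ (g (replicate c x)) {1P} {g []} (≈-sym {p = g []} {1P} (IsKkSchur.g-empty KS)) e)
    split-off (suc m′) refl e = subst (λ z → coeff (g (rest ++ replicate (z * (suc k ∸ x)) x)) e ≡ coeff (g (replicate (z * (suc k ∸ x)) x) *P g rest) e)
        (m+[n∸m]≡n (pos Fin.zero))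
        (Factors.factor k x (k ∸ x) (m∸n+n≡m (<⇒≤ x<k)) (proj₁ (bnd Fin.zero)) (m<n⇒0<n∸m x<k) (a Fin.zero ∸ 1) g KS rest U.partition U.≤k rest>x e)
      where
      x<k : x < k
      x<k = ≤-trans (inc Fin.zero (Fin.suc Fin.zero) (s≤s z≤n)) (proj₂ (bnd (Fin.suc Fin.zero)))

theorem5p8 : (k : ℕ) → 1 ≤ k → (g : List ℕ → Poly k) → IsKkSchur k g →
    (m : ℕ) → 1 ≤ m → (t a : Fin m → ℕ) →
    (∀ i j → i Fin.< j → t i < t j) →
    (∀ i → 1 ≤ t i × t i ≤ k) →
    (∀ i → 1 ≤ a i) →
    g (bigUnion m (λ i → Rpow k (t i) (a i)))
    ≈ prodP (map (λ i → g (Rpow k (t i) (a i))) (allFin m))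
theorem5p8 k _ g KS m _ t a inc bnd pos = Union.product (union k g KS m t a inc bnd pos)
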